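{- For every integer $n\ge 1$, $$A_n(t,0,q)=\sum_{k=1}^{\lfloor n/2\rfloor}\Bigl(\sum_{\sigma\in\widetilde{\mathfrak{D}}_{n,k}} q^{\mathrm{inv}(\sigma)}\Bigr)\, t^k(1+t)^{n-2k}.$$
   Context: $\mathfrak{S}_n$ is the set of permutations $\sigma=\sigma_1\cdots\sigma_n$ of $[n]$. For $\sigma\in\mathfrak{S}_n$: $\mathrm{exc}(\sigma)=|\{i:\sigma_i>i\}|$, $\mathrm{fix}(\sigma)=|\{i:\sigma_i=i\}|$, $\mathrm{maj}(\sigma)=\sum_{i:\sigma_i>\sigma_{i+1}} i$, $\mathrm{des}(\sigma)=|\{i\in[n-1]:\sigma_i>\sigma_{i+1}\}|$, $\mathrm{inv}(\sigma)=|\{(i,j):i<j,\ \sigma_i>\sigma_j\}|$. $A_n(t,r,q)=\sum_{\sigma\in\mathfrak{S}_n} t^{\mathrm{exc}(\sigma)}r^{\mathrm{fix}(\sigma)}q^{\mathrm{maj}(\sigma)-\mathrm{exc}(\sigma)}$ (so $A_n(t,0,q)$ sums over derangements). With $\sigma_0=\sigma_{n+1}=+\infty$, $\sigma_i$ is a double descent if $\sigma_{i-1}>\sigma_i>\sigma_{i+1}$; $\mathrm{dd}(\sigma)$ counts them. $\mathfrak{D}_{n,k}=\{\sigma\in\mathfrak{S}_n:\mathrm{dd}(\sigma)=0,\ \mathrm{des}(\sigma)=k\}$ and $\widetilde{\mathfrak{D}}_{n,k}=\{\sigma\in\mathfrak{D}_{n,k-1}:\sigma_{n-1}<\sigma_n\}$.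 -}

module Defs where

open import Level using (Level)
open import Data.Nat using (ℕ; zero; suc; _∸_; _<ᵇ_; _≡ᵇ_; _/_)
import Data.Nat as Nat
open Nat using () renaming (_+_ to _+ℕ_)
open import Data.Bool using (Bool; true; false; _∧_; not; if_then_else_; T)
open import Data.Bool.Properties using (T?)
open import Data.Maybe using (Maybe; just; nothing)
open import Data.List using (List; []; _∷_; map; concatMap; filter; upTo)
open import Algebra.Bundles using (CommutativeSemiring)

-- Permutations of [n] = {1,…,n} in one-line notation σ = σ₁ ⋯ σₙ,
-- represented as lists of natural numbers.

range : ℕ → List ℕ
range n = map suc (upTo n)

words : ℕ → ℕ → List (List ℕ)
words n zero    = [] ∷ []
words n (suc m) = concatMap (λ a → map (a ∷_) (words n m)) (range n)

elemᵇ : ℕ → List ℕ → Bool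
elemᵇ a []       = false
elemᵇ a (b ∷ bs) = if a ≡ᵇ b then true else elemᵇ a bs

distinctᵇ : List ℕ → Bool
distinctᵇ []       = true
distinctᵇ (a ∷ as) = not (elemᵇ a as) ∧ distinctᵇ as

-- 𝔖ₙ : the words of length n over [n] with no repeated letter
-- (each permutation listed exactly once)
perms : ℕ → List (List ℕ)
perms n = filter (λ w → T? (distinctᵇ w)) (words n n)

ind : Bool → ℕ
ind true  = 1
ind false = 0

exc-from : ℕ → List ℕ → ℕ
exc-from i []       = 0
exc-from i (a ∷ as) = ind (i <ᵇ a) +ℕ exc-from (suc i) as

exc : List ℕ → ℕ
exc = exc-from 1

fix-from : ℕ → List ℕ → ℕ
fix-from i []       = 0
fix-from i (a ∷ as) = ind (i ≡ᵇ a) +ℕ fix-from (suc i) as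

fix : List ℕ → ℕ
fix = fix-from 1

maj-from : ℕ → List ℕ → ℕ
maj-from i []           = 0
maj-from i (a ∷ [])     = 0
maj-from i (a ∷ b ∷ as) = (if b <ᵇ a then i else 0) +ℕ maj-from (suc i) (b ∷ as)

maj : List ℕ → ℕ
maj = maj-from 1

des : List ℕ → ℕ
des []           = 0
des (a ∷ [])     = 0
des (a ∷ b ∷ as) = ind (b <ᵇ a) +ℕ des (b ∷ as)

smaller : ℕ → List ℕ → ℕ
smaller a []       = 0
smaller a (b ∷ bs) = ind (b <ᵇ a) +ℕ smaller a bs

inv : List ℕ → ℕ
inv []       = 0
inv (a ∷ as) = smaller a as +ℕ inv as

-- Values in ℕ ∪ {+∞}: nothing = +∞
_<∞_ : ℕ → Maybe ℕ → Bool
a <∞ nothing = true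
a <∞ just b  = a <ᵇ b

-- dd-from p σ : double descents of σ where p is the letter preceding the head
-- (p = +∞ at the start); σ_{n+1} = +∞, so the last letter is never a double descent.
dd-from : Maybe ℕ → List ℕ → ℕ
dd-from p []           = 0
dd-from p (a ∷ [])     = 0
dd-from p (a ∷ b ∷ as) = ind ((a <∞ p) ∧ (b <ᵇ a)) +ℕ dd-from (just a) (b ∷ as)

dd : List ℕ → ℕ
dd = dd-from nothing

lastAscent : List ℕ → Bool
lastAscent []               = false
lastAscent (a ∷ [])         = false
lastAscent (a ∷ b ∷ [])     = a <ᵇ b
lastAscent (a ∷ b ∷ c ∷ as) = lastAscent (b ∷ c ∷ as)

Dtilde : ℕ → ℕ → List (List ℕ)
Dtilde n k = filter (λ σ → T? (((dd σ ≡ᵇ 0) ∧ (des σ ≡ᵇ (k ∸ 1))) ∧ lastAscent σ)) (perms n)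

-- Evaluation of the polynomials in an arbitrary commutative semiring
-- (a polynomial identity in ℕ[t,q] holds iff it holds for all t, q in
-- every commutative semiring).

module Eval {c ℓ : Level} (R : CommutativeSemiring c ℓ) where
  open CommutativeSemiring R

  pow : Carrier → ℕ → Carrier
  pow x zero    = 1#
  pow x (suc m) = x * pow x m

  Σ[_]_ : {A : Set} → List A → (A → Carrier) → Carrier
  Σ[ [] ] f     = 0#
  Σ[ x ∷ xs ] f = f x + Σ[ xs ] f

  -- A_n(t, r, q) = Σ_{σ ∈ 𝔖ₙ} t^exc r^fix q^(maj - exc)
  -- (maj σ ≥ exc σ always holds, so truncated subtraction is exact)
  A : ℕ → Carrier → Carrier → Carrier → Carrier
  A n t r q = Σ[ perms n ] (λ σ → pow t (exc σ) * (pow r (fix σ) * pow q (maj σ ∸ exc σ)))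

  RHS : ℕ → Carrier → Carrier → Carrier
  RHS n t q = Σ[ range (n / 2) ] (λ k →
                (Σ[ Dtilde n k ] (λ σ → pow q (inv σ))) * (pow t k * pow (1# + t) (n ∸ (k +ℕ k))))

{-# OPTIONS --safe #-}
module Submission where

-- Write [k] = 1 + t + ⋯ + tᵏ⁻¹ and (q)ₙ = (1 − q)(1 − q²)⋯(1 − qⁿ). Over a ring in which every 1 − qⁱ
-- is invertible, both sides divided by (q)ₙ are the coefficient of zⁿ in 1 / K₀ (sol 0), where
--   K_u = 1 − Σ_{k ≥ 1} (t [k−1] + u [k]) zᵏ / (q)ₖ.
-- Taking the ring ℤ[[t]][[q]] and comparing coefficients yields the identity in every semiring.
--
-- Right side: σ contributes iff all its ascending runs have length at least 2, and the factor
-- t (1+t)ᵐ⁻² of a run of length m is the sum, over all ways to cut the run into blocks, of the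
-- product of the weights t [k−1] of the blocks of length k. Splitting off the first block of σ
-- produces a q-binomial coefficient, hence the recursion of 1 / K₀.
--
-- Left side (after Shareshian and Wachs): bar the excedances and put the barred letters before the
-- others. The descents of the barred word add up to maj − exc, and q to that power is the sum, over
-- the sets T containing these descents, of the product of qⁱ for i ∈ T and 1 − qⁱ for i ∉ T. Let T cut
-- the positions into blocks of sizes b. The derangements whose barred word ascends on every block
-- amount to labellings of the values by signed blocks, in which each value v may independently use the
-- labels of a linear form Λ_v in variables y_j, one for each block. So they are counted by P_b(0)
-- (Pcoef), where P_b(u) = [yᵇ] ∏_v (Λ_v + u Y) and Y = Σ y_j. Eliminating the variable of a last block
-- of size k turns P_(b,k)(u) into a combination of the coefficients of P_b(u + η (1+u)(t+u)) in η, and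
-- 1 / K_u solves the recursion obtained by summing over b.

open import Defs
open import Algebra.Bundles using (CommutativeRing; CommutativeSemiring; RawRing)
open import Algebra.Solver.Ring.AlmostCommutativeRing using (_-Raw-AlmostCommutative⟶_; fromCommutativeRing)
open import Data.Bool using (Bool; _∧_; false; if_then_else_; not; true)
open import Data.Bool.Properties using (T-≡; T?; ∧-identityʳ; ∧-zeroʳ)
open import Data.Empty using (⊥-elim)
import Data.Integer as ℤ
import Data.Integer.Properties as ℤ
open import Data.List using (List; []; _++_; _∷_; _∷ʳ_; applyUpTo; concatMap; filter; length; map; reverse; upTo)
open import Data.List.Properties using (++-assoc; length-++; length-applyUpTo; length-map; length-reverse; map-upTo; reverse-involutive; unfold-reverse)
open import Data.List.Relation.Unary.All as All using (All; []; _∷_)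
import Data.List.Relation.Unary.All.Properties as All
open import Data.List.Relation.Unary.AllPairs as AllPairs using (AllPairs; []; _∷_)
import Data.List.Relation.Unary.AllPairs.Properties as AllPairs
open import Data.List.Relation.Unary.Unique.Propositional using (Unique)
import Data.List.Relation.Unary.Unique.Propositional.Properties as Unique
open import Data.Maybe using (Maybe; just; nothing)
import Data.Nat as ℕ
open import Data.Nat using (_/_; _<_; _<ᵇ_; _>_; _∸_; _≡ᵇ_; _≤_; _≥_; suc; s≤s; zero; z≤n; ℕ)
open import Data.Nat.DivMod using (/-monoˡ-≤; m*n/n≡m)
import Data.Nat.Properties as ℕ
open import Data.Nat.Solver using (module +-*-Solver)
open import Data.Product using (_,_; _×_; proj₁; proj₂; Σ-syntax)
open import Data.Product.Properties using (≡-dec)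
open import Data.Sum using (_⊎_; inj₁; inj₂)
open import Function using (Equivalence; _∘_; id)
open import Level using (Level)
open import Relation.Binary using (tri<; tri>; tri≈)
open import Relation.Binary.PropositionalEquality as ≡ using (_≡_; _≢_)
open import Relation.Nullary using (contradiction; no; yes)

-- Eliminating the last block does not lead back to the same u, so no recursion closes at u = 0. Let
-- y be its variable. The values beyond the other blocks carry (t + u) Y, the smaller values carry
-- (1 + u) y, and extracting the power of y pairs one with the other: u moves by λ = (1 + u)(t + u)
-- times a new variable η. Every block costs such a variable, hence the closed form is proved for
-- all rings and all u at once, and its step over R uses the statement over R[[η]]. The step closes
-- because K_u is affine in u. The inverse of K_(u + ηλ) is a geometric series in η with
-- coefficients f θᵈ, where f = 1 / K_u and θ is a series divisible by z, so taking coefficients in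
-- η amounts to setting η = θ in the product of the γ + η over the weights γ of the block. The
-- factor qⁱ of a cut replaces z by qz. There remains a q-difference equation between f(z) and
-- f(qz), which follows from H(qz) = (1 - z) H(z) for H = Σ zⁿ / (q)ₙ and from its analogue for M =
-- Σ [n] zⁿ / (q)ₙ. Inverses and signs exist only in rings, so the passage to semirings compares
-- both sides as multisets of monomials.

-- Integer coefficients for the ring solver, as formal differences of naturals.
module DifferenceSolver {c ℓ : Level} (R : CommutativeRing c ℓ) where
  open CommutativeRing R
  open import Algebra.Properties.Semiring.Mult semiring using (×-homo-+; ×1-homo-*) renaming (_×_ to _⊗_)
  open import Algebra.Properties.Ring ring using (-‿+-comm; -‿distribˡ-*; -‿distribʳ-*; -‿involutive; -0#≈0#)
  open import Algebra.Solver.Ring.NaturalCoefficients.Default commutativeSemiring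
    using (_:+_; _:*_; _:=_) renaming (solve to solveℕ)
  open import Relation.Binary.Reasoning.Setoid setoid
  open import Algebra.Properties.CommutativeSemigroup +-commutativeSemigroup using () renaming (interchange to +-interchange)

  private
    normalise : ℕ × ℕ → ℕ × ℕ
    normalise (suc a , suc b) = normalise (a , b)
    normalise x               = x

    differences : RawRing Level.zero Level.zero
    differences = record
      { Carrier = ℕ × ℕ
      ; _≈_ = _≡_
      ; _+_ = λ { (a , b) (c , d) → normalise (a ℕ.+ c , b ℕ.+ d) }
      ; _*_ = λ { (a , b) (c , d) → normalise (a ℕ.* c ℕ.+ b ℕ.* d , a ℕ.* d ℕ.+ b ℕ.* c) }
      ; -_ = λ { (a , b) → (b , a) }
      ; 0# = (0 , 0)
      ; 1# = (1 , 0) }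

    difference : ℕ × ℕ → Carrier
    difference (a , b) = a ⊗ 1# + - (b ⊗ 1#)

    difference-normalise : ∀ x → difference (normalise x) ≈ difference x
    difference-normalise (0 , b)         = refl
    difference-normalise (suc a , 0)     = refl
    difference-normalise (suc a , suc b) = trans (difference-normalise (a , b)) (sym (begin
      (1# + A) + - (1# + B)    ≈⟨ +-congˡ (-‿+-comm _ _) ⟨
      (1# + A) + (- 1# + - B)  ≈⟨ +-interchange _ _ _ _ ⟩
      (1# + - 1#) + (A + - B)  ≈⟨ +-congʳ (-‿inverseʳ 1#) ⟩
      0# + (A + - B)           ≈⟨ +-identityˡ _ ⟩
      A + - B                  ∎))
      where
      A B : Carrier
      A = a ⊗ 1#
      B = b ⊗ 1#

    +-homo : ∀ x y → difference (RawRing._+_ differences x y) ≈ difference x + difference y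
    +-homo (a , b) (c , d) = begin
      difference (normalise (a ℕ.+ c , b ℕ.+ d))
        ≈⟨ difference-normalise (a ℕ.+ c , b ℕ.+ d) ⟩
      (a ℕ.+ c) ⊗ 1# + - ((b ℕ.+ d) ⊗ 1#)
        ≈⟨ +-cong (×-homo-+ 1# a c) (-‿cong (×-homo-+ 1# b d)) ⟩
      (a ⊗ 1# + c ⊗ 1#) + - (b ⊗ 1# + d ⊗ 1#)
        ≈⟨ +-congˡ (-‿+-comm _ _) ⟨
      (a ⊗ 1# + c ⊗ 1#) + (- (b ⊗ 1#) + - (d ⊗ 1#))
        ≈⟨ +-interchange _ _ _ _ ⟩
      difference (a , b) + difference (c , d) ∎

    *-homo : ∀ x y → difference (RawRing._*_ differences x y) ≈ difference x * difference y
    *-homo (a , b) (c , d) = begin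
      difference (normalise (a ℕ.* c ℕ.+ b ℕ.* d , a ℕ.* d ℕ.+ b ℕ.* c))
        ≈⟨ difference-normalise (a ℕ.* c ℕ.+ b ℕ.* d , a ℕ.* d ℕ.+ b ℕ.* c) ⟩
      (a ℕ.* c ℕ.+ b ℕ.* d) ⊗ 1# + - ((a ℕ.* d ℕ.+ b ℕ.* c) ⊗ 1#)
        ≈⟨ +-cong (trans (×-homo-+ 1# (a ℕ.* c) (b ℕ.* d)) (+-cong (×1-homo-* a c) (×1-homo-* b d)))
                  (-‿cong (trans (×-homo-+ 1# (a ℕ.* d) (b ℕ.* c)) (+-cong (×1-homo-* a d) (×1-homo-* b c)))) ⟩
      (A * C + B * D) + - (A * D + B * C)
        ≈⟨ +-cong (+-congˡ minus²) (sym (-‿+-comm _ _)) ⟩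
      (A * C + - B * - D) + (- (A * D) + - (B * C))
        ≈⟨ +-congˡ (+-cong (-‿distribʳ-* A D) (-‿distribˡ-* B C)) ⟩
      (A * C + - B * - D) + (A * - D + - B * C)
        ≈⟨ solveℕ 4 (λ x y z w → (x :* z :+ y :* w) :+ (x :* w :+ y :* z) := (x :+ y) :* (z :+ w)) refl A (- B) C (- D) ⟩
      (A + - B) * (C + - D) ∎
      where
      A B C D : Carrier
      A = a ⊗ 1#
      B = b ⊗ 1#
      C = c ⊗ 1#
      D = d ⊗ 1#
      minus² : B * D ≈ - B * - D
      minus² = begin
        B * D        ≈⟨ -‿involutive _ ⟨
        - - (B * D)  ≈⟨ -‿cong (-‿distribʳ-* B D) ⟩
        - (B * - D)  ≈⟨ -‿distribˡ-* B (- D) ⟩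
        - B * - D    ∎

    -- Agrees with difference, but the literal 1 evaluates to 1# definitionally.
    value : ℕ × ℕ → Carrier
    value (1 , 0) = 1#
    value x       = difference x

    value≈ : ∀ x → value x ≈ difference x
    value≈ (0 , _)             = refl
    value≈ (1 , 0)             = sym (trans (+-cong (+-identityʳ 1#) -0#≈0#) (+-identityʳ 1#))
    value≈ (1 , suc _)         = refl
    value≈ (suc (suc _) , _)   = refl

    morphism : differences -Raw-AlmostCommutative⟶ fromCommutativeRing R
    morphism = record
      { ⟦_⟧    = value
      ; +-homo = λ x y → trans (value≈ (RawRing._+_ differences x y)) (trans (+-homo x y) (sym (+-cong (value≈ x) (value≈ y))))
      ; *-homo = λ x y → trans (value≈ (RawRing._*_ differences x y)) (trans (*-homo x y) (sym (*-cong (value≈ x) (value≈ y))))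
      ; -‿homo = λ { (a , b) → trans (value≈ (b , a)) (trans (begin
          b ⊗ 1# + - (a ⊗ 1#)        ≈⟨ +-comm _ _ ⟩
          - (a ⊗ 1#) + b ⊗ 1#        ≈⟨ +-congˡ (-‿involutive _) ⟨
          - (a ⊗ 1#) + - - (b ⊗ 1#)  ≈⟨ -‿+-comm _ _ ⟩
          - (a ⊗ 1# + - (b ⊗ 1#))    ∎) (-‿cong (sym (value≈ (a , b))))) }
      ; 0-homo = -‿inverseʳ 0#
      ; 1-homo = refl }

    decide : ∀ x y → Maybe (value x ≈ value y)
    decide x y with ≡-dec ℕ._≟_ ℕ._≟_ x y
    ... | yes e = just (reflexive (≡.cong value e))
    ... | no _  = nothing

  open import Algebra.Solver.Ring differences (fromCommutativeRing R) morphism decide public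

  :1 : ∀ {n} → Polynomial n
  :1 = con (1 , 0)

-- The algebraic identity behind the q-difference equation

module KeyIdentity {c ℓ : Level} (R : CommutativeRing c ℓ) where
  open CommutativeRing R
  open DifferenceSolver R
  open import Relation.Binary.Reasoning.Setoid setoid

  -- In the application z is the variable of the series, `H` and `M` are the series of 1 / (q)ₙ and
  -- [n] / (q)ₙ, and a prime stands for the substitution of qz for z. Then f = 1 / K_u, and `X` sums
  -- the contributions of all lengths of the last block.
  module _ (z t u H M H′ M′ f f′ g : Carrier)
    (H-eq : H′ ≈ H + - (z * H)) (M-eq : M′ ≈ M + - (z * H + t * z * M))
    (f-eq : f * (H + - ((1# + u) * M)) ≈ 1#)
    (f′-eq : f′ * (H′ + - ((1# + u) * M′)) ≈ 1#)
    (g-eq : g * (1# + - (z * ((1# + u) * (t + u) * M′ * f′ + (1# + t + u)))) ≈ 1#) where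

    private
      θ : Carrier
      θ = (1# + u) * (t + u) * M′ * f′

      X : Carrier
      X = 1# + z * ((u + θ) + z * ((t + u + θ) * (1# + u + θ)) * g)

      -- With a = u + θ one has (t + a)(1 + a) = t + a (1 + t + a), and g z (1 + t + a) = g - 1 by
      -- the equation of `g`; the terms linear in a then cancel.
      X-eq : X ≈ g * ((1# + - z) * (1# + - (t * z)))
      X-eq = begin
        X ≈⟨ solve 5 (λ z t u θ g → :1 :+ z :* ((u :+ θ) :+ z :* ((t :+ u :+ θ) :* (:1 :+ u :+ θ)) :* g) :=
                 :1 :+ z :* (u :+ θ) :+ t :* z :* z :* g :+ z :* (u :+ θ) :* g :- z :* (u :+ θ) :* (g :* (:1 :- z :* (θ :+ (:1 :+ t :+ u))))) refl z t u θ g ⟩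
        1# + z * (u + θ) + t * z * z * g + z * (u + θ) * g - z * (u + θ) * (g * (1# - z * (θ + (1# + t + u))))
          ≈⟨ +-cong (+-congʳ (+-congʳ (+-congʳ (sym g-eq)))) (-‿cong (*-congˡ g-eq)) ⟩
        g * (1# - z * (θ + (1# + t + u))) + z * (u + θ) + t * z * z * g + z * (u + θ) * g - z * (u + θ) * 1#
          ≈⟨ solve 5 (λ z t u θ g → g :* (:1 :- z :* (θ :+ (:1 :+ t :+ u))) :+ z :* (u :+ θ) :+ t :* z :* z :* g :+ z :* (u :+ θ) :* g :- z :* (u :+ θ) :* :1 :=
                 g :* ((:1 :+ :- z) :* (:1 :+ :- (t :* z)))) refl z t u θ g ⟩
        g * ((1# + - z) * (1# + - (t * z))) ∎

      v K : Carrier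
      v = 1# + u
      K = H + - (v * M)

      -- Multiplied by `f′`, the right side becomes 1 - z (θ + 1 + t + u), which is the inverse of
      -- `g`.
      shifted : (1# + - z) * (1# + - (t * z)) * K ≈
                (H′ + - (v * M′)) * (1# + - (z * (1# + t + u))) + - (z * (v * (t + u) * M′))
      shifted = begin
        (1# + - z) * (1# + - (t * z)) * K
          ≈⟨ solve 5 (λ z t u H M → (:1 :+ :- z) :* (:1 :+ :- (t :* z)) :* (H :+ :- ((:1 :+ u) :* M)) :=
               ((H :+ :- (z :* H)) :+ :- ((:1 :+ u) :* (M :+ :- (z :* H :+ t :* z :* M)))) :* (:1 :+ :- (z :* (:1 :+ t :+ u)))
               :+ :- (z :* ((:1 :+ u) :* (t :+ u) :* (M :+ :- (z :* H :+ t :* z :* M))))) refl z t u H M ⟩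
        ((H + - (z * H)) + - (v * (M + - (z * H + t * z * M)))) * (1# + - (z * (1# + t + u)))
          + - (z * (v * (t + u) * (M + - (z * H + t * z * M))))
          ≈⟨ +-cong (*-congʳ (+-cong (sym H-eq) (-‿cong (*-congˡ (sym M-eq))))) (-‿cong (*-congˡ (*-congˡ (sym M-eq)))) ⟩
        (H′ + - (v * M′)) * (1# + - (z * (1# + t + u))) + - (z * (v * (t + u) * M′)) ∎

      inverse : f′ * X * K ≈ 1#
      inverse = begin
        f′ * X * K
          ≈⟨ *-congʳ (*-congˡ X-eq) ⟩
        f′ * (g * ((1# + - z) * (1# + - (t * z)))) * K
          ≈⟨ solve 4 (λ a b c d → a :* (b :* c) :* d := b :* (a :* (c :* d))) refl f′ g _ K ⟩
        g * (f′ * ((1# + - z) * (1# + - (t * z)) * K))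
          ≈⟨ *-congˡ (*-congˡ shifted) ⟩
        g * (f′ * ((H′ + - (v * M′)) * (1# + - (z * (1# + t + u))) + - (z * (v * (t + u) * M′))))
          ≈⟨ *-congˡ (solve 5 (λ a b c d e → a :* (b :* c :+ :- (d :* e)) := (a :* b) :* c :+ :- (d :* (e :* a)))
                     refl f′ _ _ z _) ⟩
        g * ((f′ * (H′ + - (v * M′))) * (1# + - (z * (1# + t + u))) + - (z * θ))
          ≈⟨ *-congˡ (+-congʳ (*-congʳ f′-eq)) ⟩
        g * (1# * (1# + - (z * (1# + t + u))) + - (z * θ))
          ≈⟨ *-congˡ (solve 3 (λ z a b → :1 :* (:1 :+ :- (z :* a)) :+ :- (z :* b) := :1 :+ :- (z :* (b :+ a))) refl z _ θ) ⟩
        g * (1# + - (z * (θ + (1# + t + u))))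
          ≈⟨ g-eq ⟩
        1# ∎

    -- Both sides are inverse to `K`.
    key-identity : f′ * X ≈ f
    key-identity = begin
      f′ * X              ≈⟨ *-identityʳ _ ⟨
      f′ * X * 1#         ≈⟨ *-congˡ f-eq ⟨
      f′ * X * (f * K)    ≈⟨ solve 3 (λ a b c → a :* (b :* c) := b :* (a :* c)) refl (f′ * X) f K ⟩
      f * (f′ * X * K)    ≈⟨ *-congˡ inverse ⟩
      f * 1#              ≈⟨ *-identityʳ f ⟩
      f                   ∎

-- Finite sums, formal power series and products of linear factors

module ListSums {c ℓ : Level} (S : CommutativeSemiring c ℓ) where
  open CommutativeSemiring S
  open Eval S using (pow; Σ[_]_)
  open import Relation.Binary.Reasoning.Setoid setoid
  open import Algebra.Properties.CommutativeSemigroup +-commutativeSemigroup using (interchange)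

  pow-+ : ∀ x m n → pow x (m ℕ.+ n) ≈ pow x m * pow x n
  pow-+ x zero    n = sym (*-identityˡ _)
  pow-+ x (suc m) n = trans (*-congˡ (pow-+ x m n)) (sym (*-assoc _ _ _))

  Σ-cong : {A : Set} (xs : List A) {f g : A → Carrier} → (∀ x → f x ≈ g x) → Σ[ xs ] f ≈ Σ[ xs ] g
  Σ-cong []       h = refl
  Σ-cong (x ∷ xs) h = +-cong (h x) (Σ-cong xs h)

  Σ-congᴬ : {A : Set} {P : A → Set} {xs : List A} {f g : A → Carrier} →
            All P xs → (∀ {x} → P x → f x ≈ g x) → Σ[ xs ] f ≈ Σ[ xs ] g
  Σ-congᴬ []       h = refl
  Σ-congᴬ (p ∷ ps) h = +-cong (h p) (Σ-congᴬ ps h)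

  Σ-++ : {A : Set} (xs ys : List A) (f : A → Carrier) → Σ[ xs ++ ys ] f ≈ Σ[ xs ] f + Σ[ ys ] f
  Σ-++ []       ys f = sym (+-identityˡ _)
  Σ-++ (x ∷ xs) ys f = trans (+-congˡ (Σ-++ xs ys f)) (sym (+-assoc _ _ _))

  Σ-map : {A B : Set} (h : A → B) (xs : List A) (f : B → Carrier) → Σ[ map h xs ] f ≈ Σ[ xs ] (λ x → f (h x))
  Σ-map h []       f = refl
  Σ-map h (x ∷ xs) f = +-congˡ (Σ-map h xs f)

  Σ-concatMap : {A B : Set} (h : A → List B) (xs : List A) (f : B → Carrier) →
                Σ[ concatMap h xs ] f ≈ Σ[ xs ] (λ x → Σ[ h x ] f)
  Σ-concatMap h []       f = refl
  Σ-concatMap h (x ∷ xs) f = trans (Σ-++ (h x) _ f) (+-congˡ (Σ-concatMap h xs f))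

  Σ-zero : {A : Set} (xs : List A) → Σ[ xs ] (λ _ → 0#) ≈ 0#
  Σ-zero []       = refl
  Σ-zero (x ∷ xs) = trans (+-identityˡ _) (Σ-zero xs)

  Σ-+ : {A : Set} (xs : List A) (f g : A → Carrier) → Σ[ xs ] (λ x → f x + g x) ≈ Σ[ xs ] f + Σ[ xs ] g
  Σ-+ []       f g = sym (+-identityˡ _)
  Σ-+ (x ∷ xs) f g = trans (+-congˡ (Σ-+ xs f g)) (interchange _ _ _ _)

  Σ-*ˡ : {A : Set} (a : Carrier) (xs : List A) (f : A → Carrier) → Σ[ xs ] (λ x → a * f x) ≈ a * Σ[ xs ] f
  Σ-*ˡ a []       f = sym (zeroʳ a)
  Σ-*ˡ a (x ∷ xs) f = trans (+-congˡ (Σ-*ˡ a xs f)) (sym (distribˡ _ _ _))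

  Σ-*ʳ : {A : Set} (a : Carrier) (xs : List A) (f : A → Carrier) → Σ[ xs ] (λ x → f x * a) ≈ Σ[ xs ] f * a
  Σ-*ʳ a []       f = sym (zeroˡ a)
  Σ-*ʳ a (x ∷ xs) f = trans (+-congˡ (Σ-*ʳ a xs f)) (sym (distribʳ _ _ _))

  Σ-swap : {A B : Set} (xs : List A) (ys : List B) (f : A → B → Carrier) →
           Σ[ xs ] (λ x → Σ[ ys ] (f x)) ≈ Σ[ ys ] (λ y → Σ[ xs ] (λ x → f x y))
  Σ-swap []       ys f = sym (Σ-zero ys)
  Σ-swap (x ∷ xs) ys f = trans (+-congˡ (Σ-swap xs ys f)) (sym (Σ-+ ys _ _))

  Σ≤ : ℕ → (ℕ → Carrier) → Carrier
  Σ≤ zero    f = f 0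
  Σ≤ (suc n) f = f 0 + Σ≤ n (λ k → f (suc k))

  Σ≤-cong : ∀ n {f g : ℕ → Carrier} → (∀ k → f k ≈ g k) → Σ≤ n f ≈ Σ≤ n g
  Σ≤-cong zero    h = h 0
  Σ≤-cong (suc n) h = +-cong (h 0) (Σ≤-cong n (λ k → h (suc k)))

  Σ≤-cong≤ : ∀ n {f g : ℕ → Carrier} → (∀ k → k ≤ n → f k ≈ g k) → Σ≤ n f ≈ Σ≤ n g
  Σ≤-cong≤ zero    h = h 0 z≤n
  Σ≤-cong≤ (suc n) h = +-cong (h 0 z≤n) (Σ≤-cong≤ n (λ k l → h (suc k) (s≤s l)))

  Σ≤-+ : ∀ n (f g : ℕ → Carrier) → Σ≤ n (λ k → f k + g k) ≈ Σ≤ n f + Σ≤ n g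
  Σ≤-+ zero    f g = refl
  Σ≤-+ (suc n) f g = trans (+-congˡ (Σ≤-+ n _ _)) (interchange _ _ _ _)

  Σ≤-*ˡ : ∀ n (a : Carrier) (f : ℕ → Carrier) → Σ≤ n (λ k → a * f k) ≈ a * Σ≤ n f
  Σ≤-*ˡ zero    a f = refl
  Σ≤-*ˡ (suc n) a f = trans (+-congˡ (Σ≤-*ˡ n a _)) (sym (distribˡ _ _ _))

  Σ≤-zero : ∀ n → Σ≤ n (λ _ → 0#) ≈ 0#
  Σ≤-zero zero    = refl
  Σ≤-zero (suc n) = trans (+-identityˡ _) (Σ≤-zero n)

  Σ≤-last : ∀ n (f : ℕ → Carrier) → Σ≤ (suc n) f ≈ Σ≤ n f + f (suc n)
  Σ≤-last zero    f = refl
  Σ≤-last (suc n) f = trans (+-congˡ (Σ≤-last n _)) (sym (+-assoc _ _ _))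

  Σ-Σ≤-swap : {A : Set} (xs : List A) (n : ℕ) (f : A → ℕ → Carrier) →
              Σ[ xs ] (λ x → Σ≤ n (f x)) ≈ Σ≤ n (λ k → Σ[ xs ] (λ x → f x k))
  Σ-Σ≤-swap []       n f = sym (Σ≤-zero n)
  Σ-Σ≤-swap (x ∷ xs) n f = trans (+-congˡ (Σ-Σ≤-swap xs n f)) (sym (Σ≤-+ n _ _))

module PowerSeries {c ℓ : Level} (R : CommutativeRing c ℓ) where
  open CommutativeRing R
  open ListSums commutativeSemiring
  open import Relation.Binary.Reasoning.Setoid setoid
  open import Algebra.Properties.CommutativeSemigroup +-commutativeSemigroup using (interchange)

  Series : Set c
  Series = ℕ → Carrier

  tail : Series → Series
  tail f n = f (suc n)

  mul : Series → Series → Series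
  mul f g zero    = f 0 * g 0
  mul f g (suc n) = f 0 * g (suc n) + mul (tail f) g n

  lin : Carrier → Carrier → Series
  lin a b zero          = a
  lin a b (suc zero)    = b
  lin a b (suc (suc n)) = 0#

  const : Carrier → Series
  const a = lin a 0#

  mul-cong : ∀ {f f′ g g′ : Series} → (∀ n → f n ≈ f′ n) → (∀ n → g n ≈ g′ n) → ∀ n → mul f g n ≈ mul f′ g′ n
  mul-cong p q zero    = *-cong (p 0) (q 0)
  mul-cong p q (suc n) = +-cong (*-cong (p 0) (q (suc n))) (mul-cong (λ k → p (suc k)) q n)

  mul-sucʳ : ∀ f g n → mul f g (suc n) ≈ mul f (tail g) n + f (suc n) * g 0
  mul-sucʳ f g zero    = refl
  mul-sucʳ f g (suc n) = trans (+-congˡ (mul-sucʳ (tail f) g n)) (sym (+-assoc _ _ _))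

  mul-comm : ∀ f g n → mul f g n ≈ mul g f n
  mul-comm f g zero    = *-comm _ _
  mul-comm f g (suc n) = begin
    f 0 * g (suc n) + mul (tail f) g n  ≈⟨ +-cong (*-comm _ _) (mul-comm (tail f) g n) ⟩
    g (suc n) * f 0 + mul g (tail f) n  ≈⟨ +-comm _ _ ⟩
    mul g (tail f) n + g (suc n) * f 0  ≈⟨ mul-sucʳ g f n ⟨
    mul g f (suc n)                     ∎

  mul-distribʳ : ∀ h f g n → mul (λ k → f k + g k) h n ≈ mul f h n + mul g h n
  mul-distribʳ h f g zero    = distribʳ _ _ _
  mul-distribʳ h f g (suc n) =
    trans (+-cong (distribʳ _ _ _) (mul-distribʳ h (tail f) (tail g) n)) (interchange _ _ _ _)

  mul-scale : ∀ a f g n → mul (λ k → a * f k) g n ≈ a * mul f g n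
  mul-scale a f g zero    = *-assoc _ _ _
  mul-scale a f g (suc n) = trans (+-cong (*-assoc _ _ _) (mul-scale a (tail f) g n)) (sym (distribˡ _ _ _))

  mul-assoc : ∀ f g h n → mul (mul f g) h n ≈ mul f (mul g h) n
  mul-assoc f g h zero    = *-assoc _ _ _
  mul-assoc f g h (suc n) = begin
    f 0 * g 0 * h (suc n) + mul (tail (mul f g)) h n
      ≈⟨ +-congˡ (mul-distribʳ h (λ k → f 0 * g (suc k)) (mul (tail f) g) n) ⟩
    f 0 * g 0 * h (suc n) + (mul (λ k → f 0 * g (suc k)) h n + mul (mul (tail f) g) h n)
      ≈⟨ +-cong (*-assoc _ _ _) (+-cong (mul-scale (f 0) (tail g) h n) (mul-assoc (tail f) g h n)) ⟩
    f 0 * (g 0 * h (suc n)) + (f 0 * mul (tail g) h n + mul (tail f) (mul g h) n)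
      ≈⟨ +-assoc _ _ _ ⟨
    f 0 * (g 0 * h (suc n)) + f 0 * mul (tail g) h n + mul (tail f) (mul g h) n
      ≈⟨ +-congʳ (distribˡ _ _ _) ⟨
    f 0 * mul g h (suc n) + mul (tail f) (mul g h) n ∎

  mul-zeroˡ : ∀ g n → mul (λ _ → 0#) g n ≈ 0#
  mul-zeroˡ g zero    = zeroˡ _
  mul-zeroˡ g (suc n) = trans (+-cong (zeroˡ _) (mul-zeroˡ g n)) (+-identityˡ _)

  lin-mul-suc : ∀ a b f n → mul (lin a b) f (suc n) ≈ a * f (suc n) + b * f n
  lin-mul-suc a b f zero    = refl
  lin-mul-suc a b f (suc n) = +-congˡ (trans (+-congˡ (mul-zeroˡ f n)) (+-identityʳ _))

  const-mul : ∀ a f n → mul (const a) f n ≈ a * f n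
  const-mul a f zero    = refl
  const-mul a f (suc n) = trans (lin-mul-suc a 0# f n) (trans (+-congˡ (zeroˡ _)) (+-identityʳ _))

  mul-identityˡ : ∀ f n → mul (const 1#) f n ≈ f n
  mul-identityˡ f n = trans (const-mul 1# f n) (*-identityˡ _)

  mul-Σ≤ : ∀ f g n → mul f g n ≈ Σ≤ n (λ k → f k * g (n ℕ.∸ k))
  mul-Σ≤ f g zero    = refl
  mul-Σ≤ f g (suc n) = +-congˡ (mul-Σ≤ (tail f) g n)

PS : {c ℓ : Level} → CommutativeRing c ℓ → CommutativeRing c ℓ
PS R = record
  { Carrier = Series
  ; _≈_ = λ f g → ∀ n → f n ≈ g n
  ; _+_ = λ f g n → f n + g n
  ; _*_ = mul
  ; -_ = λ f n → - f n
  ; 0# = λ _ → 0#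
  ; 1# = const 1#
  ; isCommutativeRing = record
    { isRing = record
      { +-isAbelianGroup = record
        { isGroup = record
          { isMonoid = record
            { isSemigroup = record
              { isMagma = record
                { isEquivalence = record
                  { refl = λ _ → refl
                  ; sym = λ p n → sym (p n)
                  ; trans = λ p q n → trans (p n) (q n) }
                ; ∙-cong = λ p q n → +-cong (p n) (q n) }
              ; assoc = λ f g h n → +-assoc _ _ _ }
            ; identity = (λ f n → +-identityˡ _) , (λ f n → +-identityʳ _) }
          ; inverse = (λ f n → -‿inverseˡ _) , (λ f n → -‿inverseʳ _)
          ; ⁻¹-cong = λ p n → -‿cong (p n) }
        ; comm = λ f g n → +-comm _ _ }
      ; *-cong = mul-cong
      ; *-assoc = mul-assoc
      ; *-identity = mul-identityˡ , (λ f n → trans (mul-comm f _ n) (mul-identityˡ f n))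
      ; distrib = (λ h f g n → trans (mul-comm h _ n) (trans (mul-distribʳ h f g n)
                    (+-cong (mul-comm f h n) (mul-comm g h n))))
                , mul-distribʳ }
    ; *-comm = mul-comm } }
  where
  open CommutativeRing R
  open PowerSeries R

<ᵇ-true : ∀ {m n} → m < n → (m <ᵇ n) ≡ true
<ᵇ-true m<n = Equivalence.to T-≡ (ℕ.<⇒<ᵇ m<n)

<ᵇ-false : ∀ {m n} → n ≤ m → (m <ᵇ n) ≡ false
<ᵇ-false {m} {n} n≤m with m <ᵇ n in eq
... | false = ≡.refl
... | true  = ⊥-elim (ℕ.≤⇒≯ n≤m (ℕ.<ᵇ⇒< m n (Equivalence.from T-≡ eq)))

module RingProducts {c ℓ : Level} (R : CommutativeRing c ℓ) where
  open CommutativeRing R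

  Π : {a : Level} {A : Set a} → List A → (A → Carrier) → Carrier
  Π []       f = 1#
  Π (x ∷ xs) f = f x * Π xs f

  Π-cong : {a : Level} {A : Set a} (xs : List A) {f g : A → Carrier} → (∀ x → f x ≈ g x) → Π xs f ≈ Π xs g
  Π-cong []       h = refl
  Π-cong (x ∷ xs) h = *-cong (h x) (Π-cong xs h)

  Π-congᴬ : {A : Set} {P : A → Set} {xs : List A} {f g : A → Carrier} →
            All P xs → (∀ {x} → P x → f x ≈ g x) → Π xs f ≈ Π xs g
  Π-congᴬ []       h = refl
  Π-congᴬ (p ∷ ps) h = *-cong (h p) (Π-congᴬ ps h)

  -- The linear functional θᵈ ↦ a d applied to the polynomial ∏ (γ + θ), γ ∈ γs.
  umbral : List Carrier → (ℕ → Carrier) → Carrier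
  umbral []       a = a 0
  umbral (γ ∷ γs) a = umbral γs (λ n → γ * a n + a (suc n))

  umbral-cong : ∀ γs {a b : ℕ → Carrier} → (∀ n → a n ≈ b n) → umbral γs a ≈ umbral γs b
  umbral-cong []       h = h 0
  umbral-cong (γ ∷ γs) h = umbral-cong γs (λ n → +-cong (*-congˡ (h n)) (h (suc n)))

record IsHom {c ℓ c′ ℓ′ : Level} (A : CommutativeRing c ℓ) (B : CommutativeRing c′ ℓ′)
             (⟦_⟧ : CommutativeRing.Carrier A → CommutativeRing.Carrier B) : Set (c Level.⊔ ℓ Level.⊔ c′ Level.⊔ ℓ′) where
  private
    module A = CommutativeRing A
    module B = CommutativeRing B
  field
    ⟦⟧-cong : ∀ {x y} → x A.≈ y → ⟦ x ⟧ B.≈ ⟦ y ⟧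
    +-homo  : ∀ x y → ⟦ x A.+ y ⟧ B.≈ ⟦ x ⟧ B.+ ⟦ y ⟧
    *-homo  : ∀ x y → ⟦ x A.* y ⟧ B.≈ ⟦ x ⟧ B.* ⟦ y ⟧
    1-homo  : ⟦ A.1# ⟧ B.≈ B.1#

  Π-homo : {i : Level} {I : Set i} (xs : List I) (f : I → A.Carrier) →
           ⟦ RingProducts.Π A xs f ⟧ B.≈ RingProducts.Π B xs (λ x → ⟦ f x ⟧)
  Π-homo []       f = 1-homo
  Π-homo (x ∷ xs) f = B.trans (*-homo _ _) (B.*-congˡ (Π-homo xs f))

  mul-homo : ∀ (f g : ℕ → A.Carrier) n →
             ⟦ PowerSeries.mul A f g n ⟧ B.≈ PowerSeries.mul B (λ k → ⟦ f k ⟧) (λ k → ⟦ g k ⟧) n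
  mul-homo f g zero    = *-homo _ _
  mul-homo f g (suc n) = B.trans (+-homo _ _) (B.+-cong (*-homo _ _) (mul-homo (λ k → f (suc k)) g n))

module SeriesLemmas {c ℓ : Level} (R : CommutativeRing c ℓ) where
  open CommutativeRing R
  open ListSums commutativeSemiring
  open Eval commutativeSemiring using (pow)
  open PowerSeries R
  open RingProducts R using (umbral; umbral-cong)
  open RingProducts (PS R) using (Π)
  module P = CommutativeRing (PS R)
  open import Relation.Binary.Reasoning.Setoid setoid
  open import Algebra.Properties.CommutativeSemigroup *-commutativeSemigroup using (x∙yz≈y∙xz; interchange)

  scale : Carrier → Series → Series
  scale q f n = pow q n * f n

  scale-mul : ∀ q f g n → scale q (mul f g) n ≈ mul (scale q f) (scale q g) n
  scale-mul q f g zero    = begin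
    1# * (f 0 * g 0)        ≈⟨ *-congʳ (*-identityˡ 1#) ⟨
    1# * 1# * (f 0 * g 0)   ≈⟨ interchange _ _ _ _ ⟩
    1# * f 0 * (1# * g 0)   ∎
  scale-mul q f g (suc n) = begin
    q * pow q n * (f 0 * g (suc n) + mul (tail f) g n)
      ≈⟨ distribˡ _ _ _ ⟩
    q * pow q n * (f 0 * g (suc n)) + q * pow q n * mul (tail f) g n
      ≈⟨ +-cong (trans (x∙yz≈y∙xz _ _ _) (*-congʳ (sym (*-identityˡ _)))) (*-assoc _ _ _) ⟩
    1# * f 0 * (q * pow q n * g (suc n)) + q * (pow q n * mul (tail f) g n)
      ≈⟨ +-congˡ (*-congˡ (scale-mul q (tail f) g n)) ⟩
    1# * f 0 * (q * pow q n * g (suc n)) + q * mul (scale q (tail f)) (scale q g) n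
      ≈⟨ +-congˡ (mul-scale q _ _ n) ⟨
    1# * f 0 * (q * pow q n * g (suc n)) + mul (λ k → q * (pow q k * f (suc k))) (scale q g) n
      ≈⟨ +-congˡ (mul-cong (λ k → sym (*-assoc _ _ _)) (λ k → refl) n) ⟩
    1# * f 0 * (q * pow q n * g (suc n)) + mul (tail (scale q f)) (scale q g) n ∎

  scale-lin : ∀ q a b n → scale q (lin a b) n ≈ lin a (q * b) n
  scale-lin q a b zero          = *-identityˡ a
  scale-lin q a b (suc zero)    = *-congʳ (*-identityʳ q)
  scale-lin q a b (suc (suc n)) = zeroʳ _

  lin-cong : ∀ {a a′ b b′} → a ≈ a′ → b ≈ b′ → ∀ n → lin a b n ≈ lin a′ b′ n
  lin-cong p q zero          = p
  lin-cong p q (suc zero)    = q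
  lin-cong p q (suc (suc n)) = refl

  scale-isHom : ∀ q → IsHom (PS R) (PS R) (scale q)
  scale-isHom q = record
    { ⟦⟧-cong = λ p n → *-congˡ (p n)
    ; +-homo  = λ f g n → distribˡ _ _ _
    ; *-homo  = scale-mul q
    ; 1-homo  = λ n → trans (scale-lin q 1# 0# n) (lin-cong refl (zeroʳ q) n) }

  lin-+ : ∀ a b a′ b′ n → lin a b n + lin a′ b′ n ≈ lin (a + a′) (b + b′) n
  lin-+ a b a′ b′ zero          = refl
  lin-+ a b a′ b′ (suc zero)    = refl
  lin-+ a b a′ b′ (suc (suc n)) = +-identityˡ _

  const-+ : ∀ a b n → const a n + const b n ≈ const (a + b) n
  const-+ a b n = trans (lin-+ a 0# b 0# n) (lin-cong refl (+-identityˡ 0#) n)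

  const-lin : ∀ a b b′ n → mul (const a) (lin b b′) n ≈ lin (a * b) (a * b′) n
  const-lin a b b′ zero          = refl
  const-lin a b b′ (suc zero)    = const-mul a (lin b b′) 1
  const-lin a b b′ (suc (suc n)) = trans (const-mul a (lin b b′) (suc (suc n))) (zeroʳ a)

  Πlin-degree : ∀ τ γs n → length γs < n → Π γs (lin τ) n ≈ 0#
  Πlin-degree τ []       (suc zero)    _       = refl
  Πlin-degree τ []       (suc (suc n)) _       = refl
  Πlin-degree τ (γ ∷ γs) (suc n)       (s≤s l) = begin
    mul (lin τ γ) (Π γs (lin τ)) (suc n)               ≈⟨ lin-mul-suc τ γ _ n ⟩
    τ * Π γs (lin τ) (suc n) + γ * Π γs (lin τ) n      ≈⟨ +-cong (*-congˡ (Πlin-degree τ γs (suc n) (ℕ.m<n⇒m<1+n l))) (*-congˡ (Πlin-degree τ γs n l)) ⟩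
    τ * 0# + γ * 0#                                    ≈⟨ +-cong (zeroʳ _) (zeroʳ _) ⟩
    0# + 0#                                            ≈⟨ +-identityˡ _ ⟩
    0#                                                 ∎

  -- The exponent equals the number of factors τ + γ y. If d factors supply τ, the missing yᵈ must
  -- come from `A`, so the coefficient is the product of the γ + θ with θᵈ read as τᵈ times the d-th
  -- coefficient of `A`.
  coeff-Πlin : ∀ τ γs (A : Series) → mul A (Π γs (lin τ)) (length γs) ≈ umbral γs (scale τ A)
  coeff-Πlin τ []       A = *-comm _ _
  coeff-Πlin τ (γ ∷ γs) A = begin
    mul A (mul (lin τ γ) B) (suc (length γs))
      ≈⟨ P.*-assoc A (lin τ γ) B (suc (length γs)) ⟨
    mul (mul A (lin τ γ)) B (suc (length γs))
      ≈⟨ mul-cong (P.*-comm A (lin τ γ)) (λ _ → refl) (suc (length γs)) ⟩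
    mul (lin τ γ) A 0 * B (suc (length γs)) + mul (tail (mul (lin τ γ) A)) B (length γs)
      ≈⟨ +-congʳ (trans (*-congˡ (Πlin-degree τ γs _ ℕ.≤-refl)) (zeroʳ _)) ⟩
    0# + mul (tail (mul (lin τ γ) A)) B (length γs)
      ≈⟨ +-identityˡ _ ⟩
    mul (tail (mul (lin τ γ) A)) B (length γs)
      ≈⟨ coeff-Πlin τ γs _ ⟩
    umbral γs (scale τ (tail (mul (lin τ γ) A)))
      ≈⟨ umbral-cong γs step ⟩
    umbral γs (λ n → γ * scale τ A n + scale τ A (suc n)) ∎
    where
    B : Series
    B = Π γs (lin τ)
    step : ∀ n → scale τ (tail (mul (lin τ γ) A)) n ≈ γ * scale τ A n + scale τ A (suc n)
    step n = begin
      pow τ n * mul (lin τ γ) A (suc n)                    ≈⟨ *-congˡ (lin-mul-suc τ γ A n) ⟩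
      pow τ n * (τ * A (suc n) + γ * A n)                  ≈⟨ distribˡ _ _ _ ⟩
      pow τ n * (τ * A (suc n)) + pow τ n * (γ * A n)      ≈⟨ +-cong (trans (x∙yz≈y∙xz _ _ _) (sym (*-assoc _ _ _))) (x∙yz≈y∙xz _ _ _) ⟩
      τ * pow τ n * A (suc n) + γ * (pow τ n * A n)        ≈⟨ +-comm _ _ ⟩
      γ * (pow τ n * A n) + τ * pow τ n * A (suc n)        ∎

  module Double where
    module PP = PowerSeries (PS R)

    Σ≤-at : ∀ n (F : ℕ → Series) k → ListSums.Σ≤ P.commutativeSemiring n F k ≡ Σ≤ n (λ i → F i k)
    Σ≤-at zero    F k = ≡.refl
    Σ≤-at (suc n) F k = ≡.cong (F 0 k +_) (Σ≤-at n (λ i → F (suc i)) k)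

    Σ≤-swap : ∀ m n (f : ℕ → ℕ → Carrier) → Σ≤ m (λ i → Σ≤ n (f i)) ≈ Σ≤ n (λ j → Σ≤ m (λ i → f i j))
    Σ≤-swap zero    n f = refl
    Σ≤-swap (suc m) n f = trans (+-congˡ (Σ≤-swap m n (λ i → f (suc i)))) (sym (Σ≤-+ n _ _))

    mul-expand : ∀ (f g : ℕ → Series) d n →
      PP.mul f g d n ≈ Σ≤ d (λ i → Σ≤ n (λ j → f i j * g (d ℕ.∸ i) (n ℕ.∸ j)))
    mul-expand f g d n = begin
      PP.mul f g d n                                                ≈⟨ PP.mul-Σ≤ f g d n ⟩
      ListSums.Σ≤ P.commutativeSemiring d (λ i → mul (f i) (g (d ℕ.∸ i))) n  ≡⟨ Σ≤-at d _ n ⟩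
      Σ≤ d (λ i → mul (f i) (g (d ℕ.∸ i)) n)                        ≈⟨ Σ≤-cong d (λ i → mul-Σ≤ (f i) _ n) ⟩
      Σ≤ d (λ i → Σ≤ n (λ j → f i j * g (d ℕ.∸ i) (n ℕ.∸ j)))       ∎

    -- A double series may be multiplied with either variable outermost. This is what moves η past
    -- one block variable after the other.
    mul-transpose : ∀ (f g : ℕ → Series) d n →
      PP.mul f g d n ≈ PP.mul (λ j i → f i j) (λ j i → g i j) n d
    mul-transpose f g d n = begin
      PP.mul f g d n                                            ≈⟨ mul-expand f g d n ⟩
      Σ≤ d (λ i → Σ≤ n (λ j → f i j * g (d ℕ.∸ i) (n ℕ.∸ j)))   ≈⟨ Σ≤-swap d n _ ⟩
      Σ≤ n (λ j → Σ≤ d (λ i → f i j * g (d ℕ.∸ i) (n ℕ.∸ j)))   ≈⟨ mul-expand _ _ n d ⟨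
      PP.mul (λ j i → f i j) (λ j i → g i j) n d                ∎

-- Linear forms in the block variables, and elimination of the last one

-- A composition lists its parts from the last block to the first; the entry k
-- stands for a block of suc k positions, so that every block is nonempty.
size : List ℕ → ℕ
size []      = 0
size (k ∷ b) = suc k ℕ.+ size b

desc : ℕ → List ℕ
desc zero    = []
desc (suc n) = suc n ∷ desc n

desc≤ : ∀ n → All (_≤ n) (desc n)
desc≤ zero    = []
desc≤ (suc n) = ℕ.≤-refl ∷ All.map ℕ.m≤n⇒m≤1+n (desc≤ n)

-- R[[y₁]]⋯[[yₘ]] with one variable for each block.
Tower : {c ℓ : Level} → CommutativeRing c ℓ → List ℕ → CommutativeRing c ℓ
Tower R []      = R
Tower R (k ∷ b) = PS (Tower R b)

module TowerOps {c ℓ : Level} (R : CommutativeRing c ℓ) where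
  open CommutativeRing R
  open RingProducts R using (umbral; umbral-cong)
  module 𝕋 (b : List ℕ) = CommutativeRing (Tower R b)

  coef : ∀ b → 𝕋.Carrier b → Carrier
  coef []      x = x
  coef (k ∷ b) x = coef b (x (suc k))

  ι : ∀ b → Carrier → 𝕋.Carrier b
  ι []      a = a
  ι (k ∷ b) a = PowerSeries.const (Tower R b) (ι b a)

  Y : ∀ b → 𝕋.Carrier b
  Y []      = 0#
  Y (k ∷ b) = PowerSeries.lin (Tower R b) (Y b) (𝕋.1# b)

  coef-cong : ∀ b {x y} → 𝕋._≈_ b x y → coef b x ≈ coef b y
  coef-cong []      p = p
  coef-cong (k ∷ b) p = coef-cong b (p (suc k))

  coef-+ : ∀ b x y → coef b (𝕋._+_ b x y) ≈ coef b x + coef b y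
  coef-+ []      x y = refl
  coef-+ (k ∷ b) x y = coef-+ b (x (suc k)) (y (suc k))

  coef-0 : ∀ b → coef b (𝕋.0# b) ≈ 0#
  coef-0 []      = refl
  coef-0 (k ∷ b) = coef-0 b

  coef-ι : ∀ b a x → coef b (𝕋._*_ b (ι b a) x) ≈ a * coef b x
  coef-ι []      a x = refl
  coef-ι (k ∷ b) a x = trans (coef-cong b (PowerSeries.const-mul (Tower R b) (ι b a) x (suc k))) (coef-ι b a (x (suc k)))

  ι-cong : ∀ b {x y} → x ≈ y → 𝕋._≈_ b (ι b x) (ι b y)
  ι-cong []      p = p
  ι-cong (k ∷ b) p = SeriesLemmas.lin-cong (Tower R b) (ι-cong b p) (𝕋.refl b)

  ι-0 : ∀ b → 𝕋._≈_ b (ι b 0#) (𝕋.0# b)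
  ι-0 []                  = refl
  ι-0 (k ∷ b) zero          = ι-0 b
  ι-0 (k ∷ b) (suc zero)    = 𝕋.refl b
  ι-0 (k ∷ b) (suc (suc n)) = 𝕋.refl b

  ι-1 : ∀ b → 𝕋._≈_ b (ι b 1#) (𝕋.1# b)
  ι-1 []      = refl
  ι-1 (k ∷ b) = SeriesLemmas.lin-cong (Tower R b) (ι-1 b) (𝕋.refl b)

  ι-+ : ∀ b x y → 𝕋._≈_ b (ι b (x + y)) (𝕋._+_ b (ι b x) (ι b y))
  ι-+ []      x y = refl
  ι-+ (k ∷ b) x y n = T.trans (lin-cong (ι-+ b x y) (T.sym (T.+-identityˡ _)) n) (T.sym (lin-+ _ _ _ _ n))
    where
    module T = CommutativeRing (Tower R b)
    open SeriesLemmas (Tower R b)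

  ι-* : ∀ b x y → 𝕋._≈_ b (ι b (x * y)) (𝕋._*_ b (ι b x) (ι b y))
  ι-* []      x y = refl
  ι-* (k ∷ b) x y n = T.trans (lin-cong (ι-* b x y) (T.sym (T.zeroʳ _)) n) (T.sym (const-lin _ _ _ n))
    where
    module T = CommutativeRing (Tower R b)
    open SeriesLemmas (Tower R b)

  coef-umbral : ∀ b γs a → coef b (RingProducts.umbral (Tower R b) (map (ι b) γs) a) ≈ umbral γs (λ d → coef b (a d))
  coef-umbral b []       a = refl
  coef-umbral b (γ ∷ γs) a = trans (coef-umbral b γs _)
    (umbral-cong γs (λ d → trans (coef-+ b _ _) (+-congʳ (coef-ι b γ (a d)))))

  module Forms (t : Carrier) where

    -- The coefficient in the linear form of the value v of the block occupying
    -- the positions p + 1, …, p + k + 1: such a v may be placed as an excedance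
    -- unless v ≤ p + 1, and as an anti-excedance unless v ≥ p + k + 1.
    w : ℕ → ℕ → ℕ → Carrier
    w p k v = (if v <ᵇ (suc k ℕ.+ p) then 1# else 0#) + (if suc p <ᵇ v then t else 0#)

    Λ : ∀ b → ℕ → 𝕋.Carrier b
    Λ []      v = 0#
    Λ (k ∷ b) v = PowerSeries.lin (Tower R b) (Λ b v) (ι b (w (size b) k v))

    w-lower : ∀ p k v → v ≤ p → w p k v ≈ 1#
    w-lower p k v v≤p
      rewrite <ᵇ-true (s≤s (ℕ.≤-trans v≤p (ℕ.m≤n+m p k))) | <ᵇ-false {suc p} {v} (ℕ.m≤n⇒m≤1+n v≤p) = +-identityʳ 1#

    w-upper : ∀ p k v → suc k ℕ.+ p < v → w p k v ≈ t
    w-upper p k v l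
      rewrite <ᵇ-false {v} {suc k ℕ.+ p} (ℕ.<⇒≤ l)
            | <ᵇ-true {suc p} {v} (ℕ.≤-trans (s≤s (s≤s (ℕ.m≤n+m p k))) l) = +-identityˡ t

    Pcoef : Carrier → List ℕ → Carrier
    Pcoef u b = coef b (RingProducts.Π (Tower R b) (desc (size b)) (λ v → T._+_ (Λ b v) (T._*_ (ι b u) (Y b))))
      where module T = CommutativeRing (Tower R b)

    -- A value beyond all positions is an excedance wherever it is placed.
    Λ-upper : ∀ b v → size b < v → 𝕋._≈_ b (Λ b v) (𝕋._*_ b (ι b t) (Y b))
    Λ-upper []      v l = sym (zeroʳ t)
    Λ-upper (k ∷ b) v l n = T.trans
      (lin-cong (Λ-upper b v (ℕ.≤-<-trans (ℕ.m≤n+m (size b) (suc k)) l))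
                (T.trans (ι-cong b (w-upper (size b) k v l)) (T.sym (T.*-identityʳ _))) n)
      (T.sym (const-lin _ _ _ n))
      where
      module T = CommutativeRing (Tower R b)
      open SeriesLemmas (Tower R b)

    -- These belong to the values numbered like the positions of the block itself. For all other
    -- values `w` is constantly 1 (`w-lower`) or t (`w-upper`).
    topWeights : Carrier → ℕ → ℕ → ℕ → List Carrier
    topWeights u p k zero    = []
    topWeights u p k (suc i) = (w p k (suc i ℕ.+ p) + u) ∷ topWeights u p k i

    length-topWeights : ∀ u p k i → length (topWeights u p k i) ≡ i
    length-topWeights u p k zero    = ≡.refl
    length-topWeights u p k (suc i) = ≡.cong suc (length-topWeights u p k i)

    λ′ : Carrier → Carrier
    λ′ u = (1# + u) * (t + u)

    -- The coefficient of ηᵈ in P_b(u + η λ′), with η kept outside the tower; `Pcoef-marked` moves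
    -- it into the ground ring.
    marked : Carrier → List ℕ → ℕ → Carrier
    marked u b d = coef b (RingProducts.Π (PS (Tower R b)) (desc (size b))
      (λ v → PowerSeries.lin (Tower R b) (Λ b v T.+ ι b u T.* Y b) (ι b (λ′ u) T.* Y b)) d)
      where module T = CommutativeRing (Tower R b)

    module _ (u : Carrier) (k : ℕ) (b : List ℕ) where
      private
        B = Tower R b
        module B = CommutativeRing B
        module B⁺ = CommutativeRing (Tower R (k ∷ b))
        module BS = PowerSeries B
        open SeriesLemmas B
        open RingProducts (PS B) using (Π; Π-congᴬ)
        open RingProducts B using () renaming (umbral to umbralᴮ)

        form : ℕ → B⁺.Carrier
        form v = Λ (k ∷ b) v B⁺.+ ι (k ∷ b) u B⁺.* Y (k ∷ b)

        τ : B.Carrier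
        τ = ι b (t + u) B.* Y b

        lowForm : ℕ → B⁺.Carrier
        lowForm v = BS.lin (Λ b v B.+ ι b u B.* Y b) (ι b (1# + u))

        form-lin : ∀ v n → form v n B.≈ BS.lin (Λ b v B.+ ι b u B.* Y b) (ι b (w (size b) k v + u)) n
        form-lin v n = B.trans (B.+-congˡ (const-lin _ _ _ n)) (B.trans (lin-+ _ _ _ _ n)
          (lin-cong B.refl (B.trans (B.+-congˡ (B.*-identityʳ _)) (B.sym (ι-+ b _ _))) n))

        form-low : ∀ {v} → v ≤ size b → form v B⁺.≈ lowForm v
        form-low {v} l n = B.trans (form-lin v n) (lin-cong B.refl (ι-cong b (+-congʳ (w-lower (size b) k v l))) n)

        form-top : ∀ v → size b < v → form v B⁺.≈ BS.lin τ (ι b (w (size b) k v + u))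
        form-top v l n = B.trans (form-lin v n) (lin-cong
          (B.trans (B.+-congʳ (Λ-upper b v l)) (B.trans (B.sym (B.distribʳ _ _ _)) (B.*-congʳ (B.sym (ι-+ b t u)))))
          B.refl n)

        Π-split : ∀ i → Π (desc (i ℕ.+ size b)) form B⁺.≈
                  Π (desc (size b)) lowForm B⁺.* Π (map (ι b) (topWeights u (size b) k i)) (BS.lin τ)
        Π-split zero    = B⁺.trans (Π-congᴬ (desc≤ (size b)) form-low) (B⁺.sym (B⁺.*-identityʳ _))
        Π-split (suc i) = B⁺.trans
          (B⁺.*-cong (form-top (suc i ℕ.+ size b) (s≤s (ℕ.m≤n+m _ i))) (Π-split i))
          (x∙yz≈y∙xz _ _ _)
          where open import Algebra.Properties.CommutativeSemigroup B⁺.*-commutativeSemigroup using (x∙yz≈y∙xz)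

      -- The k + 1 values above `size b` give factors τ + γ y with τ = (t + u) Y, exactly as many as
      -- the exponent of y, so `coeff-Πlin` applies. It puts τ η in place of y in the factors of the
      -- lower values, and turns their (1 + u) y into λ′ Y η.
      Pcoef-eliminate′ : Pcoef u (k ∷ b) ≈ umbral (topWeights u (size b) k (suc k)) (marked u b)
      Pcoef-eliminate′ = begin
        coef b (Π (desc (suc k ℕ.+ size b)) form (suc k))
          ≈⟨ coef-cong b (Π-split (suc k) (suc k)) ⟩
        coef b (BS.mul low (Π (map (ι b) γs) (BS.lin τ)) (suc k))
          ≡⟨ ≡.cong (λ m → coef b (BS.mul low (Π (map (ι b) γs) (BS.lin τ)) m)) (≡.sym len) ⟩
        coef b (BS.mul low (Π (map (ι b) γs) (BS.lin τ)) (length (map (ι b) γs)))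
          ≈⟨ coef-cong b (coeff-Πlin τ (map (ι b) γs) low) ⟩
        coef b (umbralᴮ (map (ι b) γs) (scale τ low))
          ≈⟨ coef-umbral b γs _ ⟩
        umbral γs (λ d → coef b (scale τ low d))
          ≈⟨ umbral-cong γs (λ d → coef-cong b (B.trans (IsHom.Π-homo (scale-isHom τ) (desc (size b)) lowForm d)
               (RingProducts.Π-cong (PS B) (desc (size b)) scaled d))) ⟩
        umbral γs (marked u b) ∎
        where
        open import Relation.Binary.Reasoning.Setoid setoid
        open import Data.List.Properties using (length-map)
        γs = topWeights u (size b) k (suc k)
        low = Π (desc (size b)) lowForm
        len : length (map (ι b) γs) ≡ suc k
        len = ≡.trans (length-map (ι b) γs) (length-topWeights u (size b) k (suc k))
        scaled : ∀ v n → scale τ (lowForm v) n B.≈ BS.lin (Λ b v B.+ ι b u B.* Y b) (ι b (λ′ u) B.* Y b) n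
        scaled v n = B.trans (scale-lin τ _ _ n) (lin-cong B.refl
          (B.trans (B.*-comm _ _) (B.trans (B.sym (B.*-assoc _ _ _)) (B.*-congʳ (B.sym (ι-* b _ _))))) n)

-- Coefficient extraction in the innermost variable η is a homomorphism R[[η]]⟨y⟩ → R⟨y⟩[[η]].
module EtaCoef {c ℓ : Level} (R : CommutativeRing c ℓ) where
  private
    R′ : CommutativeRing c ℓ
    R′ = PS R
    module R = CommutativeRing R
    module R′ = CommutativeRing R′
    module O = TowerOps R
    module O′ = TowerOps R′
    open O using (module 𝕋)
    open O′ using () renaming (module 𝕋 to 𝕋′)

  π : ∀ b → 𝕋′.Carrier b → ℕ → 𝕋.Carrier b
  π []      x d   = x d
  π (k ∷ b) x d n = π b (x n) d

  π-0 : ∀ b d → 𝕋._≈_ b (π b (𝕋′.0# b) d) (𝕋.0# b)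
  π-0 []      d   = R.refl
  π-0 (k ∷ b) d n = π-0 b d

  π-cong : ∀ b {x y} → 𝕋′._≈_ b x y → ∀ d → 𝕋._≈_ b (π b x d) (π b y d)
  π-cong []      p d   = p d
  π-cong (k ∷ b) p d n = π-cong b (p n) d

  π-ι : ∀ b x d → 𝕋._≈_ b (π b (O′.ι b x) d) (O.ι b (x d))
  π-ι []      x d               = R.refl
  π-ι (k ∷ b) x d zero          = π-ι b x d
  π-ι (k ∷ b) x d (suc zero)    = π-0 b d
  π-ι (k ∷ b) x d (suc (suc n)) = π-0 b d

  π-1 : ∀ b d → 𝕋._≈_ b (π b (𝕋′.1# b) d)
                                                 (CommutativeRing.1# (PS (Tower R b)) d)
  π-1 b d = T.trans (π-cong b (𝕋′.sym b (O′.ι-1 b)) d) (T.trans (π-ι b R′.1# d) (one d))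
    where
    module T = CommutativeRing (Tower R b)
    one : ∀ d → O.ι b (R′.1# d) T.≈ CommutativeRing.1# (PS (Tower R b)) d
    one zero          = O.ι-1 b
    one (suc zero)    = O.ι-0 b
    one (suc (suc d)) = O.ι-0 b

  π-isHom : ∀ b → IsHom (Tower R′ b) (PS (Tower R b)) (π b)
  π-isHom [] = record
    { ⟦⟧-cong = λ p → p ; +-homo = λ _ _ _ → R.refl
    ; *-homo = λ _ _ _ → R.refl ; 1-homo = λ _ → R.refl }
  π-isHom (k ∷ b) = record
    { ⟦⟧-cong = π-cong (k ∷ b)
    ; +-homo  = λ x y d n → H.+-homo (x n) (y n) d
    ; *-homo  = λ x y d n → T.trans (H.mul-homo x y n d)
                  (SeriesLemmas.Double.mul-transpose (Tower R b) (λ m → π b (x m)) (λ m → π b (y m)) n d)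
    ; 1-homo  = π-1 (k ∷ b) }
    where
    module T = CommutativeRing (Tower R b)
    module H = IsHom (π-isHom b)

  π-coef : ∀ b x d → O′.coef b x d R.≈ O.coef b (π b x d)
  π-coef []      x d = R.refl
  π-coef (k ∷ b) x d = π-coef b (x (suc k)) d

  Constant : ∀ b → 𝕋′.Carrier b → 𝕋.Carrier b → Set ℓ
  Constant b x x₀ = ∀ d → 𝕋._≈_ b (π b x d) (PowerSeries.const (Tower R b) x₀ d)

  constant-lin : ∀ k b {x y x₀ y₀} → Constant b x x₀ → Constant b y y₀ →
    Constant (k ∷ b) (PowerSeries.lin (Tower R′ b) x y) (PowerSeries.lin (Tower R b) x₀ y₀)
  constant-lin k b p q zero          zero          = p 0
  constant-lin k b p q (suc zero)    zero          = p 1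
  constant-lin k b p q (suc (suc d)) zero          = p (suc (suc d))
  constant-lin k b p q zero          (suc zero)    = q 0
  constant-lin k b p q (suc zero)    (suc zero)    = q 1
  constant-lin k b p q (suc (suc d)) (suc zero)    = q (suc (suc d))
  constant-lin k b p q zero          (suc (suc n)) = π-0 b 0
  constant-lin k b p q (suc zero)    (suc (suc n)) = π-0 b 1
  constant-lin k b p q (suc (suc d)) (suc (suc n)) = π-0 b (suc (suc d))

  constant-ι : ∀ b {x a} → (∀ d → x d R.≈ PowerSeries.const R a d) → Constant b (O′.ι b x) (O.ι b a)
  constant-ι b {a = a} p d = 𝕋.trans b (π-ι b _ d) (𝕋.trans b (O.ι-cong b (p d)) (at d))
    where
    at : ∀ d → 𝕋._≈_ b (O.ι b (PowerSeries.const R a d)) (PowerSeries.const (Tower R b) (O.ι b a) d)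
    at zero          = 𝕋.refl b
    at (suc zero)    = O.ι-0 b
    at (suc (suc d)) = O.ι-0 b

  constant-0 : Constant [] R′.0# R.0#
  constant-0 zero          = R.refl
  constant-0 (suc zero)    = R.refl
  constant-0 (suc (suc d)) = R.refl

  π-Y : ∀ b → Constant b (O′.Y b) (O.Y b)
  π-Y []      = constant-0
  π-Y (k ∷ b) = constant-lin k b (π-Y b) (π-1 b)

  module _ (t : R.Carrier) where
    private
      t′ : R′.Carrier
      t′ = PowerSeries.const R t
      module F = O.Forms t
      module F′ = O′.Forms t′

    constant-w : ∀ p k v d → F′.w p k v d R.≈ PowerSeries.const R (F.w p k v) d
    constant-w p k v d with v <ᵇ (suc k ℕ.+ p) | suc p <ᵇ v
    ... | true  | true  = SeriesLemmas.const-+ R R.1# t d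
    ... | true  | false = R.trans (R.+-congˡ (constant-0 d)) (SeriesLemmas.const-+ R R.1# R.0# d)
    ... | false | true  = R.trans (R.+-congʳ (constant-0 d)) (SeriesLemmas.const-+ R R.0# t d)
    ... | false | false = R.trans (R.+-cong (constant-0 d) (constant-0 d)) (SeriesLemmas.const-+ R R.0# R.0# d)

    π-Λ : ∀ b v → Constant b (F′.Λ b v) (F.Λ b v)
    π-Λ []      v = constant-0
    π-Λ (k ∷ b) v = constant-lin k b (π-Λ b v) (constant-ι b (constant-w (size b) k v))

    module _ (u : R.Carrier) (k : ℕ) (b : List ℕ) where
      private
        module B = CommutativeRing (Tower R b)
        module BP = CommutativeRing (PS (Tower R b))
        module B′ = CommutativeRing (Tower R′ b)
        module BS = PowerSeries (Tower R b)
        open SeriesLemmas (Tower R b)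
        module H = IsHom (π-isHom b)
        l : R.Carrier
        l = F.λ′ u

        π-lin : ∀ d → π b (O′.ι b (PowerSeries.lin R u l)) d B.≈ BS.lin (O.ι b u) (O.ι b l) d
        π-lin d = B.trans (π-ι b _ d) (go d)
          where
          go : ∀ d → O.ι b (PowerSeries.lin R u l d) B.≈ BS.lin (O.ι b u) (O.ι b l) d
          go zero          = B.refl
          go (suc zero)    = B.refl
          go (suc (suc d)) = O.ι-0 b

        π-form : ∀ v → π b (F′.Λ b v B′.+ O′.ι b (PowerSeries.lin R u l) B′.* O′.Y b) BP.≈
                       BS.lin (F.Λ b v B.+ O.ι b u B.* O.Y b) (O.ι b l B.* O.Y b)
        π-form v = BP.trans (H.+-homo _ _) (BP.trans
          (BP.+-cong (π-Λ b v) (BP.trans (H.*-homo _ _) (BP.trans (BP.*-cong π-lin (π-Y b))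
            (BP.trans (BP.*-comm _ _) (const-lin _ _ _)))))
          (λ n → B.trans (lin-+ _ _ _ _ n) (lin-cong (B.+-congˡ (B.*-comm _ _)) (B.trans (B.+-identityˡ _) (B.*-comm _ _)) n)))

      Pcoef-marked : ∀ d → F.marked u b d R.≈ F′.Pcoef (PowerSeries.lin R u l) b d
      Pcoef-marked d = R.sym (R.trans (π-coef b _ d) (O.coef-cong b (BP.trans (H.Π-homo (desc (size b)) _)
        (RingProducts.Π-cong (PS (Tower R b)) (desc (size b)) π-form) d)))

      -- The form suited to induction: on the right stands a `Pcoef` over the power series ring with
      -- one block less.
      Pcoef-eliminate : F.Pcoef u (k ∷ b) R.≈
        RingProducts.umbral R (F.topWeights u (size b) k (suc k)) (F′.Pcoef (PowerSeries.lin R u l) b)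
      Pcoef-eliminate = R.trans (F.Pcoef-eliminate′ u k b) (RingProducts.umbral-cong R (F.topWeights u (size b) k (suc k)) Pcoef-marked)

-- Geometric series, q-factorials and weighted sums over compositions

module Geometric {c ℓ : Level} (R : CommutativeRing c ℓ) where
  open CommutativeRing R
  open ListSums commutativeSemiring
  open PowerSeries R
  open SeriesLemmas R using (module P)
  open P using () renaming (_+_ to _⊕_; _*_ to _⊛_; _≈_ to _≋_)
  open Eval P.commutativeSemiring using (pow)
  open import Relation.Binary.Reasoning.Setoid setoid
  import Algebra.Properties.CommutativeSemigroup P.*-commutativeSemigroup as P*

  X : Series
  X = lin 0# 1#

  X-suc : ∀ f n → (X ⊛ f) (suc n) ≈ f n
  X-suc f n = trans (lin-mul-suc 0# 1# f n) (trans (+-cong (zeroˡ _) (*-identityˡ _)) (+-identityˡ _))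

  X-zero : ∀ f → (X ⊛ f) 0 ≈ 0#
  X-zero f = zeroˡ _

  -- geomFrom a f = a + a f X + a f² X² + ⋯
  geomFrom : Series → Series → Series
  geomFrom a f zero    = a 0
  geomFrom a f (suc n) = a (suc n) + geomFrom (a ⊛ f) f n

  geomFrom-cong : ∀ {a b} f → a ≋ b → geomFrom a f ≋ geomFrom b f
  geomFrom-cong f p zero    = p 0
  geomFrom-cong f p (suc n) = +-cong (p (suc n)) (geomFrom-cong f (P.*-congʳ p) n)

  geomFrom-step : ∀ a f → geomFrom a f ≋ a ⊕ X ⊛ geomFrom (a ⊛ f) f
  geomFrom-step a f zero    = sym (trans (+-congˡ (X-zero (geomFrom (a ⊛ f) f))) (+-identityʳ _))
  geomFrom-step a f (suc n) = +-congˡ (sym (X-suc _ n))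

  geomFrom-* : ∀ b a f → geomFrom (b ⊛ a) f ≋ b ⊛ geomFrom a f
  geomFrom-* b a f zero    = refl
  geomFrom-* b a f (suc n) = begin
    (b ⊛ a) (suc n) + geomFrom ((b ⊛ a) ⊛ f) f n
      ≈⟨ +-congˡ (geomFrom-cong f (P.*-assoc b a f) n) ⟩
    (b ⊛ a) (suc n) + geomFrom (b ⊛ (a ⊛ f)) f n
      ≈⟨ +-congˡ (geomFrom-* b (a ⊛ f) f n) ⟩
    (b ⊛ a) (suc n) + (b ⊛ geomFrom (a ⊛ f) f) n
      ≈⟨ +-congˡ (X-suc _ n) ⟨
    (b ⊛ a ⊕ X ⊛ (b ⊛ geomFrom (a ⊛ f) f)) (suc n)
      ≈⟨ P.+-congˡ {b ⊛ a} (P*.x∙yz≈y∙xz X b _) (suc n) ⟩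
    (b ⊛ a ⊕ b ⊛ (X ⊛ geomFrom (a ⊛ f) f)) (suc n)
      ≈⟨ P.distribˡ b a _ (suc n) ⟨
    (b ⊛ (a ⊕ X ⊛ geomFrom (a ⊛ f) f)) (suc n)
      ≈⟨ P.*-congˡ {b} (P.sym (geomFrom-step a f)) (suc n) ⟩
    (b ⊛ geomFrom a f) (suc n) ∎

  geomFrom-Σ≤ : ∀ a f n → geomFrom a f n ≈ Σ≤ n (λ i → (a ⊛ pow f i) (n ℕ.∸ i))
  geomFrom-Σ≤ a f zero    = sym (P.*-identityʳ a 0)
  geomFrom-Σ≤ a f (suc n) = +-cong (sym (P.*-identityʳ a (suc n)))
    (trans (geomFrom-Σ≤ (a ⊛ f) f n) (Σ≤-cong n (λ i → P.*-assoc a f (pow f i) (n ℕ.∸ i))))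

  -- The inverse of 1 - X f, by `geom-eq`.
  geom : Series → Series
  geom f = geomFrom P.1# f

  geom-suc : ∀ f n → geom f (suc n) ≈ (f ⊛ geom f) n
  geom-suc f zero    = trans (+-identityˡ _) (trans (geomFrom-cong f (P.*-comm P.1# f) 0) (geomFrom-* f P.1# f 0))
  geom-suc f (suc n) = trans (+-identityˡ _) (trans (geomFrom-cong f (P.*-comm P.1# f) (suc n)) (geomFrom-* f P.1# f (suc n)))

  geom-eq : ∀ f → geom f ≋ P.1# ⊕ X ⊛ (f ⊛ geom f)
  geom-eq f zero          = sym (trans (+-congˡ (X-zero (f ⊛ geom f))) (+-identityʳ _))
  geom-eq f (suc zero)    = trans (geom-suc f 0) (sym (trans (+-identityˡ _) (X-suc (f ⊛ geom f) 0)))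
  geom-eq f (suc (suc n)) = trans (geom-suc f (suc n)) (sym (trans (+-identityˡ _) (X-suc (f ⊛ geom f) (suc n))))

  mul-congʳ≤ : ∀ f {g h : Series} n → (∀ k → k ≤ n → g k ≈ h k) → mul f g n ≈ mul f h n
  mul-congʳ≤ f zero    p = *-congˡ (p 0 z≤n)
  mul-congʳ≤ f (suc n) p = +-cong (*-congˡ (p (suc n) ℕ.≤-refl)) (mul-congʳ≤ (tail f) n (λ k l → p k (ℕ.m≤n⇒m≤1+n l)))

  geom-unique : ∀ f g → g 0 ≈ 1# → (∀ n → g (suc n) ≈ (f ⊛ g) n) → g ≋ geom f
  geom-unique f g g0 gs n = go n n ℕ.≤-refl
    where
    go : ∀ n k → k ≤ n → g k ≈ geom f k
    go n       zero    _       = g0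
    go (suc n) (suc k) (s≤s l) = trans (gs k) (trans (mul-congʳ≤ f k (λ i i≤k → go n i (ℕ.≤-trans i≤k l))) (sym (geom-suc f k)))

-- `qf n` is (q)ₙ, `iq n` its inverse and `br n` is [n]. The index of `ic` is shifted by one because
-- 1 - q⁰ = 0.
record QData {c ℓ : Level} (R : CommutativeRing c ℓ) : Set (c Level.⊔ ℓ) where
  open CommutativeRing R
  open Eval commutativeSemiring using (pow)
  field
    t q : Carrier
    ic  : ℕ → Carrier
  cq : ℕ → Carrier
  cq n = 1# + - pow q n
  field
    ic-inverse : ∀ n → cq (suc n) * ic n ≈ 1#

  qf : ℕ → Carrier
  qf zero    = 1#
  qf (suc n) = cq (suc n) * qf n

  iq : ℕ → Carrier
  iq zero    = 1#
  iq (suc n) = ic n * iq n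

  br : ℕ → Carrier
  br zero    = 0#
  br (suc n) = 1# + t * br n

  qf*iq : ∀ n → qf n * iq n ≈ 1#
  qf*iq zero    = *-identityˡ 1#
  qf*iq (suc n) = trans (interchange _ _ _ _) (trans (*-cong (ic-inverse n) (qf*iq n)) (*-identityˡ 1#))
    where open import Algebra.Properties.CommutativeSemigroup *-commutativeSemigroup using (interchange)

  -- Σ over the ways to cut below a last block containing k + 1 positions already, with
  -- p positions left: a cut above position i costs qⁱ, its absence 1 − qⁱ.
  Sb : ℕ → ℕ → (List ℕ → Carrier) → Carrier
  Sb k zero    f = f (k ∷ [])
  Sb k (suc p) f = pow q (suc p) * Sb 0 p (λ b → f (k ∷ b)) + cq (suc p) * Sb (suc k) p f

  Sn : ℕ → (List ℕ → Carrier) → Carrier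
  Sn zero    f = f []
  Sn (suc n) f = Sb 0 n f

  -- For j ≤ p this is (q)ₚ divided by the q-factorial of p - j: the weight of leaving out the j
  -- cuts from position p downwards.
  fc : ℕ → ℕ → Carrier
  fc p       zero    = 1#
  fc zero    (suc j) = 1#
  fc (suc p) (suc j) = cq (suc p) * fc p j

module QSums {c ℓ : Level} {R : CommutativeRing c ℓ} (D : QData R) where
  open CommutativeRing R
  open ListSums commutativeSemiring
  open Eval commutativeSemiring using (pow)
  open RingProducts R using (umbral)
  open QData D
  open import Relation.Binary.Reasoning.Setoid setoid
  open import Algebra.Properties.CommutativeSemigroup +-commutativeSemigroup using (interchange)
  open import Algebra.Properties.CommutativeSemigroup *-commutativeSemigroup using (x∙yz≈y∙xz)

  fc-qf : ∀ n j → j ≤ n → fc n j * qf (n ℕ.∸ j) ≈ qf n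
  fc-qf n       zero    _       = *-identityˡ _
  fc-qf (suc n) (suc j) (s≤s l) = trans (*-assoc _ _ _) (*-congˡ (fc-qf n j l))

  Sb-cong : ∀ k p {f g : List ℕ → Carrier} → (∀ b → size b ≡ suc k ℕ.+ p → f b ≈ g b) → Sb k p f ≈ Sb k p g
  Sb-cong k zero    h = h (k ∷ []) ≡.refl
  Sb-cong k (suc p) h = +-cong (*-congˡ (Sb-cong 0 p (λ b e → h (k ∷ b) (≡.cong (suc k ℕ.+_) e))))
                               (*-congˡ (Sb-cong (suc k) p (λ b e → h b (≡.trans e (≡.cong suc (≡.sym (ℕ.+-suc k p)))))))

  Sn-cong : ∀ n {f g : List ℕ → Carrier} → (∀ b → size b ≡ n → f b ≈ g b) → Sn n f ≈ Sn n g
  Sn-cong zero    h = h [] ≡.refl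
  Sn-cong (suc n) h = Sb-cong 0 n h

  Sb-+ : ∀ k p (f g : List ℕ → Carrier) → Sb k p (λ b → f b + g b) ≈ Sb k p f + Sb k p g
  Sb-+ k zero    f g = refl
  Sb-+ k (suc p) f g = trans (+-cong (trans (*-congˡ (Sb-+ 0 p _ _)) (distribˡ _ _ _))
                                     (trans (*-congˡ (Sb-+ (suc k) p f g)) (distribˡ _ _ _))) (interchange _ _ _ _)

  Sb-* : ∀ a k p (f : List ℕ → Carrier) → Sb k p (λ b → a * f b) ≈ a * Sb k p f
  Sb-* a k zero    f = refl
  Sb-* a k (suc p) f = trans (+-cong (trans (*-congˡ (Sb-* a 0 p _)) (x∙yz≈y∙xz _ _ _))
                                     (trans (*-congˡ (Sb-* a (suc k) p f)) (x∙yz≈y∙xz _ _ _))) (sym (distribˡ _ _ _))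

  Sn-+ : ∀ n (f g : List ℕ → Carrier) → Sn n (λ b → f b + g b) ≈ Sn n f + Sn n g
  Sn-+ zero    f g = refl
  Sn-+ (suc n) f g = Sb-+ 0 n f g

  Sn-* : ∀ a n (f : List ℕ → Carrier) → Sn n (λ b → a * f b) ≈ a * Sn n f
  Sn-* a zero    f = refl
  Sn-* a (suc n) f = Sb-* a 0 n f

  Sn-umbral : ∀ n γs (f : List ℕ → ℕ → Carrier) → Sn n (λ b → umbral γs (f b)) ≈ umbral γs (λ d → Sn n (λ b → f b d))
  Sn-umbral n []       f = refl
  Sn-umbral n (γ ∷ γs) f = trans (Sn-umbral n γs _) (RingProducts.umbral-cong R γs (λ d →
    trans (Sn-+ n _ _) (+-congʳ (Sn-* γ n _))))

  -- The terms are sorted by the length of the block at hand: j absent cuts enlarge it and a cut at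
  -- p - j closes it. For j = p no position is left, and the factor is q⁰ = 1.
  Sb-Σ≤ : ∀ k p (f : List ℕ → Carrier) →
          Sb k p f ≈ Σ≤ p (λ j → fc p j * (pow q (p ℕ.∸ j) * Sn (p ℕ.∸ j) (λ b → f (k ℕ.+ j ∷ b))))
  Sb-Σ≤ k zero    f = trans (reflexive (≡.cong (λ i → f (i ∷ [])) (≡.sym (ℕ.+-identityʳ k))))
                            (sym (trans (*-identityˡ _) (*-identityˡ _)))
  Sb-Σ≤ k (suc p) f = +-cong
    (trans (*-congˡ (Sb-cong 0 p (λ b _ → reflexive (≡.cong (λ i → f (i ∷ b)) (≡.sym (ℕ.+-identityʳ k)))))) (sym (*-identityˡ _)))
    (begin
      cq (suc p) * Sb (suc k) p f
        ≈⟨ *-congˡ (Sb-Σ≤ (suc k) p f) ⟩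
      cq (suc p) * Σ≤ p (λ j → fc p j * (pow q (p ℕ.∸ j) * Sn (p ℕ.∸ j) (λ b → f (suc k ℕ.+ j ∷ b))))
        ≈⟨ Σ≤-*ˡ p _ _ ⟨
      Σ≤ p (λ j → cq (suc p) * (fc p j * (pow q (p ℕ.∸ j) * Sn (p ℕ.∸ j) (λ b → f (suc k ℕ.+ j ∷ b)))))
        ≈⟨ Σ≤-cong p (λ j → trans (sym (*-assoc _ _ _)) (*-congˡ (*-congˡ (Sn-cong (p ℕ.∸ j) (λ b _ →
             reflexive (≡.cong (λ i → f (i ∷ b)) (≡.sym (ℕ.+-suc k j)))))))) ⟩
      Σ≤ p (λ j → cq (suc p) * fc p j * (pow q (p ℕ.∸ j) * Sn (p ℕ.∸ j) (λ b → f (k ℕ.+ suc j ∷ b)))) ∎)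

module Constants {c ℓ : Level} (R : CommutativeRing c ℓ) where
  open CommutativeRing R
  open PowerSeries R
  open SeriesLemmas R using (module P; lin-cong; const-lin; const-+)
  open P using () renaming (_*_ to _⊛_; _≈_ to _≋_; -_ to ⊖_)
  open Eval commutativeSemiring using (pow)
  open Eval P.commutativeSemiring using () renaming (pow to powᴾ)
  open import Algebra.Properties.Ring ring using (-0#≈0#)

  const-* : ∀ a b → const a ⊛ const b ≋ const (a * b)
  const-* a b n = trans (const-lin a b 0# n) (lin-cong refl (zeroʳ a) n)

  const-- : ∀ a → ⊖ const a ≋ const (- a)
  const-- a zero          = refl
  const-- a (suc zero)    = -0#≈0#
  const-- a (suc (suc n)) = -0#≈0#

  const-cong : ∀ {a b} → a ≈ b → const a ≋ const b
  const-cong p = lin-cong p refl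

  const-pow : ∀ a n → powᴾ (const a) n ≋ const (pow a n)
  const-pow a zero    = P.refl
  const-pow a (suc n) = P.trans (P.*-congˡ (const-pow a n)) (const-* a (pow a n))

  const-0 : const 0# ≋ P.0#
  const-0 zero          = refl
  const-0 (suc zero)    = refl
  const-0 (suc (suc n)) = refl

module Extend {c ℓ : Level} {R : CommutativeRing c ℓ} (D : QData R) where
  open CommutativeRing R
  open PowerSeries R
  open SeriesLemmas R using (module P; const-+)
  open P using () renaming (_+_ to _⊕_; _≈_ to _≋_; -_ to ⊖_)
  open Eval commutativeSemiring using (pow)
  open Eval P.commutativeSemiring using () renaming (pow to powᴾ)
  open QData D
  open Constants R public

  const-cq : ∀ n → P.1# ⊕ ⊖ powᴾ (const q) n ≋ const (cq n)
  const-cq n = P.trans (P.+-congˡ (P.trans (P.-‿cong (const-pow q n)) (const-- _))) (const-+ _ _)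

  extend : QData (PS R)
  extend = record
    { t = const t ; q = const q ; ic = λ n → const (ic n)
    ; ic-inverse = λ n → P.trans (P.*-congʳ (const-cq (suc n))) (P.trans (const-* _ _) (const-cong (ic-inverse n))) }

  private module D′ = QData extend

  const-qf : ∀ n → D′.qf n ≋ const (qf n)
  const-qf zero    = P.refl
  const-qf (suc n) = P.trans (P.*-cong (const-cq (suc n)) (const-qf n)) (const-* _ _)

  const-iq : ∀ n → D′.iq n ≋ const (iq n)
  const-iq zero    = P.refl
  const-iq (suc n) = P.trans (P.*-congˡ (const-iq n)) (const-* _ _)

  const-br : ∀ n → D′.br n ≋ const (br n)
  const-br zero    = P.sym const-0
  const-br (suc n) = P.trans (P.+-congˡ (P.trans (P.*-congˡ (const-br n)) (const-* _ _))) (const-+ _ _)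

  Sb-at : ∀ k p (f : List ℕ → Series) d → D′.Sb k p f d ≈ Sb k p (λ b → f b d)
  Sb-at k zero    f d = refl
  Sb-at k (suc p) f d = +-cong
    (trans (P.*-congʳ (const-pow q (suc p)) d) (trans (const-mul _ _ d) (*-congˡ (Sb-at 0 p _ d))))
    (trans (P.*-congʳ (const-cq (suc p)) d) (trans (const-mul _ _ d) (*-congˡ (Sb-at (suc k) p f d))))

  Sn-at : ∀ n (f : List ℕ → Series) d → D′.Sn n f d ≈ Sn n (λ b → f b d)
  Sn-at zero    f d = refl
  Sn-at (suc n) f d = Sb-at 0 n f d

-- The closed form of the sums of P_b(u) over all compositions

module Solution {c ℓ : Level} {R : CommutativeRing c ℓ} (D : QData R) where
  open CommutativeRing R
  open QData D
  open PowerSeries R using (Series)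
  open Geometric R using (geom)

  -- K_u = 1 - z κ_u: the terms of K_u from k = 1 on, shifted by one place so that `geom` inverts
  -- K_u.
  κ : Carrier → Series
  κ u n = (t * br n + u * br (suc n)) * iq (suc n)

  sol : Carrier → Series
  sol u = geom (κ u)

module Closed {c ℓ : Level} {R : CommutativeRing c ℓ} (D : QData R) (u : CommutativeRing.Carrier R) where
  open CommutativeRing R
  open QData D
  open Solution D
  open ListSums commutativeSemiring
  open PowerSeries R
  open SeriesLemmas R using (module P; scale; scale-lin; scale-isHom; lin-cong; lin-+; const-lin; const-+)
  open P using () renaming (_+_ to _⊕_; _*_ to _⊛_; _≈_ to _≋_; -_ to ⊖_)
  open Eval commutativeSemiring using (pow)
  open Eval P.commutativeSemiring using () renaming (pow to powᴾ)
  open Geometric R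
  open Extend D
  open RingProducts R using (umbral; umbral-cong)
  open RingProducts (PS R) using (Π)
  open import Algebra.Properties.Ring ring using (-0#≈0#; -‿distribʳ-*)
  open DifferenceSolver R using (solve; _:+_; _:*_; _:=_; :-_; :1)
  module SP = DifferenceSolver (PS R)
  import Relation.Binary.Reasoning.Setoid as Reasoning

  f H M U T V W θ : Series
  f = sol u
  H = iq
  M n = br n * iq n
  U = const u
  T = const t
  V = P.1# ⊕ U
  W = T ⊕ U
  θ = V ⊛ W ⊛ M ⊛ f

  f-step : f ≋ P.1# ⊕ X ⊛ (κ u ⊛ f)
  f-step = geom-eq (κ u)

  -- Since [n + 1] = 1 + t [n], this says K_u = H - (1 + u) M.
  H⊕κ : H ⊕ X ⊛ κ u ≋ P.1# ⊕ V ⊛ M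
  H⊕κ zero = +-congˡ (trans (X-zero (κ u)) (sym (trans (*-congˡ (zeroˡ _)) (zeroʳ _))))
  H⊕κ (suc n) = begin
    iq (suc n) + (X ⊛ κ u) (suc n)
      ≈⟨ +-congˡ (X-suc (κ u) n) ⟩
    iq (suc n) + (t * br n + u * br (suc n)) * iq (suc n)
      ≈⟨ solve 4 (λ i t u b → i :+ (t :* b :+ u :* (:1 :+ t :* b)) :* i
                      := (:1 :+ u) :* ((:1 :+ t :* b) :* i)) refl (iq (suc n)) t u (br n) ⟩
    (1# + u) * M (suc n)
      ≈⟨ const-mul (1# + u) M (suc n) ⟨
    (const (1# + u) ⊛ M) (suc n)
      ≈⟨ P.*-congʳ {M} (P.sym (const-+ 1# u)) (suc n) ⟩
    (V ⊛ M) (suc n)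
      ≈⟨ +-identityˡ _ ⟨
    0# + (V ⊛ M) (suc n)
      ≈⟨ +-congʳ (one n) ⟨
    (P.1# ⊕ V ⊛ M) (suc n) ∎
    where
    open Reasoning setoid
    one : ∀ n → P.1# (suc n) ≈ 0#
    one zero    = refl
    one (suc n) = refl

  f-eq : f ⊛ (H ⊕ ⊖ (V ⊛ M)) ≋ P.1#
  f-eq = begin
    f ⊛ (H ⊕ ⊖ (V ⊛ M))
      ≈⟨ SP.solve 4 (λ f H X N → f SP.:* (H SP.:+ SP.:- N) SP.:= f SP.:* (H SP.:+ X) SP.:+ SP.:- (f SP.:* (N SP.:+ X))) P.refl f H (X ⊛ κ u) (V ⊛ M) ⟩
    f ⊛ (H ⊕ X ⊛ κ u) ⊕ ⊖ (f ⊛ (V ⊛ M ⊕ X ⊛ κ u))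
      ≈⟨ P.+-congʳ (P.*-congˡ H⊕κ) ⟩
    f ⊛ (P.1# ⊕ V ⊛ M) ⊕ ⊖ (f ⊛ (V ⊛ M ⊕ X ⊛ κ u))
      ≈⟨ SP.solve 4 (λ f N x k → f SP.:* (SP.:1 SP.:+ N) SP.:+ SP.:- (f SP.:* (N SP.:+ x SP.:* k)) SP.:= f SP.:+ SP.:- (x SP.:* (k SP.:* f))) P.refl f (V ⊛ M) X (κ u) ⟩
    f ⊕ ⊖ (X ⊛ (κ u ⊛ f))
      ≈⟨ P.+-congʳ f-step ⟩
    P.1# ⊕ X ⊛ (κ u ⊛ f) ⊕ ⊖ (X ⊛ (κ u ⊛ f))
      ≈⟨ SP.solve 1 (λ x → SP.:1 SP.:+ x SP.:+ SP.:- x SP.:= SP.:1) P.refl (X ⊛ (κ u ⊛ f)) ⟩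
    P.1# ∎
    where open Reasoning P.setoid

  l : Carrier
  l = (1# + u) * (t + u)

  -- The coefficient of η in κ at u + η l, which is affine in η because κ is affine in u.
  N : Series
  N n = l * M (suc n)

  private
    D′ : QData (PS R)
    D′ = extend
    module D′ = QData D′
    module S′ = Solution D′
    module P′ = PowerSeries (PS R)

  const-l : V ⊛ W ≋ const l
  const-l = P.trans (P.*-cong (const-+ 1# u) (const-+ t u)) (const-* _ _)

  θ-shift : θ ≋ X ⊛ (N ⊛ f)
  θ-shift = begin
    V ⊛ W ⊛ M ⊛ f    ≈⟨ P.*-congʳ (P.trans (P.*-congʳ const-l) shifted) ⟩
    (X ⊛ N) ⊛ f      ≈⟨ P.*-assoc X N f ⟩
    X ⊛ (N ⊛ f)      ∎
    where
    open Reasoning P.setoid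
    shifted : const l ⊛ M ≋ X ⊛ N
    shifted zero    = trans (*-congˡ (zeroˡ _)) (trans (zeroʳ _) (sym (X-zero N)))
    shifted (suc n) = trans (const-mul l M (suc n)) (sym (X-suc N n))

  κ′-at : ∀ n d → S′.κ (lin u l) n d ≈ P′.lin (κ u) N d n
  κ′-at n d = trans (step d) (pointwise d)
    where
    step : S′.κ (lin u l) n ≋ lin (κ u n) (N n)
    step = begin
      (const t ⊛ D′.br n ⊕ lin u l ⊛ D′.br (suc n)) ⊛ D′.iq (suc n)
        ≈⟨ P.*-cong (P.+-cong (P.*-congˡ (const-br n)) (P.*-congˡ (const-br (suc n)))) (const-iq (suc n)) ⟩
      (const t ⊛ const (br n) ⊕ lin u l ⊛ const (br (suc n))) ⊛ const (iq (suc n))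
        ≈⟨ P.*-congʳ (P.+-cong (const-* _ _) (P.trans (P.*-comm _ _) (const-lin _ _ _))) ⟩
      (const (t * br n) ⊕ lin (br (suc n) * u) (br (suc n) * l)) ⊛ const (iq (suc n))
        ≈⟨ P.trans (P.*-comm _ _) (P.*-congˡ (lin-+ _ _ _ _)) ⟩
      const (iq (suc n)) ⊛ lin (t * br n + br (suc n) * u) (0# + br (suc n) * l)
        ≈⟨ const-lin _ _ _ ⟩
      lin (iq (suc n) * (t * br n + br (suc n) * u)) (iq (suc n) * (0# + br (suc n) * l))
        ≈⟨ lin-cong (trans (*-comm _ _) (*-congʳ (+-congˡ (*-comm _ _))))
             (trans (*-congˡ (+-identityˡ _)) (solve 3 (λ i b l → i :* (b :* l) := l :* (b :* i)) refl _ _ _)) ⟩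
      lin (κ u n) (N n) ∎
      where open Reasoning P.setoid
    pointwise : ∀ d → lin (κ u n) (N n) d ≈ P′.lin (κ u) N d n
    pointwise zero          = refl
    pointwise (suc zero)    = refl
    pointwise (suc (suc d)) = refl

  private
    g : ℕ → Series
    g n d = (f ⊛ powᴾ θ d) n

    gᵀ : ℕ → Series
    gᵀ d = f ⊛ powᴾ θ d

    g-zero : g 0 ≋ P.1#
    g-zero zero          = *-identityˡ 1#
    g-zero (suc zero)    = trans (*-congˡ (trans (*-congʳ (trans (θ-shift 0) (X-zero (N ⊛ f)))) (zeroˡ _))) (zeroʳ _)
    g-zero (suc (suc d)) = trans (*-congˡ (trans (*-congʳ (trans (θ-shift 0) (X-zero (N ⊛ f)))) (zeroˡ _))) (zeroʳ _)

    gᵀ-suc : ∀ d n → gᵀ d (suc n) ≈ P′.mul (P′.lin (κ u) N) gᵀ d n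
    gᵀ-suc zero n = begin
      (f ⊛ P.1#) (suc n)        ≈⟨ P.*-identityʳ f (suc n) ⟩
      f (suc n)                 ≈⟨ geom-suc (κ u) n ⟩
      (κ u ⊛ f) n               ≈⟨ P.*-congˡ {κ u} (P.*-identityʳ f) n ⟨
      (κ u ⊛ (f ⊛ P.1#)) n      ∎
      where open Reasoning setoid
    gᵀ-suc (suc d) n = begin
      (f ⊛ (θ ⊛ powᴾ θ d)) (suc n)
        ≈⟨ identity (suc n) ⟩
      (X ⊛ (κ u ⊛ gᵀ (suc d) ⊕ N ⊛ gᵀ d)) (suc n)
        ≈⟨ X-suc (κ u ⊛ gᵀ (suc d) ⊕ N ⊛ gᵀ d) n ⟩
      (κ u ⊛ gᵀ (suc d) ⊕ N ⊛ gᵀ d) n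
        ≈⟨ P′.lin-mul-suc (κ u) N gᵀ d n ⟨
      P′.mul (P′.lin (κ u) N) gᵀ (suc d) n ∎
      where
      open Reasoning setoid
      θᵈ : Series
      θᵈ = powᴾ θ d
      identity : f ⊛ (θ ⊛ θᵈ) ≋ X ⊛ (κ u ⊛ (f ⊛ (θ ⊛ θᵈ)) ⊕ N ⊛ (f ⊛ θᵈ))
      identity = P.trans (P.*-congʳ f-step) (P.trans
        (SP.solve 5 (λ x k f th td → (SP.:1 SP.:+ x SP.:* (k SP.:* f)) SP.:* (th SP.:* td) SP.:=
           th SP.:* td SP.:+ x SP.:* (k SP.:* (f SP.:* (th SP.:* td)))) P.refl X (κ u) f θ θᵈ)
        (P.trans (P.+-congʳ (P.*-congʳ θ-shift))
        (SP.solve 6 (λ x k f th td n → (x SP.:* (n SP.:* f)) SP.:* td SP.:+ x SP.:* (k SP.:* (f SP.:* (th SP.:* td))) SP.:=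
           x SP.:* (k SP.:* (f SP.:* (th SP.:* td)) SP.:+ n SP.:* (f SP.:* td))) P.refl X (κ u) f θ θᵈ N)))

  -- K_(u + ηl) = K_u - η z N, so its inverse is f / (1 - η z N f), and z N f = θ by `θ-shift`. The
  -- proof checks that the coefficients f θᵈ satisfy the recursion that characterises the inverse.
  extended-sol : ∀ n d → S′.sol (lin u l) n d ≈ (f ⊛ powᴾ θ d) n
  extended-sol n d = sym (Geometric.geom-unique (PS R) (S′.κ (lin u l)) g g-zero g-suc n d)
    where
    g-suc : ∀ n → g (suc n) ≋ P′.mul (S′.κ (lin u l)) g n
    g-suc n d = begin
      gᵀ d (suc n)
        ≈⟨ gᵀ-suc d n ⟩
      P′.mul (P′.lin (κ u) N) gᵀ d n
        ≈⟨ P′.mul-cong (λ d n → sym (κ′-at n d)) (λ d → P.refl) d n ⟩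
      P′.mul (λ d n → S′.κ (lin u l) n d) gᵀ d n
        ≈⟨ SeriesLemmas.Double.mul-transpose R (λ d n → S′.κ (lin u l) n d) gᵀ d n ⟩
      P′.mul (S′.κ (lin u l)) g n d ∎
      where open Reasoning setoid

  private
    σ : Series → Series
    σ = scale q
    module σ = IsHom (scale-isHom q)

    f′ H′ M′ θ′ C : Series
    f′ = σ f
    H′ = σ H
    M′ = σ M
    θ′ = V ⊛ W ⊛ M′ ⊛ f′
    C = P.1# ⊕ T ⊕ U

    σ-const : ∀ a → σ (const a) ≋ const a
    σ-const a n = trans (scale-lin q a 0# n) (lin-cong refl (zeroʳ q) n)

    σ-V : σ V ≋ V
    σ-V = P.trans (σ.+-homo _ _) (P.+-cong (σ-const 1#) (σ-const u))

    σ-W : σ W ≋ W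
    σ-W = P.trans (σ.+-homo _ _) (P.+-cong (σ-const t) (σ-const u))

    σ-θ : σ θ ≋ θ′
    σ-θ = P.trans (σ.*-homo _ _) (P.*-congʳ (P.trans (σ.*-homo _ _) (P.*-congʳ (P.trans (σ.*-homo _ _) (P.*-cong σ-V σ-W)))))

    iq-step : ∀ n → iq n ≈ iq (suc n) + - (pow q (suc n) * iq (suc n))
    iq-step n = begin
      iq n                                             ≈⟨ *-identityˡ _ ⟨
      1# * iq n                                        ≈⟨ *-congʳ (ic-inverse n) ⟨
      cq (suc n) * ic n * iq n                         ≈⟨ solve 3 (λ a b c → (:1 :+ :- a) :* b :* c := b :* c :+ :- (a :* (b :* c))) refl (pow q (suc n)) (ic n) (iq n) ⟩
      iq (suc n) + - (pow q (suc n) * iq (suc n))      ∎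
      where open Reasoning setoid

    -- This is H(qz) = (1 - z) H(z), coefficientwise the relation between 1 / (q)ₙ and 1 / (q)ₙ₊₁ in
    -- `iq-step`; `M-eq` adds [n + 1] = 1 + t [n].
    H-eq : H′ ≋ H ⊕ ⊖ (X ⊛ H)
    H-eq zero    = trans (*-identityˡ _) (sym (trans (+-congˡ (trans (-‿cong (X-zero H)) -0#≈0#)) (+-identityʳ _)))
    H-eq (suc n) = sym (trans (+-congˡ (-‿cong (trans (X-suc H n) (iq-step n))))
      (solve 2 (λ a b → a :+ :- (a :+ :- b) := b) refl _ _))

    M-eq : M′ ≋ M ⊕ ⊖ (X ⊛ H ⊕ T ⊛ X ⊛ M)
    M-eq zero    = trans (*-identityˡ _) (sym (trans (+-congˡ (trans (-‿cong (trans (+-cong (X-zero H)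
      (trans (*-congʳ (zeroʳ t)) (zeroˡ _))) (+-identityˡ _))) -0#≈0#)) (+-identityʳ _)))
    M-eq (suc n) = sym (begin
      M (suc n) + - ((X ⊛ H) (suc n) + (T ⊛ X ⊛ M) (suc n))
        ≈⟨ +-congˡ (-‿cong (+-cong (X-suc H n) (trans (P.*-assoc T X M (suc n)) (trans (const-mul t (X ⊛ M) (suc n)) (*-congˡ (X-suc M n)))))) ⟩
      M (suc n) + - (iq n + t * (br n * iq n))
        ≈⟨ +-congˡ (-‿cong (+-cong (iq-step n) (*-congˡ (*-congˡ (iq-step n))))) ⟩
      (1# + t * br n) * i + - ((i + - (Q * i)) + t * (br n * (i + - (Q * i))))
        ≈⟨ solve 4 (λ t b i q → (:1 :+ t :* b) :* i :+ :- ((i :+ :- (q :* i)) :+ t :* (b :* (i :+ :- (q :* i))))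
             := q :* ((:1 :+ t :* b) :* i)) refl t (br n) i Q ⟩
      Q * M (suc n) ∎)
      where
      open Reasoning setoid
      i Q : Carrier
      i = iq (suc n)
      Q = pow q (suc n)

    f′-eq : f′ ⊛ (H′ ⊕ ⊖ (V ⊛ M′)) ≋ P.1#
    f′-eq = begin
      f′ ⊛ (H′ ⊕ ⊖ (V ⊛ M′))        ≈⟨ P.*-congˡ (P.+-congˡ (P.-‿cong (P.trans (σ.*-homo V M) (P.*-congʳ σ-V)))) ⟨
      f′ ⊛ (H′ ⊕ ⊖ σ (V ⊛ M))       ≈⟨ P.*-congˡ (P.+-congˡ (λ n → -‿distribʳ-* _ _)) ⟩
      f′ ⊛ (H′ ⊕ σ (⊖ (V ⊛ M)))     ≈⟨ P.*-congˡ (σ.+-homo H _) ⟨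
      f′ ⊛ σ (H ⊕ ⊖ (V ⊛ M))        ≈⟨ σ.*-homo f _ ⟨
      σ (f ⊛ (H ⊕ ⊖ (V ⊛ M)))       ≈⟨ σ.⟦⟧-cong f-eq ⟩
      σ P.1#                        ≈⟨ σ.1-homo ⟩
      P.1#                          ∎
      where open Reasoning P.setoid

    G : Series
    G = geom (θ′ ⊕ C)

    G-eq : G ⊛ (P.1# ⊕ ⊖ (X ⊛ (θ′ ⊕ C))) ≋ P.1#
    G-eq = begin
      G ⊛ (P.1# ⊕ ⊖ (X ⊛ (θ′ ⊕ C)))
        ≈⟨ SP.solve 3 (λ g x y → g SP.:* (SP.:1 SP.:+ SP.:- (x SP.:* y)) SP.:= g SP.:+ SP.:- (x SP.:* (y SP.:* g))) P.refl G X (θ′ ⊕ C) ⟩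
      G ⊕ ⊖ (X ⊛ ((θ′ ⊕ C) ⊛ G))
        ≈⟨ P.+-congʳ (geom-eq (θ′ ⊕ C)) ⟩
      P.1# ⊕ X ⊛ ((θ′ ⊕ C) ⊛ G) ⊕ ⊖ (X ⊛ ((θ′ ⊕ C) ⊛ G))
        ≈⟨ SP.solve 1 (λ x → SP.:1 SP.:+ x SP.:+ SP.:- x SP.:= SP.:1) P.refl (X ⊛ ((θ′ ⊕ C) ⊛ G)) ⟩
      P.1# ∎
      where open Reasoning P.setoid

    -- ∏ (γ + x) over the weights γ of the positions of a block of size j + 1
    Qₓ : ℕ → Series → Series
    Qₓ zero    x = U ⊕ x
    Qₓ (suc j) x = (T ⊕ U ⊕ x) ⊛ (P.1# ⊕ U ⊕ x) ⊛ powᴾ (x ⊕ C) j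

    -- The sum of zʲ `Qₓ j θ′` over all j, as `ΣQ` shows. `G` collects the powers of θ′ + C, one
    -- factor for each interior position of a block.
    B : Series
    B = (U ⊕ θ′) ⊕ X ⊛ ((T ⊕ U ⊕ θ′) ⊛ (P.1# ⊕ U ⊕ θ′)) ⊛ G

    key : f′ ⊛ (P.1# ⊕ X ⊛ B) ≋ f
    key = KeyIdentity.key-identity (PS R) X T U H M H′ M′ f f′ G H-eq M-eq f-eq f′-eq G-eq

    -- Both sides are the coefficient of zⁿ⁺¹ in f(z) - f(qz).
    key-coef : ∀ n → (f′ ⊛ B) n ≈ cq (suc n) * f (suc n)
    key-coef n = begin
      (f′ ⊛ B) n
        ≈⟨ solve 2 (λ a b → b := (a :+ b) :+ :- a) refl (f′ (suc n)) _ ⟩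
      (f′ (suc n) + (f′ ⊛ B) n) + - f′ (suc n)
        ≈⟨ +-congʳ (+-congˡ (X-suc (f′ ⊛ B) n)) ⟨
      (f′ ⊕ X ⊛ (f′ ⊛ B)) (suc n) + - f′ (suc n)
        ≈⟨ +-congʳ (SP.solve 3 (λ f x b → f SP.:+ x SP.:* (f SP.:* b) SP.:= f SP.:* (SP.:1 SP.:+ x SP.:* b)) P.refl f′ X B (suc n)) ⟩
      (f′ ⊛ (P.1# ⊕ X ⊛ B)) (suc n) + - f′ (suc n)
        ≈⟨ +-congʳ (key (suc n)) ⟩
      f (suc n) + - (pow q (suc n) * f (suc n))
        ≈⟨ solve 2 (λ q f → f :+ :- (q :* f) := (:1 :+ :- q) :* f) refl (pow q (suc n)) (f (suc n)) ⟩
      cq (suc n) * f (suc n) ∎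
      where open Reasoning setoid

    ΣQ : ∀ n → Σ≤ n (λ j → (f′ ⊛ Qₓ j θ′) (n ℕ.∸ j)) ≈ (f′ ⊛ B) n
    ΣQ zero    = *-congˡ (sym (trans (+-congˡ (trans (*-congʳ (zeroˡ _)) (zeroˡ _))) (+-identityʳ _)))
    ΣQ (suc n) = begin
      (f′ ⊛ (U ⊕ θ′)) (suc n) + Σ≤ n (λ j → (f′ ⊛ (Z ⊛ powᴾ (θ′ ⊕ C) j)) (n ℕ.∸ j))
        ≈⟨ +-congˡ (Σ≤-cong n (λ j → P.*-assoc f′ Z (powᴾ (θ′ ⊕ C) j) (n ℕ.∸ j))) ⟨
      (f′ ⊛ (U ⊕ θ′)) (suc n) + Σ≤ n (λ j → ((f′ ⊛ Z) ⊛ powᴾ (θ′ ⊕ C) j) (n ℕ.∸ j))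
        ≈⟨ +-congˡ (geomFrom-Σ≤ (f′ ⊛ Z) (θ′ ⊕ C) n) ⟨
      (f′ ⊛ (U ⊕ θ′)) (suc n) + geomFrom (f′ ⊛ Z) (θ′ ⊕ C) n
        ≈⟨ +-congˡ (trans (geomFrom-cong (θ′ ⊕ C) (P.sym (P.*-identityʳ (f′ ⊛ Z))) n) (geomFrom-* (f′ ⊛ Z) P.1# (θ′ ⊕ C) n)) ⟩
      (f′ ⊛ (U ⊕ θ′)) (suc n) + ((f′ ⊛ Z) ⊛ G) n
        ≈⟨ +-congˡ (X-suc ((f′ ⊛ Z) ⊛ G) n) ⟨
      (f′ ⊛ (U ⊕ θ′) ⊕ X ⊛ ((f′ ⊛ Z) ⊛ G)) (suc n)
        ≈⟨ SP.solve 5 (λ f a x z g → f SP.:* a SP.:+ x SP.:* ((f SP.:* z) SP.:* g) SP.:= f SP.:* (a SP.:+ x SP.:* z SP.:* g)) P.refl f′ (U ⊕ θ′) X Z G (suc n) ⟩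
      (f′ ⊛ B) (suc n) ∎
      where
      open Reasoning setoid
      Z : Series
      Z = (T ⊕ U ⊕ θ′) ⊛ (P.1# ⊕ U ⊕ θ′)

    σ-pow : ∀ x j → σ (powᴾ x j) ≋ powᴾ (σ x) j
    σ-pow x zero    = σ.1-homo
    σ-pow x (suc j) = P.trans (σ.*-homo _ _) (P.*-congˡ (σ-pow x j))

    powᴾ-cong : ∀ {x y} j → x ≋ y → powᴾ x j ≋ powᴾ y j
    powᴾ-cong zero    p = P.refl
    powᴾ-cong (suc j) p = P.*-cong p (powᴾ-cong j p)

    σ-Q : ∀ j → σ (Qₓ j θ) ≋ Qₓ j θ′
    σ-Q zero    = P.trans (σ.+-homo _ _) (P.+-cong (σ-const u) σ-θ)
    σ-Q (suc j) = P.trans (σ.*-homo _ _) (P.*-cong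
      (P.trans (σ.*-homo _ _) (P.*-cong (P.trans (σ.+-homo _ _) (P.+-cong σ-W σ-θ)) (P.trans (σ.+-homo _ _) (P.+-cong σ-V σ-θ))))
      (P.trans (σ-pow _ j) (powᴾ-cong j (P.trans (σ.+-homo _ _) (P.+-cong σ-θ
        (P.trans (σ.+-homo _ _) (P.+-cong (P.trans (σ.+-homo _ _) (P.+-cong (σ-const 1#) (σ-const t))) (σ-const u))))))))

  open TowerOps.Forms R t using (topWeights; Pcoef)

  private
    top-tail : ∀ p j i → i ≤ j → ∀ x →
               Π (topWeights u p (suc j) (suc i)) (λ γ → const γ ⊕ x) ≋ (P.1# ⊕ U ⊕ x) ⊛ powᴾ (x ⊕ C) i
    top-tail p j zero    l x
      rewrite <ᵇ-true {suc p} {suc (suc j) ℕ.+ p} (s≤s (s≤s (ℕ.m≤n+m p j)))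
            | <ᵇ-false {suc p} {suc p} ℕ.≤-refl
      = P.*-congʳ (P.+-congʳ (P.trans (const-cong (+-congʳ (+-identityʳ 1#))) (P.sym (const-+ 1# u))))
    top-tail p j (suc i) l x
      rewrite <ᵇ-true {suc (suc i) ℕ.+ p} {suc (suc j) ℕ.+ p} (s≤s (s≤s (ℕ.+-monoˡ-≤ p l)))
            | <ᵇ-true {suc p} {suc (suc i) ℕ.+ p} (s≤s (s≤s (ℕ.m≤n+m p i)))
      = P.trans (P.*-cong (P.trans (P.+-congʳ (P.sym (P.trans (P.+-congʳ (const-+ 1# t)) (const-+ (1# + t) u)))) (P.+-comm _ _))
                          (top-tail p j i (ℕ.<⇒≤ l) x)) (x∙yz≈y∙xz _ _ _)
      where open import Algebra.Properties.CommutativeSemigroup P.*-commutativeSemigroup using (x∙yz≈y∙xz)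

    -- In a block of one position the only weight is u. In a longer block the lowest value has
    -- weight 1 + u, the highest t + u and every other 1 + t + u. None of this depends on p.
    top-Π : ∀ p j x → Π (topWeights u p j (suc j)) (λ γ → const γ ⊕ x) ≋ Qₓ j x
    top-Π p zero x
      rewrite <ᵇ-false {suc p} {suc p} ℕ.≤-refl
      = P.trans (P.*-identityʳ _) (P.+-congʳ (const-cong (trans (+-congʳ (+-identityˡ 0#)) (+-identityˡ u))))
    top-Π p (suc j) x
      rewrite <ᵇ-false {suc (suc j) ℕ.+ p} {suc (suc j) ℕ.+ p} ℕ.≤-refl
            | <ᵇ-true {suc p} {suc (suc j) ℕ.+ p} (s≤s (s≤s (ℕ.m≤n+m p j)))
      = P.trans (P.*-cong (P.+-congʳ (P.trans (const-cong (+-congʳ (+-identityˡ t))) (P.sym (const-+ t u))))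
                          (top-tail p j j ℕ.≤-refl x)) (P.sym (P.*-assoc _ _ _))

    -- On a sequence of the form x θᵈ the functional is evaluation at θ.
    umbral-eval : ∀ γs a x m → umbral γs (λ d → a * (x ⊛ powᴾ θ d) m) ≈ a * (x ⊛ Π γs (λ γ → const γ ⊕ θ)) m
    umbral-eval []       a x m = refl
    umbral-eval (γ ∷ γs) a x m = begin
      umbral γs (λ d → γ * (a * (x ⊛ powᴾ θ d) m) + a * (x ⊛ (θ ⊛ powᴾ θ d)) m)
        ≈⟨ umbral-cong γs step ⟩
      umbral γs (λ d → a * ((x ⊛ (const γ ⊕ θ)) ⊛ powᴾ θ d) m)
        ≈⟨ umbral-eval γs a (x ⊛ (const γ ⊕ θ)) m ⟩
      a * ((x ⊛ (const γ ⊕ θ)) ⊛ Π γs (λ γ → const γ ⊕ θ)) m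
        ≈⟨ *-congˡ (P.*-assoc x (const γ ⊕ θ) _ m) ⟩
      a * (x ⊛ ((const γ ⊕ θ) ⊛ Π γs (λ γ → const γ ⊕ θ))) m ∎
      where
      open Reasoning setoid
      step : ∀ d → γ * (a * (x ⊛ powᴾ θ d) m) + a * (x ⊛ (θ ⊛ powᴾ θ d)) m ≈ a * ((x ⊛ (const γ ⊕ θ)) ⊛ powᴾ θ d) m
      step d = begin
        γ * (a * (x ⊛ powᴾ θ d) m) + a * (x ⊛ (θ ⊛ powᴾ θ d)) m
          ≈⟨ solve 4 (λ g a b c → g :* (a :* b) :+ a :* c := a :* (g :* b :+ c)) refl γ a _ _ ⟩
        a * (γ * (x ⊛ powᴾ θ d) m + (x ⊛ (θ ⊛ powᴾ θ d)) m)
          ≈⟨ *-congˡ (+-congʳ (const-mul γ (x ⊛ powᴾ θ d) m)) ⟨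
        a * (const γ ⊛ (x ⊛ powᴾ θ d) ⊕ x ⊛ (θ ⊛ powᴾ θ d)) m
          ≈⟨ *-congˡ (SP.solve 4 (λ g x p h → g SP.:* (x SP.:* p) SP.:+ x SP.:* (h SP.:* p) SP.:= (x SP.:* (g SP.:+ h)) SP.:* p) P.refl (const γ) x (powᴾ θ d) θ m) ⟩
        a * ((x ⊛ (const γ ⊕ θ)) ⊛ powᴾ θ d) m ∎

  open QSums D

  -- The hypothesis is used over R[[η]] at the argument u + η l, one coefficient of η at a time;
  -- `extended-sol` makes these coefficients f θᵈ, and the functional evaluates at θ.
  block-sum : ∀ m j →
    (∀ (u′ : P.Carrier) → D′.Sn m (TowerOps.Forms.Pcoef (PS R) D′.t u′) ≋ D′.qf m ⊛ S′.sol u′ m) →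
    Sn m (λ b → Pcoef u (j ∷ b)) ≈ qf m * (f ⊛ Qₓ j θ) m
  block-sum m j ih = begin
    Sn m (λ b → Pcoef u (j ∷ b))
      ≈⟨ Sn-cong m (λ b e → trans (EtaCoef.Pcoef-eliminate R t u j b)
           (reflexive (≡.cong (λ p → umbral (topWeights u p j (suc j)) (Pcoef′ b)) e))) ⟩
    Sn m (λ b → umbral γs (Pcoef′ b))
      ≈⟨ Sn-umbral m γs Pcoef′ ⟩
    umbral γs (λ d → Sn m (λ b → Pcoef′ b d))
      ≈⟨ umbral-cong γs (λ d → trans (sym (Sn-at m Pcoef′ d)) (trans (ih (lin u l) d)
           (trans (P.*-congʳ (const-qf m) d) (trans (const-mul _ _ d) (*-congˡ (extended-sol m d)))))) ⟩
    umbral γs (λ d → qf m * (f ⊛ powᴾ θ d) m)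
      ≈⟨ umbral-eval γs (qf m) f m ⟩
    qf m * (f ⊛ Π γs (λ γ → const γ ⊕ θ)) m
      ≈⟨ *-congˡ (P.*-congˡ {f} (top-Π m j θ) m) ⟩
    qf m * (f ⊛ Qₓ j θ) m ∎
    where
    open Reasoning setoid
    γs : List Carrier
    γs = topWeights u m j (suc j)
    Pcoef′ : List ℕ → Series
    Pcoef′ = TowerOps.Forms.Pcoef (PS R) (const t) (lin u l)

  closed-step : ∀ n →
    (∀ m → m ≤ n → ∀ (u′ : P.Carrier) → D′.Sn m (TowerOps.Forms.Pcoef (PS R) D′.t u′) ≋ D′.qf m ⊛ S′.sol u′ m) →
    Sn (suc n) (Pcoef u) ≈ qf (suc n) * f (suc n)
  closed-step n ih = begin
    Sb 0 n (Pcoef u)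
      ≈⟨ Sb-Σ≤ 0 n (Pcoef u) ⟩
    Σ≤ n (λ j → fc n j * (pow q (n ℕ.∸ j) * Sn (n ℕ.∸ j) (λ b → Pcoef u (j ∷ b))))
      -- The cut weight q^(n - j) on the coefficient of z^(n - j) is the substitution of qz for z,
      -- and `fc n j` completes the q-factorial of n - j to (q)ₙ.
      ≈⟨ Σ≤-cong≤ n (λ j l → trans (*-congˡ (*-congˡ (block-sum (n ℕ.∸ j) j (ih _ (ℕ.m∸n≤m n j)))))
           (trans (solve 4 (λ a b c d → a :* (b :* (c :* d)) := (a :* c) :* (b :* d)) refl _ _ _ _)
           (*-cong (fc-qf n j l) (trans (σ.*-homo f (Qₓ j θ) (n ℕ.∸ j)) (P.*-congˡ {f′} (σ-Q j) (n ℕ.∸ j)))))) ⟩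
    Σ≤ n (λ j → qf n * (f′ ⊛ Qₓ j θ′) (n ℕ.∸ j))
      ≈⟨ Σ≤-*ˡ n (qf n) _ ⟩
    qf n * Σ≤ n (λ j → (f′ ⊛ Qₓ j θ′) (n ℕ.∸ j))
      ≈⟨ *-congˡ (trans (ΣQ n) (key-coef n)) ⟩
    qf n * (cq (suc n) * f (suc n))
      ≈⟨ solve 3 (λ a b c → a :* (b :* c) := (b :* a) :* c) refl _ _ _ ⟩
    qf (suc n) * f (suc n) ∎
    where open Reasoning setoid

-- The induction leaves the ring free, since the step over R needs the statement over R[[η]]; the
-- bound n makes all smaller m available.
closed-form : ∀ {c ℓ : Level} n m → m ≤ n → (R : CommutativeRing c ℓ) (D : QData R) (u : CommutativeRing.Carrier R) →
  CommutativeRing._≈_ R (QData.Sn D m (TowerOps.Forms.Pcoef R (QData.t D) u))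
                        (CommutativeRing._*_ R (QData.qf D m) (Solution.sol D u m))
closed-form n       zero    _       R D u = CommutativeRing.sym R (CommutativeRing.*-identityˡ R _)
closed-form (suc n) (suc m) (s≤s l) R D u =
  Closed.closed-step D u m (λ k k≤m → closed-form n k (ℕ.≤-trans k≤m l) (PS R) (Extend.extend D))

-- Permutations as arrangements of a pool of letters

picks : List ℕ → List (ℕ × List ℕ)
picks []      = []
picks (v ∷ V) = (v , V) ∷ map (λ { (x , W) → (x , v ∷ W) }) (picks V)

-- A recursive enumeration by drawing letters from a pool. As `picks` keeps the order of what
-- remains, a sorted pool stays sorted.
arr : ℕ → List ℕ → List (List ℕ)
arr zero    V = [] ∷ []
arr (suc m) V = concatMap (λ { (x , W) → map (x ∷_) (arr m W) }) (picks V)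

remove : ℕ → List ℕ → List ℕ
remove a = filter (λ b → T? (not (b ≡ᵇ a)))

_∖_ : List ℕ → List ℕ → List ℕ
L ∖ X = filter (λ b → T? (not (elemᵇ b X))) L

avoidsᵇ : List ℕ → List ℕ → Bool
avoidsᵇ X []      = true
avoidsᵇ X (a ∷ w) = not (elemᵇ a X) ∧ avoidsᵇ X w

≡ᵇ-refl : ∀ a → (a ≡ᵇ a) ≡ true
≡ᵇ-refl a = Equivalence.to T-≡ (ℕ.≡⇒≡ᵇ a a ≡.refl)

≢⇒≡ᵇ-false : ∀ {a b} → a ≢ b → (a ≡ᵇ b) ≡ false
≢⇒≡ᵇ-false {a} {b} a≢b with a ≡ᵇ b in eq
... | false = ≡.refl
... | true  = ⊥-elim (a≢b (ℕ.≡ᵇ⇒≡ a b (Equivalence.from T-≡ eq)))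

≡ᵇ-sym : ∀ a b → (a ≡ᵇ b) ≡ (b ≡ᵇ a)
≡ᵇ-sym zero    zero    = ≡.refl
≡ᵇ-sym zero    (suc b) = ≡.refl
≡ᵇ-sym (suc a) zero    = ≡.refl
≡ᵇ-sym (suc a) (suc b) = ≡ᵇ-sym a b

remove-∉ : ∀ {a V} → All (a ≢_) V → remove a V ≡ V
remove-∉ []               = ≡.refl
remove-∉ {a} {b ∷ V} (p ∷ ps) rewrite ≢⇒≡ᵇ-false {b} {a} (p ∘ ≡.sym) = ≡.cong (b ∷_) (remove-∉ ps)

remove-∖ : ∀ a X L → remove a (L ∖ X) ≡ L ∖ (a ∷ X)
remove-∖ a X []      = ≡.refl
remove-∖ a X (b ∷ L) with elemᵇ b X
... | true  with b ≡ᵇ a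
...   | true  = remove-∖ a X L
...   | false = remove-∖ a X L
remove-∖ a X (b ∷ L) | false with b ≡ᵇ a
...   | true  = remove-∖ a X L
...   | false = ≡.cong (b ∷_) (remove-∖ a X L)

∖-[] : ∀ L → L ∖ [] ≡ L
∖-[] []      = ≡.refl
∖-[] (b ∷ L) = ≡.cong (b ∷_) (∖-[] L)

avoids-∷ : ∀ a X w → avoidsᵇ (a ∷ X) w ≡ (not (elemᵇ a w) ∧ avoidsᵇ X w)
avoids-∷ a X []      = ≡.refl
avoids-∷ a X (b ∷ w) rewrite ≡ᵇ-sym b a | avoids-∷ a X w with a ≡ᵇ b | elemᵇ b X | elemᵇ a w
... | true  | _     | _     = ≡.refl
... | false | true  | true  = ≡.refl
... | false | true  | false = ≡.refl
... | false | false | true  = ≡.refl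
... | false | false | false = ≡.refl

avoids-[] : ∀ w → avoidsᵇ [] w ≡ true
avoids-[] []      = ≡.refl
avoids-[] (a ∷ w) = avoids-[] w

distinct-avoids : ∀ a X w →
  (distinctᵇ (a ∷ w) ∧ avoidsᵇ X (a ∷ w)) ≡ (not (elemᵇ a X) ∧ (distinctᵇ w ∧ avoidsᵇ (a ∷ X) w))
distinct-avoids a X w rewrite avoids-∷ a X w with elemᵇ a w | elemᵇ a X | distinctᵇ w
... | true  | true  | _     = ≡.refl
... | true  | false | true  = ≡.refl
... | true  | false | false = ≡.refl
... | false | true  | true  = ≡.refl
... | false | true  | false = ≡.refl
... | false | false | _     = ≡.refl

desc-unique : ∀ n → Unique (desc n)
desc-unique zero    = []
desc-unique (suc n) = All.map (λ l e → ℕ.<-irrefl (≡.sym e) (s≤s l)) (desc≤ n) ∷ desc-unique n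

range-unique : ∀ n → Unique (range n)
range-unique n = Unique.map⁺ ℕ.suc-injective (Unique.upTo⁺ n)

module Enumeration {c ℓ : Level} (S : CommutativeSemiring c ℓ) where
  open CommutativeSemiring S
  open Eval S using (Σ[_]_)
  open ListSums S
  open import Relation.Binary.Reasoning.Setoid setoid
  open import Algebra.Properties.CommutativeSemigroup +-commutativeSemigroup using (x∙yz≈y∙xz)

  when : Bool → Carrier → Carrier
  when b x = if b then x else 0#

  when-∧ : ∀ b c x → when (b ∧ c) x ≈ when b (when c x)
  when-∧ true  c x = refl
  when-∧ false c x = refl

  when-cong : ∀ b {x y} → x ≈ y → when b x ≈ when b y
  when-cong true  e = e
  when-cong false e = refl

  Σ-when : {A : Set} (b : Bool) (xs : List A) (f : A → Carrier) → Σ[ xs ] (λ x → when b (f x)) ≈ when b (Σ[ xs ] f)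
  Σ-when true  xs f = refl
  Σ-when false xs f = Σ-zero xs

  Σ-filter : {A : Set} (p : A → Bool) (xs : List A) (f : A → Carrier) →
             Σ[ filter (λ x → T? (p x)) xs ] f ≈ Σ[ xs ] (λ x → when (p x) (f x))
  Σ-filter p []       f = refl
  Σ-filter p (x ∷ xs) f with p x
  ... | true  = +-congˡ (Σ-filter p xs f)
  ... | false = trans (Σ-filter p xs f) (sym (+-identityˡ _))

  Σ-picks-∷ : ∀ v V (h : ℕ → List ℕ → Carrier) →
    Σ[ picks (v ∷ V) ] (λ { (x , W) → h x W }) ≈ h v V + Σ[ picks V ] (λ { (x , W) → h x (v ∷ W) })
  Σ-picks-∷ v V h = +-congˡ (Σ-map _ (picks V) _)

  Σ-picks : ∀ {V} → Unique V → (h : ℕ → List ℕ → Carrier) →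
            Σ[ V ] (λ a → h a (remove a V)) ≈ Σ[ picks V ] (λ { (x , W) → h x W })
  Σ-picks []                        h = refl
  Σ-picks {v ∷ V} (v∉V ∷ unique) h = begin
    h v (remove v (v ∷ V)) + Σ[ V ] (λ a → h a (remove a (v ∷ V)))
      ≈⟨ +-cong (reflexive (≡.cong (h v) removed)) (Σ-congᴬ v∉V (λ p → reflexive (≡.cong (h _) (kept p)))) ⟩
    h v V + Σ[ V ] (λ a → h a (v ∷ remove a V))
      ≈⟨ +-congˡ (Σ-picks unique (λ a W → h a (v ∷ W))) ⟩
    h v V + Σ[ picks V ] (λ { (x , W) → h x (v ∷ W) })
      ≈⟨ Σ-picks-∷ v V h ⟨
    Σ[ picks (v ∷ V) ] (λ { (x , W) → h x W }) ∎
    where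
    removed : remove v (v ∷ V) ≡ V
    removed rewrite ≡ᵇ-refl v = remove-∉ v∉V
    kept : ∀ {a} → v ≢ a → remove a (v ∷ V) ≡ v ∷ remove a V
    kept {a} p rewrite ≢⇒≡ᵇ-false p = ≡.refl

  Σ-arr-suc : ∀ m V (g : List ℕ → Carrier) →
              Σ[ arr (suc m) V ] g ≈ Σ[ picks V ] (λ { (x , W) → Σ[ arr m W ] (λ w → g (x ∷ w)) })
  Σ-arr-suc m V g = trans (Σ-concatMap _ (picks V) g) (Σ-cong (picks V) (λ { (x , W) → Σ-map (x ∷_) (arr m W) g }))

  -- `X` holds the letters already used. `L` is left free because the right side needs the ascending
  -- pool and the left side the descending one.
  Σ-words : ∀ n L → Unique L → (∀ (h : ℕ → Carrier) → Σ[ range n ] h ≈ Σ[ L ] h) → ∀ m X (g : List ℕ → Carrier) →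
    Σ[ words n m ] (λ w → when (distinctᵇ w ∧ avoidsᵇ X w) (g w)) ≈ Σ[ arr m (L ∖ X) ] g
  Σ-words n L unique Σ≈ zero    X g = refl
  Σ-words n L unique Σ≈ (suc m) X g = begin
    Σ[ words n (suc m) ] (λ w → when (distinctᵇ w ∧ avoidsᵇ X w) (g w))
      ≈⟨ Σ-concatMap _ (range n) _ ⟩
    Σ[ range n ] (λ a → Σ[ map (a ∷_) (words n m) ] (λ w → when (distinctᵇ w ∧ avoidsᵇ X w) (g w)))
      ≈⟨ Σ-cong (range n) (λ a → Σ-map (a ∷_) (words n m) _) ⟩
    Σ[ range n ] (λ a → Σ[ words n m ] (λ w → when (distinctᵇ (a ∷ w) ∧ avoidsᵇ X (a ∷ w)) (g (a ∷ w))))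
      ≈⟨ Σ-cong (range n) (λ a → trans (Σ-cong (words n m) (λ w →
           trans (reflexive (≡.cong (λ b → when b (g (a ∷ w))) (distinct-avoids a X w))) (when-∧ (not (elemᵇ a X)) _ _)))
           (Σ-when (not (elemᵇ a X)) (words n m) _)) ⟩
    Σ[ range n ] (λ a → when (not (elemᵇ a X)) (Σ[ words n m ] (λ w → when (distinctᵇ w ∧ avoidsᵇ (a ∷ X) w) (g (a ∷ w)))))
      ≈⟨ Σ≈ _ ⟩
    Σ[ L ] (λ a → when (not (elemᵇ a X)) (Σ[ words n m ] (λ w → when (distinctᵇ w ∧ avoidsᵇ (a ∷ X) w) (g (a ∷ w)))))
      ≈⟨ Σ-filter _ L _ ⟨
    Σ[ L ∖ X ] (λ a → Σ[ words n m ] (λ w → when (distinctᵇ w ∧ avoidsᵇ (a ∷ X) w) (g (a ∷ w))))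
      ≈⟨ Σ-cong (L ∖ X) (λ a → trans (Σ-words n L unique Σ≈ m (a ∷ X) (λ w → g (a ∷ w)))
           (reflexive (≡.cong (λ V → Σ[ arr m V ] (λ w → g (a ∷ w))) (≡.sym (remove-∖ a X L))))) ⟩
    Σ[ L ∖ X ] (λ a → Σ[ arr m (remove a (L ∖ X)) ] (λ w → g (a ∷ w)))
      ≈⟨ Σ-picks (Unique.filter⁺ _ unique) (λ a W → Σ[ arr m W ] (λ w → g (a ∷ w))) ⟩
    Σ[ picks (L ∖ X) ] (λ { (a , W) → Σ[ arr m W ] (λ w → g (a ∷ w)) })
      ≈⟨ Σ-arr-suc m (L ∖ X) g ⟨
    Σ[ arr (suc m) (L ∖ X) ] g ∎

  Σ-perms : ∀ n L → Unique L → (∀ (h : ℕ → Carrier) → Σ[ range n ] h ≈ Σ[ L ] h) → (g : List ℕ → Carrier) →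
            Σ[ perms n ] g ≈ Σ[ arr n L ] g
  Σ-perms n L unique Σ≈ g = begin
    Σ[ perms n ] g
      ≈⟨ Σ-filter distinctᵇ (words n n) g ⟩
    Σ[ words n n ] (λ w → when (distinctᵇ w) (g w))
      ≈⟨ Σ-cong (words n n) (λ w → reflexive (≡.cong (λ b → when b (g w)) (≡.sym (noX w)))) ⟩
    Σ[ words n n ] (λ w → when (distinctᵇ w ∧ avoidsᵇ [] w) (g w))
      ≈⟨ Σ-words n L unique Σ≈ n [] g ⟩
    Σ[ arr n (L ∖ []) ] g
      ≡⟨ ≡.cong (λ V → Σ[ arr n V ] g) (∖-[] L) ⟩
    Σ[ arr n L ] g ∎
    where
    noX : ∀ w → (distinctᵇ w ∧ avoidsᵇ [] w) ≡ distinctᵇ w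
    noX w rewrite avoids-[] w with distinctᵇ w
    ... | true  = ≡.refl
    ... | false = ≡.refl

  Σ-desc : ∀ n (h : ℕ → Carrier) → Σ[ range n ] h ≈ Σ[ desc n ] h
  Σ-desc zero    h = refl
  Σ-desc (suc n) h = begin
    Σ[ range (suc n) ] h                                       ≡⟨ ≡.cong (λ xs → Σ[ map suc xs ] h) (≡.sym (upTo-∷ʳ n)) ⟩
    Σ[ map suc (upTo n ∷ʳ n) ] h                               ≡⟨ ≡.cong (λ xs → Σ[ xs ] h) (map-++ suc (upTo n) (n ∷ [])) ⟩
    Σ[ range n ++ (suc n ∷ []) ] h                             ≈⟨ Σ-++ (range n) _ h ⟩
    Σ[ range n ] h + (h (suc n) + 0#)                          ≈⟨ +-cong (Σ-desc n h) (+-identityʳ _) ⟩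
    Σ[ desc n ] h + h (suc n)                                  ≈⟨ +-comm _ _ ⟩
    Σ[ desc (suc n) ] h                                        ∎
    where open import Data.List.Properties using (upTo-∷ʳ; map-++)

  picks-swap : ∀ V (h : ℕ → ℕ → List ℕ → Carrier) →
    Σ[ picks V ] (λ { (x , W) → Σ[ picks W ] (λ { (y , U) → h x y U }) }) ≈
    Σ[ picks V ] (λ { (x , W) → Σ[ picks W ] (λ { (y , U) → h y x U }) })
  picks-swap []      h = refl
  picks-swap (v ∷ V) h = begin
    Σ[ picks (v ∷ V) ] (λ { (x , W) → Σ[ picks W ] (λ { (y , U) → h x y U }) })
      ≈⟨ expand h ⟩
    A + (B + C)
      ≈⟨ x∙yz≈y∙xz _ _ _ ⟩
    B + (A + C)
      ≈⟨ +-congˡ (+-congˡ (picks-swap V (λ x y U → h x y (v ∷ U)))) ⟩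
    B + (A + C′)
      ≈⟨ expand (λ x y U → h y x U) ⟨
    Σ[ picks (v ∷ V) ] (λ { (x , W) → Σ[ picks W ] (λ { (y , U) → h y x U }) }) ∎
    where
    A B C C′ : Carrier
    A = Σ[ picks V ] (λ { (y , U) → h v y U })
    B = Σ[ picks V ] (λ { (y , U) → h y v U })
    C = Σ[ picks V ] (λ { (x , W) → Σ[ picks W ] (λ { (y , U) → h x y (v ∷ U) }) })
    C′ = Σ[ picks V ] (λ { (x , W) → Σ[ picks W ] (λ { (y , U) → h y x (v ∷ U) }) })
    expand : (h : ℕ → ℕ → List ℕ → Carrier) →
      Σ[ picks (v ∷ V) ] (λ { (x , W) → Σ[ picks W ] (λ { (y , U) → h x y U }) }) ≈
      Σ[ picks V ] (λ { (y , U) → h v y U }) +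
        (Σ[ picks V ] (λ { (x , W) → h x v W }) + Σ[ picks V ] (λ { (x , W) → Σ[ picks W ] (λ { (y , U) → h x y (v ∷ U) }) }))
    expand h = trans (Σ-picks-∷ v V (λ x W → Σ[ picks W ] (λ { (y , U) → h x y U })))
      (+-congˡ (trans (Σ-cong (picks V) (λ { (x , W) → Σ-picks-∷ v W (h x) })) (Σ-+ (picks V) _ _)))

  Σ-arr-snoc : ∀ m V (g : List ℕ → Carrier) →
               Σ[ arr (suc m) V ] g ≈ Σ[ picks V ] (λ { (x , W) → Σ[ arr m W ] (λ w → g (w ∷ʳ x)) })
  Σ-arr-snoc zero    V g = Σ-arr-suc 0 V g
  Σ-arr-snoc (suc m) V g = begin
    Σ[ arr (suc (suc m)) V ] g
      ≈⟨ Σ-arr-suc (suc m) V g ⟩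
    Σ[ picks V ] (λ { (x , W) → Σ[ arr (suc m) W ] (λ w → g (x ∷ w)) })
      ≈⟨ Σ-cong (picks V) (λ { (x , W) → Σ-arr-snoc m W (λ w → g (x ∷ w)) }) ⟩
    Σ[ picks V ] (λ { (x , W) → Σ[ picks W ] (λ { (y , U) → Σ[ arr m U ] (λ w → g (x ∷ (w ∷ʳ y))) }) })
      ≈⟨ picks-swap V (λ x y U → Σ[ arr m U ] (λ w → g (x ∷ (w ∷ʳ y)))) ⟩
    Σ[ picks V ] (λ { (x , W) → Σ[ picks W ] (λ { (y , U) → Σ[ arr m U ] (λ w → g (y ∷ (w ∷ʳ x))) }) })
      ≈⟨ Σ-cong (picks V) (λ { (x , W) → Σ-arr-suc m W (λ w → g (w ∷ʳ x)) }) ⟨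
    Σ[ picks V ] (λ { (x , W) → Σ[ arr (suc m) W ] (λ w → g (w ∷ʳ x)) }) ∎

  Σ-arr-reverse : ∀ m V (g : List ℕ → Carrier) → Σ[ arr m V ] g ≈ Σ[ arr m V ] (λ w → g (reverse w))
  Σ-arr-reverse zero    V g = refl
  Σ-arr-reverse (suc m) V g = begin
    Σ[ arr (suc m) V ] g
      ≈⟨ Σ-arr-snoc m V g ⟩
    Σ[ picks V ] (λ { (x , W) → Σ[ arr m W ] (λ w → g (w ∷ʳ x)) })
      ≈⟨ Σ-cong (picks V) (λ { (x , W) → trans (Σ-arr-reverse m W (λ w → g (w ∷ʳ x)))
           (Σ-cong (arr m W) (λ w → reflexive (≡.cong g (≡.sym (unfold-reverse x w))))) }) ⟩
    Σ[ picks V ] (λ { (x , W) → Σ[ arr m W ] (λ w → g (reverse (x ∷ w))) })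
      ≈⟨ Σ-arr-suc m V (λ w → g (reverse w)) ⟨
    Σ[ arr (suc m) V ] (λ w → g (reverse w)) ∎

  picks-++ : ∀ U V (h : ℕ → List ℕ → Carrier) →
    Σ[ picks (U ++ V) ] (λ { (x , W) → h x W }) ≈
    Σ[ picks U ] (λ { (x , W) → h x (W ++ V) }) + Σ[ picks V ] (λ { (x , W) → h x (U ++ W) })
  picks-++ []      V h = sym (+-identityˡ _)
  picks-++ (u ∷ U) V h = begin
    Σ[ picks (u ∷ U ++ V) ] (λ { (x , W) → h x W })
      ≈⟨ Σ-picks-∷ u (U ++ V) h ⟩
    h u (U ++ V) + Σ[ picks (U ++ V) ] (λ { (x , W) → h x (u ∷ W) })
      ≈⟨ +-congˡ (picks-++ U V (λ x W → h x (u ∷ W))) ⟩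
    h u (U ++ V) + (Σ[ picks U ] (λ { (x , W) → h x (u ∷ W ++ V) }) + Σ[ picks V ] (λ { (x , W) → h x (u ∷ U ++ W) }))
      ≈⟨ +-assoc _ _ _ ⟨
    h u (U ++ V) + Σ[ picks U ] (λ { (x , W) → h x (u ∷ W ++ V) }) + Σ[ picks V ] (λ { (x , W) → h x (u ∷ U ++ W) })
      ≈⟨ +-congʳ (Σ-picks-∷ u U (λ x W → h x (W ++ V))) ⟨
    Σ[ picks (u ∷ U) ] (λ { (x , W) → h x (W ++ V) }) + Σ[ picks V ] (λ { (x , W) → h x (u ∷ U ++ W) }) ∎

  picks-congᴬ : {P : ℕ → Set} {V : List ℕ} {h h′ : ℕ → List ℕ → Carrier} → All P V →
    (∀ {x} W → P x → h x W ≈ h′ x W) →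
    Σ[ picks V ] (λ { (x , W) → h x W }) ≈ Σ[ picks V ] (λ { (x , W) → h′ x W })
  picks-congᴬ             []       e = refl
  picks-congᴬ {V = v ∷ V} {h} {h′} (p ∷ ps) e = trans (Σ-picks-∷ v V h) (trans
    (+-cong (e V p) (picks-congᴬ ps (λ W q → e (v ∷ W) q))) (sym (Σ-picks-∷ v V h′)))

  -- A chain picks x₁, x₂, … in turn, each standing in the relation lt to its predecessor;
  -- when the pool is sorted, it is determined by the set of its elements.
  module Chains (lt : ℕ → ℕ → Bool) (lt-irrefl : ∀ x → lt x x ≡ false) (weight : ℕ → ℕ → List ℕ → Carrier) where

    chain : ℕ → ℕ → List ℕ → ℕ → (List ℕ → Carrier) → Carrier
    chain zero    p V y Φ = Φ V
    chain (suc k) p V y Φ =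
      Σ[ picks V ] (λ { (x , W) → when (lt x y) (weight p x W * chain k (ℕ.pred p) W x Φ) })

    -- `U` contains the candidates already passed over, `V` those still to be decided; a chosen
    -- element leaves `U ++ V` behind.
    subset : ℕ → ℕ → List ℕ → List ℕ → (List ℕ → Carrier) → Carrier
    subset zero    p U V       Φ = Φ (U ++ V)
    subset (suc k) p U []      Φ = 0#
    subset (suc k) p U (v ∷ V) Φ = weight p v (U ++ V) * subset k (ℕ.pred p) U V Φ + subset (suc k) p (U ∷ʳ v) V Φ

    Before : ℕ → ℕ → Set
    Before a b = lt b a ≡ true × lt a b ≡ false

    -- In a sorted pool a chain only moves forward: a candidate that was passed over is not in
    -- relation `lt` to any later element and cannot be taken any more.
    chain-subset : ∀ k p U V y Φ → AllPairs Before V →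
      All (λ v → All (λ u → lt u v ≡ false) U) V → All (λ u → lt u y ≡ false) U → All (λ v → lt v y ≡ true) V →
      chain k p (U ++ V) y Φ ≈ subset k p U V Φ
    chain-subset zero    p U V       y Φ sorted cross low high = refl
    chain-subset (suc k) p U []      y Φ sorted cross low high = trans (picks-++ U [] step)
      (trans (+-identityʳ _) (trans (picks-congᴬ {h′ = λ _ _ → 0#} low (λ {x} W e →
        reflexive (≡.cong (λ b → when b (weight p x (W ++ []) * chain k (ℕ.pred p) (W ++ []) x Φ)) e))) (Σ-zero (picks U))))
      where
      step : ℕ → List ℕ → Carrier
      step x W = when (lt x y) (weight p x W * chain k (ℕ.pred p) W x Φ)
    chain-subset (suc k) p U (v ∷ V) y Φ (v<V ∷ sorted) (c ∷ cross) low (h ∷ high) = begin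
      chain (suc k) p (U ++ v ∷ V) y Φ
        ≈⟨ trans (picks-++ U (v ∷ V) (step y)) (trans (+-congʳ (vanish U y low (v ∷ V))) (trans (+-identityˡ _) (Σ-picks-∷ v V (λ x W → step y x (U ++ W))))) ⟩
      step y v (U ++ V) + Σ[ picks V ] (λ { (x , W) → step y x (U ++ v ∷ W) })
        ≈⟨ +-cong (trans (reflexive (≡.cong (λ b → when b (weight p v (U ++ V) * chain k (ℕ.pred p) (U ++ V) v Φ)) h))
                         (*-congˡ (chain-subset k (ℕ.pred p) U V v Φ sorted cross c (All.map proj₁ v<V))))
                  rest ⟩
      weight p v (U ++ V) * subset k (ℕ.pred p) U V Φ + chain (suc k) p ((U ∷ʳ v) ++ V) v Φ
        ≈⟨ +-congˡ (chain-subset (suc k) p (U ∷ʳ v) V v Φ sorted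
             (All.zipWith (λ { (cs , b) → All.++⁺ cs (proj₂ b ∷ []) }) (cross , v<V))
             (All.++⁺ c (lt-irrefl v ∷ [])) (All.map proj₁ v<V)) ⟩
      weight p v (U ++ V) * subset k (ℕ.pred p) U V Φ + subset (suc k) p (U ∷ʳ v) V Φ ∎
      where
      step : ℕ → ℕ → List ℕ → Carrier
      step y x W = when (lt x y) (weight p x W * chain k (ℕ.pred p) W x Φ)
      vanish : ∀ U y → All (λ u → lt u y ≡ false) U → ∀ V → Σ[ picks U ] (λ { (x , W) → step y x (W ++ V) }) ≈ 0#
      vanish U y low V = trans (picks-congᴬ {h′ = λ _ _ → 0#} low (λ {x} W e →
        reflexive (≡.cong (λ b → when b (weight p x (W ++ V) * chain k (ℕ.pred p) (W ++ V) x Φ)) e))) (Σ-zero (picks U))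
      rest : Σ[ picks V ] (λ { (x , W) → step y x (U ++ v ∷ W) }) ≈ chain (suc k) p ((U ∷ʳ v) ++ V) v Φ
      rest = sym (trans (picks-++ (U ∷ʳ v) V (step v)) (trans (+-congʳ (vanish (U ∷ʳ v) v (All.++⁺ c (lt-irrefl v ∷ [])) V))
        (trans (+-identityˡ _) (picks-congᴬ (All.zip (high , v<V)) (λ {x} W e →
          trans (reflexive (≡.cong (step v x) (++-assoc U (v ∷ []) W)))
                (reflexive (≡.cong (λ b → when b (weight p x (U ++ v ∷ W) * chain k (ℕ.pred p) (U ++ v ∷ W) x Φ))
                  (≡.trans (proj₁ (proj₂ e)) (≡.sym (proj₁ e))))))))))

picks-smaller : ∀ x W → All (λ { (y , W′) → ind (y <ᵇ x) ℕ.+ smaller x W′ ≡ smaller x W × suc (length W′) ≡ length W }) (picks W)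
picks-smaller x []      = []
picks-smaller x (v ∷ W) = (≡.refl , ≡.refl) ∷ All.map⁺ (All.map (λ { {y , W′} (e , l) →
    ≡.trans (x∙yz≈y∙xz (ind (y <ᵇ x)) (ind (v <ᵇ x)) (smaller x W′)) (≡.cong (ind (v <ᵇ x) ℕ.+_) e) , ≡.cong suc l })
  (picks-smaller x W))
  where open import Algebra.Properties.CommutativeSemigroup ℕ.+-commutativeSemigroup using (x∙yz≈y∙xz)

AllPairs-drop : {P : ℕ → ℕ → Set} → ∀ U {v V} → AllPairs P (U ++ v ∷ V) → AllPairs P (U ++ V)
AllPairs-drop []      (_ ∷ ps) = ps
AllPairs-drop (u ∷ U) (p ∷ ps) = All.++⁺ (All.++⁻ˡ U p) (All.tail (All.++⁻ʳ U p)) ∷ AllPairs-drop U ps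

smaller-middle : ∀ U {v V} → AllPairs _<_ (U ++ v ∷ V) → smaller v (U ++ V) ≡ length U
smaller-middle []      {v} (p ∷ _) = above p
  where
  above : ∀ {V} → All (v <_) V → smaller v V ≡ 0
  above []       = ≡.refl
  above (l ∷ ls) rewrite <ᵇ-false (ℕ.<⇒≤ l) = above ls
smaller-middle (u ∷ U) {v} (p ∷ ps) rewrite <ᵇ-true (All.head (All.++⁻ʳ U p)) = ≡.cong suc (smaller-middle U ps)

-- Right side: the sum over words with long ascending runs

module RightSide {c ℓ : Level} {R : CommutativeRing c ℓ} (D : QData R) where
  open CommutativeRing R
  open QData D
  open Eval commutativeSemiring using (pow; Σ[_]_)
  open ListSums commutativeSemiring
  open Enumeration commutativeSemiring
  open PowerSeries R using (mul; mul-Σ≤)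
  open Solution D using (κ; sol)
  open DifferenceSolver R using (solve; _:+_; _:*_; _:=_; :-_; :1)
  open import Relation.Binary.Reasoning.Setoid setoid

  -- total weight of the factorisations of an ascending run into blocks of length at least two
  runWeight : ℕ → Carrier
  runWeight 0             = 1#
  runWeight 1             = 0#
  runWeight (suc (suc m)) = t * pow (1# + t) m

  -- The block has j + 1 letters; a single letter gets weight 0.
  blockWeight : ℕ → Carrier
  blockWeight j = t * br j

  wtFrom : ℕ → ℕ → List ℕ → Carrier
  wtFrom i a []      = runWeight (suc i)
  wtFrom i a (b ∷ w) = if a <ᵇ b then wtFrom (suc i) b w else runWeight (suc i) * wtFrom 0 b w

  wt : List ℕ → Carrier
  wt []      = 1#
  wt (a ∷ w) = wtFrom 0 a w

  -- The weight of a word expanded by its first block, of which j letters precede a: the block ends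
  -- at a, or goes on if the run does.
  firstBlock : ℕ → ℕ → List ℕ → Carrier
  firstBlock j a []      = blockWeight j
  firstBlock j a (b ∷ w) = blockWeight j * wt (b ∷ w) + when (a <ᵇ b) (firstBlock (suc j) b w)

  private
    runLen : ℕ → List ℕ → ℕ
    runLen a []      = 0
    runLen a (b ∷ w) = if a <ᵇ b then suc (runLen b w) else 0

    runRest : ℕ → List ℕ → List ℕ
    runRest a []      = []
    runRest a (b ∷ w) = if a <ᵇ b then runRest b w else b ∷ w

    wtFrom-run : ∀ i a w → wtFrom i a w ≈ runWeight (suc i ℕ.+ runLen a w) * wt (runRest a w)
    wtFrom-run i a []      = trans (reflexive (≡.cong runWeight (≡.sym (ℕ.+-identityʳ (suc i))))) (sym (*-identityʳ _))
    wtFrom-run i a (b ∷ w) with a <ᵇ b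
    ... | true  = trans (wtFrom-run (suc i) b w) (*-congʳ (reflexive (≡.cong runWeight (≡.sym (ℕ.+-suc (suc i) _)))))
    ... | false = *-congʳ (reflexive (≡.cong runWeight (≡.sym (ℕ.+-identityʳ (suc i)))))

    firstBlock-run : ∀ j a w → firstBlock j a w ≈
      Σ≤ (runLen a w) (λ i → blockWeight (j ℕ.+ i) * runWeight (runLen a w ℕ.∸ i)) * wt (runRest a w)
    firstBlock-run j a [] =
      trans (reflexive (≡.cong blockWeight (≡.sym (ℕ.+-identityʳ j)))) (sym (trans (*-identityʳ _) (*-identityʳ _)))
    firstBlock-run j a (b ∷ w) with a <ᵇ b
    ... | false = trans (+-identityʳ _) (*-congʳ (trans (reflexive (≡.cong blockWeight (≡.sym (ℕ.+-identityʳ j)))) (sym (*-identityʳ _))))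
    ... | true  = begin
      blockWeight j * wtFrom 0 b w + firstBlock (suc j) b w
        ≈⟨ +-cong (*-congˡ (wtFrom-run 0 b w)) (firstBlock-run (suc j) b w) ⟩
      blockWeight j * (runWeight (suc L) * wt ρ) + Σ≤ L (λ i → blockWeight (suc j ℕ.+ i) * runWeight (L ℕ.∸ i)) * wt ρ
        ≈⟨ solve 4 (λ a b c d → a :* (b :* c) :+ d :* c := (a :* b :+ d) :* c) refl _ _ _ _ ⟩
      (blockWeight j * runWeight (suc L) + Σ≤ L (λ i → blockWeight (suc j ℕ.+ i) * runWeight (L ℕ.∸ i))) * wt ρ
        ≈⟨ *-congʳ (+-cong (*-congʳ (reflexive (≡.cong blockWeight (≡.sym (ℕ.+-identityʳ j)))))
             (Σ≤-cong L (λ i → *-congʳ (reflexive (≡.cong blockWeight (≡.sym (ℕ.+-suc j i))))))) ⟩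
      Σ≤ (suc L) (λ i → blockWeight (j ℕ.+ i) * runWeight (suc L ℕ.∸ i)) * wt ρ ∎
      where
      L : ℕ
      L = runLen b w
      ρ : List ℕ
      ρ = runRest b w

    1⋆runWeight : ∀ n → mul (λ _ → 1#) runWeight (suc n) ≈ pow (1# + t) n
    1⋆runWeight zero    = trans (+-cong (*-identityˡ 0#) (*-identityˡ 1#)) (+-identityˡ 1#)
    1⋆runWeight (suc n) = trans (+-cong (*-identityˡ _) (1⋆runWeight n))
      (solve 2 (λ t p → t :* p :+ p := (:1 :+ t) :* p) refl t _)

    br⋆runWeight : ∀ n → mul br runWeight (suc n) ≈ pow (1# + t) n
    br⋆runWeight zero    = trans (+-cong (zeroˡ _) (trans (*-identityʳ _) (trans (+-congˡ (zeroʳ t)) (+-identityʳ 1#)))) (+-identityˡ 1#)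
    br⋆runWeight (suc n) = begin
      0# * runWeight (suc (suc n)) + mul (λ k → 1# + t * br k) runWeight (suc n)
        ≈⟨ trans (+-congʳ (zeroˡ _)) (+-identityˡ _) ⟩
      mul (λ k → 1# + t * br k) runWeight (suc n)
        ≈⟨ PowerSeries.mul-distribʳ R runWeight (λ _ → 1#) (λ k → t * br k) (suc n) ⟩
      mul (λ _ → 1#) runWeight (suc n) + mul (λ k → t * br k) runWeight (suc n)
        ≈⟨ +-cong (1⋆runWeight n) (trans (PowerSeries.mul-scale R t br runWeight (suc n)) (*-congˡ (br⋆runWeight n))) ⟩
      pow (1# + t) n + t * pow (1# + t) n
        ≈⟨ solve 2 (λ t p → p :+ t :* p := (:1 :+ t) :* p) refl t _ ⟩
      pow (1# + t) (suc n) ∎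

    -- Splits the first block off a run of n + 1 letters. The value 1 of `runWeight 0` stands for a
    -- block that exhausts the run; the rest is [k + 1] = 1 + t [k] summed against the run weights.
    runWeight-suc : ∀ n → runWeight (suc n) ≈ mul blockWeight runWeight n
    runWeight-suc zero    = sym (trans (*-congʳ (zeroʳ t)) (zeroˡ _))
    runWeight-suc (suc n) = sym (trans (PowerSeries.mul-scale R t br runWeight (suc n)) (*-congˡ (br⋆runWeight n)))

  wt-firstBlock : ∀ a w → wt (a ∷ w) ≈ firstBlock 0 a w
  wt-firstBlock a w = trans (wtFrom-run 0 a w) (trans (*-congʳ (trans (runWeight-suc (runLen a w)) (mul-Σ≤ blockWeight runWeight (runLen a w))))
    (sym (firstBlock-run 0 a w)))

  Z : ℕ → List ℕ → Carrier
  Z m V = Σ[ arr m V ] (λ w → pow q (inv w) * wt w)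

  open Chains (λ x y → y <ᵇ x) (λ x → <ᵇ-false {x} {x} ℕ.≤-refl) (λ _ x W → pow q (smaller x W))

  private
    -- All arrangements of `W` have the same letters, hence equally many letters below x.
    Σ-arr-smaller : ∀ x m W → length W ≡ m → ∀ (h : List ℕ → Carrier) →
      Σ[ arr m W ] (λ w → pow q (smaller x w) * h w) ≈ pow q (smaller x W) * Σ[ arr m W ] h
    Σ-arr-smaller x zero    []      _ h = sym (trans (distribˡ _ _ _) (+-congˡ (zeroʳ _)))
    Σ-arr-smaller x (suc m) W       l h = begin
      Σ[ arr (suc m) W ] (λ w → pow q (smaller x w) * h w)
        ≈⟨ Σ-arr-suc m W _ ⟩
      Σ[ picks W ] (λ { (y , W′) → Σ[ arr m W′ ] (λ w → pow q (ind (y <ᵇ x) ℕ.+ smaller x w) * h (y ∷ w)) })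
        ≈⟨ Σ-congᴬ (picks-smaller x W) (λ { {y , W′} (e , l′) → begin
             Σ[ arr m W′ ] (λ w → pow q (ind (y <ᵇ x) ℕ.+ smaller x w) * h (y ∷ w))
               ≈⟨ Σ-cong (arr m W′) (λ w → trans (*-congʳ (pow-+ q (ind (y <ᵇ x)) _)) (*-assoc _ _ _)) ⟩
             Σ[ arr m W′ ] (λ w → pow q (ind (y <ᵇ x)) * (pow q (smaller x w) * h (y ∷ w)))
               ≈⟨ trans (Σ-*ˡ _ (arr m W′) _) (*-congˡ (Σ-arr-smaller x m W′ (ℕ.suc-injective (≡.trans l′ l)) _)) ⟩
             pow q (ind (y <ᵇ x)) * (pow q (smaller x W′) * Σ[ arr m W′ ] (λ w → h (y ∷ w)))
               ≈⟨ trans (sym (*-assoc _ _ _)) (*-congʳ (trans (sym (pow-+ q (ind (y <ᵇ x)) _)) (reflexive (≡.cong (pow q) e)))) ⟩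
             pow q (smaller x W) * Σ[ arr m W′ ] (λ w → h (y ∷ w)) ∎ }) ⟩
      Σ[ picks W ] (λ { (y , W′) → pow q (smaller x W) * Σ[ arr m W′ ] (λ w → h (y ∷ w)) })
        ≈⟨ trans (Σ-*ˡ _ (picks W) _) (*-congˡ (sym (Σ-arr-suc m W h))) ⟩
      pow q (smaller x W) * Σ[ arr (suc m) W ] h ∎

    Zblock : ℕ → ℕ → ℕ → List ℕ → Carrier
    Zblock m j x W = Σ[ arr m W ] (λ w → pow q (inv w) * firstBlock j x w)

    picks-length : ∀ W → All (λ { (y , W′) → suc (length W′) ≡ length W }) (picks W)
    picks-length W = All.map (λ { {y , W′} (_ , l) → l }) (picks-smaller 0 W)

    Z-suc : ∀ m V → length V ≡ suc m → Z (suc m) V ≈ Σ[ picks V ] (λ { (x , W) → pow q (smaller x W) * Zblock m 0 x W })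
    Z-suc m V l = trans (Σ-arr-suc m V _) (Σ-congᴬ (picks-length V) (λ { {x , W} l′ → trans
      (Σ-cong (arr m W) (λ w → trans (*-cong (pow-+ q (smaller x w) _) (wt-firstBlock x w)) (*-assoc _ _ _)))
      (Σ-arr-smaller x m W (ℕ.suc-injective (≡.trans l′ l)) _) }))

    -- The i further letters of the first block form an ascending chain starting above x. What
    -- follows the block is an unrestricted arrangement of the remaining pool, since cuts may fall
    -- inside a run.
    Zblock-chain : ∀ m j x W → length W ≡ m →
      Zblock m j x W ≈ Σ≤ m (λ i → blockWeight (j ℕ.+ i) * chain i 0 W x (Z (m ℕ.∸ i)))
    Zblock-chain zero    j x []  _ = begin
      1# * blockWeight j + 0#                     ≈⟨ trans (+-identityʳ _) (*-comm _ _) ⟩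
      blockWeight j * 1#                          ≈⟨ *-cong (reflexive (≡.cong blockWeight (≡.sym (ℕ.+-identityʳ j)))) (sym (trans (+-identityʳ _) (*-identityˡ 1#))) ⟩
      blockWeight (j ℕ.+ 0) * (1# * 1# + 0#)      ∎
    Zblock-chain (suc m) j x W l = begin
      Σ[ arr (suc m) W ] (λ w → pow q (inv w) * firstBlock j x w)
        ≈⟨ Σ-arr-suc m W _ ⟩
      Σ[ picks W ] (λ { (y , U) → Σ[ arr m U ] (λ w → pow q (inv (y ∷ w)) * (blockWeight j * wt (y ∷ w) + when (x <ᵇ y) (firstBlock (suc j) y w))) })
        ≈⟨ Σ-congᴬ (picks-length W) (λ { {y , U} l′ → trans (Σ-cong (arr m U) (λ w → split (x <ᵇ y) _ _ _ _))
             (trans (Σ-+ (arr m U) _ _) (+-cong (Σ-*ˡ _ (arr m U) _) (trans (Σ-when (x <ᵇ y) (arr m U) _)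
               (when-cong (x <ᵇ y) (inner y U (ℕ.suc-injective (≡.trans l′ l))))))) }) ⟩
      Σ[ picks W ] (λ { (y , U) → blockWeight j * Σ[ arr m U ] (λ w → pow q (inv (y ∷ w)) * wt (y ∷ w)) +
                                  when (x <ᵇ y) (pow q (smaller y U) * Zblock m (suc j) y U) })
        ≈⟨ Σ-+ (picks W) _ _ ⟩
      Σ[ picks W ] (λ { (y , U) → blockWeight j * Σ[ arr m U ] (λ w → pow q (inv (y ∷ w)) * wt (y ∷ w)) }) +
      Σ[ picks W ] (λ { (y , U) → when (x <ᵇ y) (pow q (smaller y U) * Zblock m (suc j) y U) })
        ≈⟨ +-cong (trans (Σ-*ˡ _ (picks W) _) (*-cong (reflexive (≡.cong blockWeight (≡.sym (ℕ.+-identityʳ j)))) (sym (Σ-arr-suc m W _))))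
                  (Σ-congᴬ (picks-length W) (λ { {y , U} l′ → expand y U (ℕ.suc-injective (≡.trans l′ l)) })) ⟩
      blockWeight (j ℕ.+ 0) * Z (suc m) W +
      Σ[ picks W ] (λ { (y , U) → Σ≤ m (λ i → blockWeight (j ℕ.+ suc i) * when (x <ᵇ y) (pow q (smaller y U) * chain i 0 U y (Z (m ℕ.∸ i)))) })
        ≈⟨ +-congˡ (trans (Σ-Σ≤-swap (picks W) m _) (Σ≤-cong m (λ i → Σ-*ˡ _ (picks W) _))) ⟩
      Σ≤ (suc m) (λ i → blockWeight (j ℕ.+ i) * chain i 0 W x (Z (suc m ℕ.∸ i))) ∎
      where
      split : ∀ b p k v f → p * (k * v + when b f) ≈ k * (p * v) + when b (p * f)
      split true  p k v f = solve 4 (λ p k v f → p :* (k :* v :+ f) := k :* (p :* v) :+ p :* f) refl p k v f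
      split false p k v f = trans (*-congˡ (+-identityʳ _)) (trans (solve 3 (λ p k v → p :* (k :* v) := k :* (p :* v)) refl p k v) (sym (+-identityʳ _)))
      inner : ∀ y U → length U ≡ m → Σ[ arr m U ] (λ w → pow q (inv (y ∷ w)) * firstBlock (suc j) y w) ≈ pow q (smaller y U) * Zblock m (suc j) y U
      inner y U e = trans (Σ-cong (arr m U) (λ w → trans (*-congʳ (pow-+ q (smaller y w) _)) (*-assoc _ _ _))) (Σ-arr-smaller y m U e _)
      expand : ∀ y U → length U ≡ m → when (x <ᵇ y) (pow q (smaller y U) * Zblock m (suc j) y U) ≈
        Σ≤ m (λ i → blockWeight (j ℕ.+ suc i) * when (x <ᵇ y) (pow q (smaller y U) * chain i 0 U y (Z (m ℕ.∸ i))))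
      expand y U e with x <ᵇ y
      ... | true  = trans (*-congˡ (Zblock-chain m (suc j) y U e)) (trans (sym (Σ≤-*ˡ m _ _)) (Σ≤-cong m (λ i →
                      trans (solve 3 (λ a b c → a :* (b :* c) := b :* (a :* c)) refl _ _ _)
                            (*-congʳ (reflexive (≡.cong blockWeight (≡.sym (ℕ.+-suc j i))))))))
      ... | false = sym (trans (Σ≤-cong m (λ i → zeroʳ _)) (Σ≤-zero m))

    -- Σ q^(inversions with the complement) over the k-subsets of an n-set, each chosen element
    -- being preceded by s further smaller elements
    gauss : ℕ → ℕ → ℕ → Carrier
    gauss zero    s n       = 1#
    gauss (suc k) s zero    = 0#
    gauss (suc k) s (suc n) = pow q s * gauss k s n + gauss (suc k) (suc s) n

    gauss-vanish : ∀ k s → gauss (suc k) s k ≈ 0#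
    gauss-vanish k s = go k k s ℕ.≤-refl
      where
      go : ∀ k n s → n ≤ k → gauss (suc k) s n ≈ 0#
      go k       zero    s _       = refl
      go (suc k) (suc n) s (s≤s l) = trans (+-cong (trans (*-congˡ (go k n s l)) (zeroʳ _)) (go (suc k) n (suc s) (ℕ.m≤n⇒m≤1+n l))) (+-identityˡ _)

    -- `gauss k s (k + m)` is q^(sk) times the q-binomial coefficient of k + m over k. The step is
    -- the q-Pascal rule, in the form (1 - a) + a (1 - b) = 1 - a b with a = qᵏ⁺¹ and b = qᵐ.
    gauss-qf : ∀ k m s → gauss k s (k ℕ.+ m) * (qf k * qf m) ≈ pow q (s ℕ.* k) * qf (k ℕ.+ m)
    gauss-qf zero    m s = trans (*-identityˡ _) (trans (*-identityˡ _) (sym (trans (*-congʳ (reflexive (≡.cong (pow q) (ℕ.*-zeroʳ s)))) (*-identityˡ _))))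
    gauss-qf (suc k) m s = begin
      (pow q s * gauss k s (k ℕ.+ m) + gauss (suc k) (suc s) (k ℕ.+ m)) * ((cq (suc k) * qf k) * qf m)
        ≈⟨ solve 6 (λ a g h c x y → (a :* g :+ h) :* ((c :* x) :* y) := a :* c :* (g :* (x :* y)) :+ h :* ((c :* x) :* y)) refl _ _ _ _ _ _ ⟩
      pow q s * cq (suc k) * (gauss k s (k ℕ.+ m) * (qf k * qf m)) + gauss (suc k) (suc s) (k ℕ.+ m) * (qf (suc k) * qf m)
        ≈⟨ +-cong (*-congˡ (gauss-qf k m s)) (second m) ⟩
      pow q s * cq (suc k) * (pow q (s ℕ.* k) * qf (k ℕ.+ m)) + cq m * (pow q (suc s ℕ.* suc k) * qf (k ℕ.+ m))
        ≈⟨ +-congˡ (*-congˡ (*-congʳ (pow-+ q (suc k) (s ℕ.* suc k)))) ⟩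
      pow q s * cq (suc k) * (pow q (s ℕ.* k) * qf (k ℕ.+ m)) + cq m * (pow q (suc k) * pow q (s ℕ.* suc k) * qf (k ℕ.+ m))
        ≈⟨ +-congʳ (solve 4 (λ a c b d → a :* c :* (b :* d) := c :* ((a :* b) :* d)) refl _ _ _ _) ⟩
      cq (suc k) * ((pow q s * pow q (s ℕ.* k)) * qf (k ℕ.+ m)) + cq m * (pow q (suc k) * pow q (s ℕ.* suc k) * qf (k ℕ.+ m))
        ≈⟨ +-congʳ (*-congˡ (*-congʳ (trans (sym (pow-+ q s (s ℕ.* k))) (reflexive (≡.cong (pow q) (≡.sym (ℕ.*-suc s k))))))) ⟩
      cq (suc k) * (pow q (s ℕ.* suc k) * qf (k ℕ.+ m)) + cq m * (pow q (suc k) * pow q (s ℕ.* suc k) * qf (k ℕ.+ m))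
        ≈⟨ solve 4 (λ a b c d → (:1 :+ :- a) :* (c :* d) :+ (:1 :+ :- b) :* (a :* c :* d)
             := c :* ((:1 :+ :- (a :* b)) :* d)) refl (pow q (suc k)) (pow q m) _ _ ⟩
      pow q (s ℕ.* suc k) * ((1# + - (pow q (suc k) * pow q m)) * qf (k ℕ.+ m))
        ≈⟨ *-congˡ (*-congʳ (+-congˡ (-‿cong (sym (pow-+ q (suc k) m))))) ⟩
      pow q (s ℕ.* suc k) * (cq (suc k ℕ.+ m) * qf (k ℕ.+ m)) ∎
      where
      second : ∀ m → gauss (suc k) (suc s) (k ℕ.+ m) * (qf (suc k) * qf m) ≈ cq m * (pow q (suc s ℕ.* suc k) * qf (k ℕ.+ m))
      -- For m = 0 both sides vanish: a k-set has no subset of k + 1 elements, and 1 - q⁰ = 0.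
      second zero    rewrite ℕ.+-identityʳ k = trans (*-congʳ (gauss-vanish k (suc s))) (trans (zeroˡ _)
        (sym (trans (*-congʳ (-‿inverseʳ 1#)) (zeroˡ _))))
      second (suc m) rewrite ℕ.+-suc k m = trans
        (solve 4 (λ g x c y → g :* (x :* (c :* y)) := c :* (g :* (x :* y))) refl _ _ _ _)
        (*-congˡ (gauss-qf (suc k) m (suc s)))

    -- In an ascending pool the remaining letters below a chosen v are exactly those passed over, so
    -- the weight depends on the length of `U` alone.
    subset-gauss : ∀ k p U V Φ r ζ → AllPairs _<_ (0 ∷ U ++ V) → k ℕ.+ r ≡ length (U ++ V) →
      (∀ W → AllPairs _<_ (0 ∷ W) → length W ≡ r → Φ W ≈ ζ) →
      subset k p U V Φ ≈ gauss k (length U) (length V) * ζ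
    subset-gauss zero    p U V       Φ r ζ asc e h = trans (h (U ++ V) asc (≡.sym e)) (sym (*-identityˡ _))
    subset-gauss (suc k) p U []      Φ r ζ asc e h = sym (zeroˡ _)
    subset-gauss (suc k) p U (v ∷ V) Φ r ζ asc e h = trans (+-cong
      (trans (*-cong (reflexive (≡.cong (pow q) (smaller-middle U (AllPairs.tail asc))))
               (subset-gauss k (ℕ.pred p) U V Φ r ζ (AllPairs-drop (0 ∷ U) asc) shorter h)) (sym (*-assoc _ _ _)))
      (trans (subset-gauss (suc k) p (U ∷ʳ v) V Φ r ζ
               (≡.subst (λ W → AllPairs _<_ (0 ∷ W)) (≡.sym (++-assoc U (v ∷ []) V)) asc)
               (≡.trans e (≡.cong length (≡.sym (++-assoc U (v ∷ []) V)))) h)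
             (*-congʳ (reflexive (≡.cong (λ s → gauss (suc k) s (length V)) (≡.trans (length-++ U) (ℕ.+-comm _ 1)))))))
      (sym (distribʳ _ _ _))
      where
      shorter : k ℕ.+ r ≡ length (U ++ V)
      shorter = ℕ.suc-injective (≡.trans e (≡.trans (length-++ U) (≡.trans (ℕ.+-suc _ _) (≡.cong suc (≡.sym (length-++ U))))))

  Z-closed : ∀ n m → m ≤ n → ∀ V → AllPairs _<_ (0 ∷ V) → length V ≡ m → Z m V ≈ qf m * sol 0# m
  Z-closed n       zero    _       []  asc _ = +-identityʳ _
  Z-closed (suc n) (suc m) (s≤s l) V   (pos ∷ asc) e = begin
    Z (suc m) V
      ≈⟨ Z-suc m V e ⟩
    Σ[ picks V ] (λ { (x , W) → pow q (smaller x W) * Zblock m 0 x W })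
      ≈⟨ Σ-congᴬ (picks-length V) (λ { {x , W} l′ → trans (*-congˡ (Zblock-chain m 0 x W (ℕ.suc-injective (≡.trans l′ e))))
           (trans (sym (Σ≤-*ˡ m _ _)) (Σ≤-cong m (λ i → solve 3 (λ a b c → a :* (b :* c) := b :* (a :* c)) refl _ _ _))) }) ⟩
    Σ[ picks V ] (λ { (x , W) → Σ≤ m (λ i → blockWeight i * (pow q (smaller x W) * chain i 0 W x (Z (m ℕ.∸ i)))) })
      ≈⟨ trans (Σ-Σ≤-swap (picks V) m _) (Σ≤-cong m (λ i → Σ-*ˡ _ (picks V) _)) ⟩
    Σ≤ m (λ i → blockWeight i * Σ[ picks V ] (λ { (x , W) → pow q (smaller x W) * chain i 0 W x (Z (m ℕ.∸ i)) }))
      -- The sentinel 0 lies below every letter, so the first letter of the block becomes the first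
      -- link of a chain of i + 1 letters.
      ≈⟨ Σ≤-cong m (λ i → *-congˡ (picks-congᴬ pos (λ {x} W p → reflexive (≡.cong (λ b → when b (pow q (smaller x W) * chain i 0 W x (Z (m ℕ.∸ i)))) (≡.sym (<ᵇ-true p)))))) ⟩
    Σ≤ m (λ i → blockWeight i * chain (suc i) 0 V 0 (Z (m ℕ.∸ i)))
      ≈⟨ Σ≤-cong m (λ i → *-congˡ (chain-subset (suc i) 0 [] V 0 (Z (m ℕ.∸ i)) (AllPairs.map (λ p → <ᵇ-true p , <ᵇ-false (ℕ.<⇒≤ p)) asc)
           (All.map (λ _ → []) pos) [] (All.map <ᵇ-true pos))) ⟩
    Σ≤ m (λ i → blockWeight i * subset (suc i) 0 [] V (Z (m ℕ.∸ i)))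
      ≈⟨ Σ≤-cong≤ m (λ i i≤m → trans (*-congˡ (subset-gauss (suc i) 0 [] V (Z (m ℕ.∸ i)) (m ℕ.∸ i) _ (pos ∷ asc)
           (≡.trans (≡.cong suc (ℕ.m+[n∸m]≡n i≤m)) (≡.sym e)) (λ W asc′ e′ → Z-closed n (m ℕ.∸ i) (ℕ.≤-trans (ℕ.m∸n≤m m i) l) W asc′ e′))) (term i i≤m)) ⟩
    Σ≤ m (λ i → qf (suc m) * (κ 0# i * sol 0# (m ℕ.∸ i)))
      ≈⟨ trans (Σ≤-*ˡ m _ _) (*-congˡ (sym (mul-Σ≤ (κ 0#) (sol 0#) m))) ⟩
    qf (suc m) * mul (κ 0#) (sol 0#) m
      ≈⟨ *-congˡ (Geometric.geom-suc R (κ 0#) m) ⟨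
    qf (suc m) * sol 0# (suc m) ∎
    where
    term : ∀ i → i ≤ m → blockWeight i * (gauss (suc i) 0 (length V) * (qf (m ℕ.∸ i) * sol 0# (m ℕ.∸ i))) ≈
                          qf (suc m) * (κ 0# i * sol 0# (m ℕ.∸ i))
    term i i≤m = begin
      blockWeight i * (γ * (Q * s))
        ≈⟨ *-congˡ (*-congʳ (trans (sym (*-identityʳ γ)) (*-congˡ (sym (qf*iq (suc i)))))) ⟩
      blockWeight i * ((γ * (qf (suc i) * iq (suc i))) * (Q * s))
        ≈⟨ solve 6 (λ b g x y r s → b :* ((g :* (x :* y)) :* (r :* s)) := (g :* (x :* r)) :* ((b :* y) :* s)) refl _ _ _ _ _ _ ⟩
      (γ * (qf (suc i) * Q)) * ((blockWeight i * iq (suc i)) * s)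
        ≈⟨ *-cong gq (*-congʳ (*-congʳ (sym (trans (+-congˡ (zeroˡ _)) (+-identityʳ _))))) ⟩
      qf (suc m) * (κ 0# i * s) ∎
      where
      γ Q s : Carrier
      γ = gauss (suc i) 0 (length V)
      Q = qf (m ℕ.∸ i)
      s = sol 0# (m ℕ.∸ i)
      gq : γ * (qf (suc i) * Q) ≈ qf (suc m)
      gq = trans (*-congʳ (reflexive (≡.cong (gauss (suc i) 0) (≡.trans e (≡.cong suc (≡.sym (ℕ.m+[n∸m]≡n i≤m)))))))
        (trans (gauss-qf (suc i) (m ℕ.∸ i) 0) (trans (*-identityˡ _) (reflexive (≡.cong (λ k → qf (suc k)) (ℕ.m+[n∸m]≡n i≤m)))))

-- Right side: runs of length at least two, in terms of double descents

distinct⇒unique : ∀ w → distinctᵇ w ≡ true → Unique w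
distinct⇒unique []      _ = []
distinct⇒unique (a ∷ w) e with elemᵇ a w in a∉w
... | false = fresh w a∉w ∷ distinct⇒unique w e
  where
  fresh : ∀ w → elemᵇ a w ≡ false → All (a ≢_) w
  fresh []      _ = []
  fresh (b ∷ w) e with a ≡ᵇ b in a≡b
  ... | false = (λ { ≡.refl → contradiction (≡.trans (≡.sym (≡ᵇ-refl a)) a≡b) (λ ()) }) ∷ fresh w e

words-length : ∀ n m → All (λ w → length w ≡ m) (words n m)
words-length n zero    = ≡.refl ∷ []
words-length n (suc m) = All.concat⁺ (All.map⁺ {f = λ a → map (a ∷_) (words n m)} (All.universal
  (λ a → All.map⁺ {f = a ∷_} (All.map (≡.cong suc) (words-length n m))) (range n)))

perms-valid : ∀ n → All (λ w → length w ≡ n × Unique w) (perms n)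
perms-valid n = All.zip (All.filter⁺ _ (words-length n n) ,
  All.map (λ {w} p → distinct⇒unique w (Equivalence.to T-≡ p)) (All.all-filter (λ w → T? (distinctᵇ w)) (words n n)))

range≡ : ∀ n → range n ≡ applyUpTo suc n
range≡ n = map-upTo suc n

range-ascending : ∀ n → AllPairs _<_ (0 ∷ range n)
range-ascending n rewrite range≡ n = AllPairs.applyUpTo⁺₁ id (suc n) (λ i<j _ → i<j)

range-length : ∀ n → length (range n) ≡ n
range-length n = ≡.trans (length-map suc (upTo n)) (length-applyUpTo id n)

<ᵇ-flip : ∀ {a b} → a ≢ b → (a <ᵇ b) ≡ false → (b <ᵇ a) ≡ true
<ᵇ-flip {a} {b} a≢b e = <ᵇ-true (ℕ.≤∧≢⇒< (ℕ.≮⇒≥ λ a<b → contradiction (≡.trans (≡.sym (<ᵇ-true a<b)) e) (λ ())) (a≢b ∘ ≡.sym))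

<ᵇ-asym : ∀ a b → (a <ᵇ b) ≡ true → (b <ᵇ a) ≡ false
<ᵇ-asym a b e = <ᵇ-false (ℕ.<⇒≤ (ℕ.<ᵇ⇒< a b (Equivalence.from T-≡ e)))

-- the last run has length at least two, when the run containing a has i letters before a
endsWell : ℕ → ℕ → List ℕ → Bool
endsWell i a []      = 0 <ᵇ i
endsWell i a (b ∷ w) = lastAscent (a ∷ b ∷ w)

endsWell-up : ∀ i a b w → (a <ᵇ b) ≡ true → lastAscent (a ∷ b ∷ w) ≡ endsWell (suc i) b w
endsWell-up i a b []      e = e
endsWell-up i a b (c ∷ w) e = ≡.refl

endsWell-down : ∀ a b w → (a <ᵇ b) ≡ false → lastAscent (a ∷ b ∷ w) ≡ endsWell 0 b w
endsWell-down a b []      e = e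
endsWell-down a b (c ∷ w) e = ≡.refl

good : ℕ → Maybe ℕ → ℕ → List ℕ → Bool
good i p a w = (dd-from p (a ∷ w) ≡ᵇ 0) ∧ endsWell i a w

good-up : ∀ i p a b w → (a <ᵇ b) ≡ true → good i p a (b ∷ w) ≡ good (suc i) (just a) b w
good-up i p a b w e rewrite endsWell-up i a b w e | <ᵇ-asym a b e with a <∞ p
... | true  = ≡.refl
... | false = ≡.refl

-- The first hypothesis says that a starts its run exactly when the preceding letter, or +∞ in front
-- of the word, is larger. A descent after such an a is a double descent.
good-down : ∀ i p a b w → (a <∞ p) ≡ (i ≡ᵇ 0) → a ≢ b → (a <ᵇ b) ≡ false →
            good i p a (b ∷ w) ≡ ((0 <ᵇ i) ∧ good 0 (just a) b w)
good-down zero    p a b w hp a≢b e rewrite hp | <ᵇ-flip a≢b e = ≡.refl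
good-down (suc i) p a b w hp a≢b e rewrite hp | endsWell-down a b w e = ≡.refl

des-up : ∀ a b w → (a <ᵇ b) ≡ true → des (a ∷ b ∷ w) ≡ des (b ∷ w)
des-up a b w e rewrite <ᵇ-asym a b e = ≡.refl

des-down : ∀ a b w → a ≢ b → (a <ᵇ b) ≡ false → des (a ∷ b ∷ w) ≡ suc (des (b ∷ w))
des-down a b w a≢b e rewrite <ᵇ-flip a≢b e = ≡.refl

-- There are des + 1 runs, each with at least two letters; the i letters before a belong to the
-- first of them.
good-bound : ∀ i p a w → (a <∞ p) ≡ (i ≡ᵇ 0) → Unique (a ∷ w) → good i p a w ≡ true →
             suc (des (a ∷ w)) ℕ.+ suc (des (a ∷ w)) ≤ suc i ℕ.+ length w
good-bound (suc i) p a []      hp un g = s≤s (s≤s z≤n)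
good-bound i       p a (b ∷ w) hp ((a≢b ∷ _) ∷ un) g = go i hp g (a <ᵇ b) ≡.refl
  where
  d : ℕ
  d = des (b ∷ w)
  go : ∀ i → (a <∞ p) ≡ (i ≡ᵇ 0) → good i p a (b ∷ w) ≡ true → ∀ x → (a <ᵇ b) ≡ x →
       suc (des (a ∷ b ∷ w)) ℕ.+ suc (des (a ∷ b ∷ w)) ≤ suc i ℕ.+ suc (length w)
  go i hp g true e = ≡.subst₂ (λ m n → suc m ℕ.+ suc m ≤ n) (≡.sym (des-up a b w e)) (≡.sym (ℕ.+-suc (suc i) (length w)))
    (good-bound (suc i) (just a) b w (<ᵇ-asym a b e) un (≡.trans (≡.sym (good-up i p a b w e)) g))
  go zero    hp g false e = contradiction (≡.trans (≡.sym (good-down zero p a b w hp a≢b e)) g) (λ ())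
  go (suc i) hp g false e = ≡.subst (λ m → suc m ℕ.+ suc m ≤ suc (suc i) ℕ.+ suc (length w)) (≡.sym (des-down a b w a≢b e))
    (s≤s (≡.subst (_≤ suc i ℕ.+ suc (length w)) (≡.sym (ℕ.+-suc (suc d) (suc d)))
      (s≤s (ℕ.≤-trans (good-bound 0 (just a) b w (<ᵇ-flip a≢b e) un (≡.trans (≡.sym (good-down (suc i) p a b w hp a≢b e)) g))
                      (ℕ.m≤n+m (suc (length w)) i)))))

module RightSideForm {c ℓ : Level} {R : CommutativeRing c ℓ} (D : QData R) where
  open CommutativeRing R
  open QData D
  open Eval commutativeSemiring using (pow; Σ[_]_; RHS)
  open ListSums commutativeSemiring
  open Enumeration commutativeSemiring
  open RightSide D
  open DifferenceSolver R using (solve; _:*_; _:=_)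
  open Solution D using (sol)
  open import Relation.Binary.Reasoning.Setoid setoid

  -- The product of t (1 + t)ᵐ⁻² over runs of lengths m depends only on the number of runs and on
  -- the total length; a run of one letter has weight 0.
  wtFrom-good : ∀ i p a w → (a <∞ p) ≡ (i ≡ᵇ 0) → Unique (a ∷ w) →
    wtFrom i a w ≈ when (good i p a w) (pow t (suc (des (a ∷ w))) *
                      pow (1# + t) ((suc i ℕ.+ length w) ∸ (suc (des (a ∷ w)) ℕ.+ suc (des (a ∷ w)))))
  wtFrom-good zero    p a [] hp un = refl
  wtFrom-good (suc i) p a [] hp un = *-cong (sym (*-identityʳ t)) (reflexive (≡.cong (pow (1# + t)) (≡.sym (ℕ.+-identityʳ i))))
  wtFrom-good i p a (b ∷ w) hp ((a≢b ∷ _) ∷ un) with a <ᵇ b in e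
  ... | true rewrite good-up i p a b w e | <ᵇ-asym a b e | ℕ.+-suc i (length w) =
    wtFrom-good (suc i) (just a) b w (<ᵇ-asym a b e) un
  ... | false rewrite good-down i p a b w hp a≢b e | <ᵇ-flip a≢b e = down i
    where
    d : ℕ
    d = des (b ∷ w)
    rest : Carrier
    rest = wtFrom 0 b w
    down : ∀ i → runWeight (suc i) * rest ≈ when ((0 <ᵇ i) ∧ good 0 (just a) b w) (pow t (suc (suc d)) *
                   pow (1# + t) ((suc i ℕ.+ suc (length w)) ∸ (suc (suc d) ℕ.+ suc (suc d))))
    down zero    = zeroˡ _
    down (suc i) with good 0 (just a) b w in g | wtFrom-good 0 (just a) b w (<ᵇ-flip a≢b e) un
    ... | false | ih = trans (*-congˡ ih) (zeroʳ _)
    ... | true  | ih = begin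
      (t * pow (1# + t) i) * rest
        ≈⟨ *-congˡ ih ⟩
      (t * pow (1# + t) i) * (pow t (suc d) * pow (1# + t) (suc (length w) ∸ (suc d ℕ.+ suc d)))
        ≈⟨ solve 4 (λ a b c d → (a :* b) :* (c :* d) := (a :* c) :* (b :* d)) refl _ _ _ _ ⟩
      pow t (suc (suc d)) * (pow (1# + t) i * pow (1# + t) (suc (length w) ∸ (suc d ℕ.+ suc d)))
        ≈⟨ *-congˡ (pow-+ (1# + t) i _) ⟨
      pow t (suc (suc d)) * pow (1# + t) (i ℕ.+ (suc (length w) ∸ (suc d ℕ.+ suc d)))
        ≡⟨ ≡.cong (λ m → pow t (suc (suc d)) * pow (1# + t) m) exponent ⟩
      pow t (suc (suc d)) * pow (1# + t) ((suc (suc i) ℕ.+ suc (length w)) ∸ (suc (suc d) ℕ.+ suc (suc d))) ∎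
      where
      exponent : i ℕ.+ (suc (length w) ∸ (suc d ℕ.+ suc d)) ≡ (suc (suc i) ℕ.+ suc (length w)) ∸ (suc (suc d) ℕ.+ suc (suc d))
      exponent = ≡.trans (≡.sym (ℕ.+-∸-assoc i (good-bound 0 (just a) b w (<ᵇ-flip a≢b e) un g)))
        (≡.cong (λ m → (suc i ℕ.+ suc (length w)) ∸ m) (≡.sym (ℕ.+-suc (suc d) (suc d))))

  private
    Σ-select-none : ∀ (f : ℕ → ℕ) m c (h : ℕ → Carrier) → (∀ i → c ≢ f i) → Σ[ applyUpTo f m ] (λ j → when (c ≡ᵇ j) (h j)) ≈ 0#
    Σ-select-none f zero    c h ne = refl
    Σ-select-none f (suc m) c h ne rewrite ≢⇒≡ᵇ-false (ne 0) = trans (+-identityˡ _) (Σ-select-none (f ∘ suc) m c h (λ i → ne (suc i)))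

    Σ-select : ∀ (f : ℕ → ℕ) → (∀ {i j} → f i ≡ f j → i ≡ j) → ∀ m d (h : ℕ → Carrier) → d < m →
               Σ[ applyUpTo f m ] (λ j → when (f d ≡ᵇ j) (h j)) ≈ h (f d)
    Σ-select f inj (suc m) zero    h _ rewrite ≡ᵇ-refl (f 0) =
      trans (+-congˡ (Σ-select-none (f ∘ suc) m (f 0) h (λ i e → contradiction (inj e) (λ ())))) (+-identityʳ _)
    Σ-select f inj (suc m) (suc d) h (s≤s l) rewrite ≢⇒≡ᵇ-false {f (suc d)} {f 0} (λ e → contradiction (inj e) (λ ())) =
      trans (+-identityˡ _) (Σ-select (f ∘ suc) (λ e → ℕ.suc-injective (inj e)) m d h l)

    Σ-range-select : ∀ x y m d (h : ℕ → Carrier) → ((x ∧ y) ≡ true → d < m) →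
      Σ[ range m ] (λ k → when ((x ∧ (d ≡ᵇ (k ∸ 1))) ∧ y) (h k)) ≈ when (x ∧ y) (h (suc d))
    Σ-range-select true  true  m d h l = trans (Σ-map suc (upTo m) _)
      (trans (Σ-cong (upTo m) (λ j → reflexive (≡.cong (λ b → when b (h (suc j))) (∧-identityʳ (d ≡ᵇ j)))))
             (Σ-select id id m d (λ j → h (suc j)) (l ≡.refl)))
    Σ-range-select true  false m d h l = trans (Σ-cong (range m) (λ k → reflexive (≡.cong (λ b → when b (h k)) (∧-zeroʳ (d ≡ᵇ (k ∸ 1)))))) (Σ-zero (range m))
    Σ-range-select false y     m d h l = Σ-zero (range m)

    when-*ˡ : ∀ b x y → when b x * y ≈ x * when b y
    when-*ˡ true  x y = refl
    when-*ˡ false x y = trans (zeroˡ _) (sym (zeroʳ _))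

    half : ∀ d n → suc d ℕ.+ suc d ≤ n → d < n / 2
    half d n l = ≡.subst (_≤ n / 2) (m*n/n≡m (suc d) 2) (/-monoˡ-≤ 2 (≡.subst (_≤ n) double l))
      where
      double : suc d ℕ.+ suc d ≡ suc d ℕ.* 2
      double = ≡.trans (≡.cong (suc d ℕ.+_) (≡.sym (ℕ.+-identityʳ (suc d)))) (ℕ.*-comm 2 (suc d))

  -- After the sums are exchanged, a permutation meets the condition for k = des + 1 at most, and
  -- `good-bound` shows that this k is within n / 2.
  RHS-runs : ∀ n → RHS (suc n) t q ≈ Σ[ perms (suc n) ] (λ σ → pow q (inv σ) * wt σ)
  RHS-runs n = begin
    Σ[ range (suc n / 2) ] (λ k → Σ[ Dtilde (suc n) k ] (λ σ → pow q (inv σ)) * h k)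
      ≈⟨ Σ-cong (range (suc n / 2)) (λ k → trans (*-congʳ (Σ-filter (λ σ → cond σ k) (perms (suc n)) _))
           (trans (sym (Σ-*ʳ (h k) (perms (suc n)) _)) (Σ-cong (perms (suc n)) (λ σ → when-*ˡ (cond σ k) _ _)))) ⟩
    Σ[ range (suc n / 2) ] (λ k → Σ[ perms (suc n) ] (λ σ → pow q (inv σ) * when (cond σ k) (h k)))
      ≈⟨ Σ-swap (range (suc n / 2)) (perms (suc n)) _ ⟩
    Σ[ perms (suc n) ] (λ σ → Σ[ range (suc n / 2) ] (λ k → pow q (inv σ) * when (cond σ k) (h k)))
      ≈⟨ Σ-congᴬ (perms-valid (suc n)) (λ {σ} v → trans (Σ-*ˡ _ (range (suc n / 2)) _) (*-congˡ (select σ v))) ⟩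
    Σ[ perms (suc n) ] (λ σ → pow q (inv σ) * wt σ) ∎
    where
    h : ℕ → Carrier
    h k = pow t k * pow (1# + t) (suc n ∸ (k ℕ.+ k))
    cond : List ℕ → ℕ → Bool
    cond σ k = ((dd σ ≡ᵇ 0) ∧ (des σ ≡ᵇ (k ∸ 1))) ∧ lastAscent σ
    ends : ∀ a w → lastAscent (a ∷ w) ≡ endsWell 0 a w
    ends a []      = ≡.refl
    ends a (b ∷ w) = ≡.refl
    select : ∀ σ → length σ ≡ suc n × Unique σ → Σ[ range (suc n / 2) ] (λ k → when (cond σ k) (h k)) ≈ wt σ
    select (a ∷ w) (e , un) = begin
      Σ[ range (suc n / 2) ] (λ k → when (cond (a ∷ w) k) (h k))
        ≈⟨ Σ-range-select (dd (a ∷ w) ≡ᵇ 0) (lastAscent (a ∷ w)) (suc n / 2) (des (a ∷ w)) h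
             (λ g → half (des (a ∷ w)) (suc n) (≡.subst (suc (des (a ∷ w)) ℕ.+ suc (des (a ∷ w)) ≤_) e
               (good-bound 0 nothing a w ≡.refl un (≡.trans (≡.cong ((dd (a ∷ w) ≡ᵇ 0) ∧_) (≡.sym (ends a w))) g)))) ⟩
      when ((dd (a ∷ w) ≡ᵇ 0) ∧ lastAscent (a ∷ w)) (h (suc (des (a ∷ w))))
        ≡⟨ ≡.cong₂ (λ l m → when ((dd (a ∷ w) ≡ᵇ 0) ∧ l) (pow t (suc (des (a ∷ w))) * pow (1# + t) (m ∸ (suc (des (a ∷ w)) ℕ.+ suc (des (a ∷ w)))))) (ends a w) (≡.sym e) ⟩
      when (good 0 nothing a w) (pow t (suc (des (a ∷ w))) * pow (1# + t) (suc (length w) ∸ (suc (des (a ∷ w)) ℕ.+ suc (des (a ∷ w)))))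
        ≈⟨ wtFrom-good 0 nothing a w ≡.refl un ⟨
      wt (a ∷ w) ∎

  RHS-closed : ∀ n → RHS (suc n) t q ≈ qf (suc n) * sol 0# (suc n)
  RHS-closed n = begin
    RHS (suc n) t q                                          ≈⟨ RHS-runs n ⟩
    Σ[ perms (suc n) ] (λ σ → pow q (inv σ) * wt σ)          ≈⟨ Σ-perms (suc n) (range (suc n)) (range-unique (suc n)) (λ _ → refl) _ ⟩
    Z (suc n) (range (suc n))                                ≈⟨ Z-closed (suc n) (suc n) ℕ.≤-refl (range (suc n)) (range-ascending (suc n)) (range-length (suc n)) ⟩
    qf (suc n) * sol 0# (suc n)                              ∎

-- Left side: the signed word and the statistic maj - exc

exc-snoc : ∀ i w x → exc-from i (w ∷ʳ x) ≡ exc-from i w ℕ.+ ind (i ℕ.+ length w <ᵇ x)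
exc-snoc i []      x rewrite ℕ.+-identityʳ i = ℕ.+-identityʳ _
exc-snoc i (a ∷ w) x rewrite ℕ.+-suc i (length w) | exc-snoc (suc i) w x = ≡.sym (ℕ.+-assoc (ind (i <ᵇ a)) _ _)

fix-snoc : ∀ i w x → fix-from i (w ∷ʳ x) ≡ fix-from i w ℕ.+ ind (i ℕ.+ length w ≡ᵇ x)
fix-snoc i []      x rewrite ℕ.+-identityʳ i = ℕ.+-identityʳ _
fix-snoc i (a ∷ w) x rewrite ℕ.+-suc i (length w) | fix-snoc (suc i) w x = ≡.sym (ℕ.+-assoc (ind (i ≡ᵇ a)) _ _)

maj-snoc : ∀ i w y x → maj-from i ((w ∷ʳ y) ∷ʳ x) ≡ maj-from i (w ∷ʳ y) ℕ.+ (if x <ᵇ y then i ℕ.+ length w else 0)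
maj-snoc i []          y x rewrite ℕ.+-identityʳ i = ℕ.+-identityʳ _
maj-snoc i (a ∷ [])    y x = ≡.trans (≡.cong ((if y <ᵇ a then i else 0) ℕ.+_) (maj-snoc (suc i) [] y x))
  (≡.trans (≡.cong (λ k → (if y <ᵇ a then i else 0) ℕ.+ (if x <ᵇ y then k else 0)) (≡.sym (ℕ.+-suc i 0)))
           (≡.sym (ℕ.+-assoc (if y <ᵇ a then i else 0) 0 _)))
maj-snoc i (a ∷ b ∷ w) y x = ≡.trans (≡.cong ((if b <ᵇ a then i else 0) ℕ.+_) (maj-snoc (suc i) (b ∷ w) y x))
  (≡.trans (≡.cong (λ k → (if b <ᵇ a then i else 0) ℕ.+ (maj-from (suc i) (b ∷ w ∷ʳ y) ℕ.+ (if x <ᵇ y then k else 0))) (≡.sym (ℕ.+-suc i (suc (length w)))))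
           (≡.sym (ℕ.+-assoc (if b <ᵇ a then i else 0) _ _)))

exc-reverse : ∀ x r → exc (reverse (x ∷ r)) ≡ exc (reverse r) ℕ.+ ind (suc (length r) <ᵇ x)
exc-reverse x r rewrite unfold-reverse x r | exc-snoc 1 (reverse r) x | length-reverse r = ≡.refl

fix-reverse : ∀ x r → fix (reverse (x ∷ r)) ≡ fix (reverse r) ℕ.+ ind (suc (length r) ≡ᵇ x)
fix-reverse x r rewrite unfold-reverse x r | fix-snoc 1 (reverse r) x | length-reverse r = ≡.refl

maj-reverse : ∀ x y r → maj (reverse (x ∷ y ∷ r)) ≡ maj (reverse (y ∷ r)) ℕ.+ (if x <ᵇ y then suc (length r) else 0)
maj-reverse x y r rewrite unfold-reverse x (y ∷ r) | unfold-reverse y r | maj-snoc 1 (reverse r) y x | length-reverse r = ≡.refl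

all-reverse : {P : ℕ → Set} → ∀ w → All P w → All P (reverse w)
all-reverse []      []       = []
all-reverse (x ∷ w) (p ∷ ps) rewrite unfold-reverse x w = All.++⁺ (all-reverse w ps) (p ∷ [])

unique-reverse : ∀ w → Unique w → Unique (reverse w)
unique-reverse []      []       = []
unique-reverse (x ∷ w) (p ∷ ps) rewrite unfold-reverse x w =
  AllPairs.++⁺ (unique-reverse w ps) ([] ∷ []) (All.map (λ x≢ → (x≢ ∘ ≡.sym) ∷ []) (all-reverse w p))

words-bounded : ∀ n m → All (All (_≤ n)) (words n m)
words-bounded n zero    = [] ∷ []
words-bounded n (suc m) = All.concat⁺ (All.map⁺ {f = λ a → map (a ∷_) (words n m)} (All.map
  (λ {a} a≤n → All.map⁺ {f = a ∷_} (All.map (a≤n ∷_) (words-bounded n m)))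
  (All.map⁺ {f = suc} (All.applyUpTo⁺₁ id n id))))

-- Signed letters: the sign true marks an excedance; excedances precede the other letters.
signed< : Bool → ℕ → Bool → ℕ → Bool
signed< true  x true  y = x <ᵇ y
signed< true  x false y = true
signed< false x true  y = false
signed< false x false y = x <ᵇ y

module LeftSideWeights {c ℓ : Level} {R : CommutativeRing c ℓ} (D : QData R) where
  open CommutativeRing R
  open QData D
  open Eval commutativeSemiring using (pow; Σ[_]_; A)
  open Enumeration commutativeSemiring
  open ListSums commutativeSemiring
  open import Relation.Binary.Reasoning.Setoid setoid
  module SR = DifferenceSolver R

  -- At a fixed point both signs get weight 0, which realises r = 0.
  es : Bool → ℕ → ℕ → Carrier
  es true  p x = if p <ᵇ x then t else 0#
  es false p x = if x <ᵇ p then 1# else 0#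

  δ : ℕ → Bool → Carrier
  δ p b = if b then 1# else pow q p

  -- Weights of words written backwards: the head is at position p, and is followed
  -- (at position p + 1) by the letter y with sign s.
  G : ℕ → Bool → ℕ → List ℕ → Carrier
  G (suc p) s y (x ∷ r) = es true (suc p) x * (δ (suc p) (signed< true x s y) * G p true x r)
                        + es false (suc p) x * (δ (suc p) (signed< false x s y) * G p false x r)
  G _       s y _       = 1#

  G₀ : ℕ → List ℕ → Carrier
  G₀ (suc p) (x ∷ r) = es true (suc p) x * G p true x r + es false (suc p) x * G p false x r
  G₀ _       _       = 1#

  es-exc : ∀ {p x} → p < x → es true p x ≈ t × es false p x ≈ 0#
  es-exc {p} {x} l rewrite <ᵇ-true l | <ᵇ-false {x} {p} (ℕ.<⇒≤ l) = refl , refl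

  es-fix : ∀ p → es true p p ≈ 0# × es false p p ≈ 0#
  es-fix p rewrite <ᵇ-false {p} {p} ℕ.≤-refl = refl , refl

  es-anti : ∀ {p x} → x < p → es true p x ≈ 0# × es false p x ≈ 1#
  es-anti {p} {x} l rewrite <ᵇ-true l | <ᵇ-false {p} {x} (ℕ.<⇒≤ l) = refl , refl

  first : ∀ {a b c} → a ≈ c → b ≈ 0# → ∀ x y → a * x + b * y ≈ c * x
  first a≈c b≈0 x y = trans (+-cong (*-congʳ a≈c) (trans (*-congʳ b≈0) (zeroˡ y))) (+-identityʳ _)

  second : ∀ {a b c} → a ≈ 0# → b ≈ c → ∀ x y → a * x + b * y ≈ c * y
  second a≈0 b≈c x y = trans (+-cong (trans (*-congʳ a≈0) (zeroˡ x)) (*-congʳ b≈c)) (+-identityˡ _)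

  private
    none : ∀ {a b} → a ≈ 0# → b ≈ 0# → ∀ x y → a * x + b * y ≈ 0#
    none a≈0 b≈0 x y = trans (first a≈0 b≈0 x y) (zeroˡ x)

    swap : ∀ a b c → a * (b * c) ≈ b * (a * c)
    swap = SR.solve 3 (λ a b c → a SR.:* (b SR.:* c) SR.:= b SR.:* (a SR.:* c)) refl

    G-exc : ∀ p s x y r → suc p < y → G (suc p) s x (y ∷ r) ≈ δ (suc p) (signed< true y s x) * G₀ (suc p) (y ∷ r)
    G-exc p s x y r l = trans (first e₁ e₂ _ _) (trans (swap t _ _) (*-congˡ (sym (first e₁ e₂ _ _))))
      where
      e₁ = proj₁ (es-exc l)
      e₂ = proj₂ (es-exc l)

    G-anti : ∀ p s x y r → y < suc p → G (suc p) s x (y ∷ r) ≈ δ (suc p) (signed< false y s x) * G₀ (suc p) (y ∷ r)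
    G-anti p s x y r l = trans (second e₁ e₂ _ _) (trans (swap 1# _ _) (*-congˡ (sym (second e₁ e₂ _ _))))
      where
      e₁ = proj₁ (es-anti l)
      e₂ = proj₂ (es-anti l)

    G-fix : ∀ p s x r → G (suc p) s x (suc p ∷ r) ≈ 0#
    G-fix p s x r = none (proj₁ (es-fix (suc p))) (proj₂ (es-fix (suc p))) _ _

  -- dex is the sum of the descents of the signed word; it satisfies maj = dex + exc
  -- as soon as the last letter is not an excedance.
  Weighted : ℕ → List ℕ → Set ℓ
  Weighted x r =
    (fix σ ≡ 0 × Σ[ dex ∈ ℕ ] (dex ℕ.+ exc σ ≡ maj σ ℕ.+ (if suc (length r) <ᵇ x then suc (length r) else 0)
                              × G₀ (suc (length r)) (x ∷ r) ≈ pow t (exc σ) * pow q dex))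
    ⊎ (Σ[ k ∈ ℕ ] (fix σ ≡ suc k × G₀ (suc (length r)) (x ∷ r) ≈ 0#))
    where
    σ : List ℕ
    σ = reverse (x ∷ r)

  private
    compare : ∀ p {x y} → y ≢ x → Σ[ e ∈ ℕ ] ((if x <ᵇ y then p else 0) ≡ e × δ p (y <ᵇ x) ≈ pow q e)
    compare p {x} {y} y≢x with y <ᵇ x in e
    ... | true  rewrite <ᵇ-asym y x e = 0 , ≡.refl , refl
    ... | false rewrite <ᵇ-flip y≢x e = p , ≡.refl , refl

    combine : ∀ {g d e : Carrier} → ∀ dex dex′ ex ex′ → e ≈ pow t ex′ → d ≈ pow q dex′ →
      g ≈ pow t ex * pow q dex → e * (d * g) ≈ pow t (ex ℕ.+ ex′) * pow q (dex ℕ.+ dex′)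
    combine dex dex′ ex ex′ pe pd pg = trans (*-cong pe (*-cong pd pg)) (begin
      pow t ex′ * (pow q dex′ * (pow t ex * pow q dex))
        ≈⟨ SR.solve 4 (λ a b c d → a SR.:* (b SR.:* (c SR.:* d)) SR.:= (c SR.:* a) SR.:* (d SR.:* b)) refl _ _ _ _ ⟩
      (pow t ex * pow t ex′) * (pow q dex * pow q dex′)
        ≈⟨ *-cong (pow-+ t ex ex′) (pow-+ q dex dex′) ⟨
      pow t (ex ℕ.+ ex′) * pow q (dex ℕ.+ dex′) ∎)

    nat₁ : ∀ d e x m p → d ℕ.+ x ≡ m ℕ.+ p → (d ℕ.+ e) ℕ.+ (x ℕ.+ 1) ≡ (m ℕ.+ e) ℕ.+ suc p
    nat₁ d e x m p h = ≡.trans (solve 3 (λ d e x → (d :+ e) :+ (x :+ con 1) := (d :+ x) :+ (e :+ con 1)) ≡.refl d e x)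
      (≡.trans (≡.cong (ℕ._+ (e ℕ.+ 1)) h) (solve 3 (λ m p e → (m :+ p) :+ (e :+ con 1) := (m :+ e) :+ (con 1 :+ p)) ≡.refl m p e))
      where open +-*-Solver

    nat₂ : ∀ d x m p → d ℕ.+ x ≡ m ℕ.+ 0 → (d ℕ.+ p) ℕ.+ (x ℕ.+ 1) ≡ (m ℕ.+ 0) ℕ.+ suc p
    nat₂ d x m p h = ≡.trans (solve 3 (λ d p x → (d :+ p) :+ (x :+ con 1) := (d :+ x) :+ (con 1 :+ p)) ≡.refl d p x)
      (≡.cong (ℕ._+ suc p) h)
      where open +-*-Solver

    nat₃ : ∀ d x m p → d ℕ.+ x ≡ m ℕ.+ p → (d ℕ.+ 0) ℕ.+ (x ℕ.+ 0) ≡ (m ℕ.+ p) ℕ.+ 0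
    nat₃ d x m p h = ≡.trans (≡.cong₂ ℕ._+_ (ℕ.+-identityʳ d) (ℕ.+-identityʳ x)) (≡.trans h (≡.sym (ℕ.+-identityʳ _)))

    nat₄ : ∀ d e x m → d ℕ.+ x ≡ m ℕ.+ 0 → (d ℕ.+ e) ℕ.+ (x ℕ.+ 0) ≡ (m ℕ.+ e) ℕ.+ 0
    nat₄ d e x m h = ≡.trans (solve 3 (λ d e x → (d :+ e) :+ (x :+ con 0) := (d :+ x) :+ e) ≡.refl d e x)
      (≡.trans (≡.cong (ℕ._+ e) h) (solve 2 (λ m e → (m :+ con 0) :+ e := (m :+ e) :+ con 0) ≡.refl m e))
      where open +-*-Solver

  -- Letters of equal sign compare as plain letters. An excedance followed by a non-excedance is a
  -- descent of σ only, the opposite change a descent of the signed word only. Thus a maximal run of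
  -- excedances at positions a, ..., b changes the sum by (a - 1) - b, minus its length. The term
  -- added to `maj` in `Weighted` is the b of a run that is still open.
  weighted : ∀ x r → Unique (x ∷ r) → Weighted x r
  weighted x [] _ with ℕ.<-cmp x 1
  ... | tri< (s≤s z≤n) _ _ = inj₁ (≡.refl , 0 , ≡.refl , trans (second refl refl _ _) refl)
  ... | tri≈ _ ≡.refl _    = inj₂ (0 , ≡.refl , none refl refl _ _)
  ... | tri> _ _ (s≤s (s≤s z≤n)) = inj₁ (≡.refl , 0 , ≡.refl , trans (first refl refl _ _) (*-congʳ (sym (*-identityʳ t))))
  weighted x (y ∷ r) ((x≢y ∷ _) ∷ un) = go (weighted y r un)
    where
    p′ p : ℕ
    p′ = suc (length r)
    p = suc p′
    σ′ : List ℕ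
    σ′ = reverse (y ∷ r)
    fixed-below : ∀ k → fix σ′ ≡ suc k → G₀ p′ (y ∷ r) ≈ 0# → Weighted x (y ∷ r)
    fixed-below k f g = inj₂ (k ℕ.+ ind (p ≡ᵇ x) , ≡.trans (fix-reverse x (y ∷ r)) (≡.cong (ℕ._+ ind (p ≡ᵇ x)) f) ,
      trans (+-cong (*-congˡ (zero-G true)) (*-congˡ (zero-G false))) (trans (+-cong (zeroʳ _) (zeroʳ _)) (+-identityˡ _)))
      where
      zero-G : ∀ s → G p′ s x (y ∷ r) ≈ 0#
      zero-G s with ℕ.<-cmp y p′
      ... | tri< l _ _       = trans (G-anti (length r) s x y r l) (trans (*-congˡ g) (zeroʳ _))
      ... | tri≈ _ ≡.refl _  = G-fix (length r) s x r
      ... | tri> _ _ l       = trans (G-exc (length r) s x y r l) (trans (*-congˡ g) (zeroʳ _))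
    above : ∀ {n} → p′ < y → n ≡ maj σ′ ℕ.+ (if p′ <ᵇ y then p′ else 0) → n ≡ maj σ′ ℕ.+ p′
    above l h = ≡.trans h (≡.cong (λ b → maj σ′ ℕ.+ (if b then p′ else 0)) (<ᵇ-true l))
    below : ∀ {n} → y < p′ → n ≡ maj σ′ ℕ.+ (if p′ <ᵇ y then p′ else 0) → n ≡ maj σ′ ℕ.+ 0
    below l h = ≡.trans h (≡.cong (λ b → maj σ′ ℕ.+ (if b then p′ else 0)) (<ᵇ-false (ℕ.<⇒≤ l)))
    go : Weighted y r → Weighted x (y ∷ r)
    go (inj₂ (k , f , g)) = fixed-below k f g
    go (inj₁ (f , dex , e , g)) with ℕ.<-cmp x p | ℕ.<-cmp y p′
    ... | tri≈ _ ≡.refl _ | _ = inj₂ (fix σ′ , ≡.trans (fix-reverse p (y ∷ r)) (≡.trans (≡.cong (λ b → fix σ′ ℕ.+ ind b) (≡ᵇ-refl p)) (ℕ.+-comm (fix σ′) 1)) ,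
                                      none (proj₁ (es-fix p)) (proj₂ (es-fix p)) _ _)
    ... | tri< _ _ _ | tri≈ _ y≡ _ = contradiction (≡.trans (≡.sym f) (≡.trans (fix-reverse y r) (≡.trans (≡.cong (λ b → fix (reverse r) ℕ.+ ind b)
                                        (≡.trans (≡.cong (p′ ≡ᵇ_) y≡) (≡ᵇ-refl p′))) (ℕ.+-comm _ 1)))) (λ ())
    ... | tri> _ _ _ | tri≈ _ y≡ _ = contradiction (≡.trans (≡.sym f) (≡.trans (fix-reverse y r) (≡.trans (≡.cong (λ b → fix (reverse r) ℕ.+ ind b)
                                        (≡.trans (≡.cong (p′ ≡ᵇ_) y≡) (≡ᵇ-refl p′))) (ℕ.+-comm _ 1)))) (λ ())
    ... | tri> _ x≢p x> | tri> _ _ y> rewrite fix-reverse x (y ∷ r) | exc-reverse x (y ∷ r) | maj-reverse x y r | f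
          | ≢⇒≡ᵇ-false (x≢p ∘ ≡.sym) | <ᵇ-true x> with compare p′ (x≢y ∘ ≡.sym)
    ...   | d , m≡ , δ≈ rewrite m≡ = inj₁ (≡.refl , dex ℕ.+ d , nat₁ dex d (exc σ′) (maj σ′) p′ (above y> e) ,
            trans (first refl (proj₂ (es-exc x>)) _ _) (trans (*-congˡ (G-exc (length r) true x y r y>)) (combine dex d (exc σ′) 1 (sym (*-identityʳ t)) δ≈ g)))
    go (inj₁ (f , dex , e , g)) | tri> _ x≢p x> | tri< y< _ _
      rewrite fix-reverse x (y ∷ r) | exc-reverse x (y ∷ r) | maj-reverse x y r | f | ≢⇒≡ᵇ-false (x≢p ∘ ≡.sym) | <ᵇ-true x>
            | <ᵇ-false {x} {y} (ℕ.<⇒≤ (ℕ.<-trans y< (ℕ.<-trans (ℕ.n<1+n p′) x>)))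
      = inj₁ (≡.refl , dex ℕ.+ p′ , nat₂ dex (exc σ′) (maj σ′) p′ (below y< e) ,
          trans (first refl (proj₂ (es-exc x>)) _ _) (trans (*-congˡ (G-anti (length r) true x y r y<)) (combine dex p′ (exc σ′) 1 (sym (*-identityʳ t)) refl g)))
    go (inj₁ (f , dex , e , g)) | tri< x< x≢p _ | tri> _ _ y>
      rewrite fix-reverse x (y ∷ r) | exc-reverse x (y ∷ r) | maj-reverse x y r | f | ≢⇒≡ᵇ-false (x≢p ∘ ≡.sym)
            | <ᵇ-false {p} {x} (ℕ.<⇒≤ x<) | <ᵇ-true (ℕ.<-≤-trans x< y>)
      = inj₁ (≡.refl , dex ℕ.+ 0 , nat₃ dex (exc σ′) (maj σ′) p′ (above y> e) ,
          trans (second refl (proj₂ (es-anti x<)) _ _) (trans (*-congˡ (G-exc (length r) false x y r y>)) (combine dex 0 (exc σ′) 0 refl refl g)))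
    go (inj₁ (f , dex , e , g)) | tri< x< x≢p _ | tri< y< _ _
      rewrite fix-reverse x (y ∷ r) | exc-reverse x (y ∷ r) | maj-reverse x y r | f | ≢⇒≡ᵇ-false (x≢p ∘ ≡.sym)
            | <ᵇ-false {p} {x} (ℕ.<⇒≤ x<) with compare p′ (x≢y ∘ ≡.sym)
    ...   | d , m≡ , δ≈ rewrite m≡ = inj₁ (≡.refl , dex ℕ.+ d , nat₄ dex d (exc σ′) (maj σ′) (below y< e) ,
            trans (second refl (proj₂ (es-anti x<)) _ _) (trans (*-congˡ (G-anti (length r) false x y r y<)) (combine dex d (exc σ′) 0 refl δ≈ g)))

  -- The last letter is at most its position, so no run of excedances is open at the end and the
  -- correction vanishes.
  backward-weight : ∀ n r → length r ≡ suc n → Unique r → All (_≤ suc n) r →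
    pow t (exc (reverse r)) * (pow 0# (fix (reverse r)) * pow q (maj (reverse r) ∸ exc (reverse r))) ≈ G₀ (suc n) r
  backward-weight n (x ∷ r) ≡.refl un (x≤ ∷ _) with weighted x r un
  ... | inj₂ (k , f , g) rewrite f = trans (*-congˡ (trans (*-congʳ (zeroˡ _)) (zeroˡ _))) (trans (zeroʳ _) (sym g))
  ... | inj₁ (f , dex , e , g) rewrite f = trans (*-congˡ (trans (*-identityˡ _) (reflexive (≡.cong (pow q) power)))) (sym g)
    where
    σ : List ℕ
    σ = reverse (x ∷ r)
    power : maj σ ∸ exc σ ≡ dex
    power = ≡.trans (≡.cong (_∸ exc σ) (≡.sym (≡.trans e (≡.trans (≡.cong (λ b → maj σ ℕ.+ (if b then suc (length r) else 0)) (<ᵇ-false x≤)) (ℕ.+-identityʳ _)))))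
                    (ℕ.m+n∸n≡m dex (exc σ))

  A-backward : ∀ n → A (suc n) t 0# q ≈ Σ[ arr (suc n) (desc (suc n)) ] (G₀ (suc n))
  A-backward n = begin
    A (suc n) t 0# q
      ≈⟨ Σ-congᴬ (All.zip (perms-valid (suc n) , All.filter⁺ _ (words-bounded (suc n) (suc n)))) (λ {σ} v → weight σ v) ⟩
    Σ[ perms (suc n) ] (λ σ → G₀ (suc n) (reverse σ))
      ≈⟨ Σ-perms (suc n) (desc (suc n)) (desc-unique (suc n)) (Σ-desc (suc n)) _ ⟩
    Σ[ arr (suc n) (desc (suc n)) ] (λ σ → G₀ (suc n) (reverse σ))
      ≈⟨ Σ-arr-reverse (suc n) (desc (suc n)) (G₀ (suc n)) ⟨
    Σ[ arr (suc n) (desc (suc n)) ] (G₀ (suc n)) ∎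
    where
    weight : ∀ σ → (length σ ≡ suc n × Unique σ) × All (_≤ suc n) σ →
             pow t (exc σ) * (pow 0# (fix σ) * pow q (maj σ ∸ exc σ)) ≈ G₀ (suc n) (reverse σ)
    weight σ ((l , un) , bounded) = ≡.subst
      (λ τ → pow t (exc τ) * (pow 0# (fix τ) * pow q (maj τ ∸ exc τ)) ≈ G₀ (suc n) (reverse σ)) (reverse-involutive σ)
      (backward-weight n (reverse σ) (≡.trans (length-reverse σ) l) (unique-reverse σ un) (all-reverse σ bounded))

-- Left side: from words ascending on blocks to labellings of values

desc-descending : ∀ n → AllPairs _>_ (desc n)
desc-descending zero    = []
desc-descending (suc n) = All.map s≤s (desc≤ n) ∷ desc-descending n

desc-length : ∀ n → length (desc n) ≡ n
desc-length zero    = ≡.refl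
desc-length (suc n) = ≡.cong suc (desc-length n)

picks-All : {P : ℕ → Set} → ∀ {V} → All P V → All (λ { (x , W) → P x × All P W }) (picks V)
picks-All []       = []
picks-All (p ∷ ps) = (p , ps) ∷ All.map⁺ (All.map (λ { {x , W} (px , pW) → px , p ∷ pW }) (picks-All ps))

-- `B` exceeds all values. A non-excedance `B` placed behind a word makes the comparison with its
-- last letter hold for both signs.
module LeftSide {c ℓ : Level} {R : CommutativeRing c ℓ} (D : QData R) (B : ℕ) where
  open CommutativeRing R
  open QData D
  open QSums D
  open Eval commutativeSemiring using (pow; Σ[_]_)
  open ListSums commutativeSemiring
  open Enumeration commutativeSemiring
  open LeftSideWeights D
  open DifferenceSolver R using (solve; _:+_; _:*_; _:=_; :-_; :1)
  open TowerOps R using (module 𝕋; coef; coef-cong; coef-+; coef-0; coef-ι; ι)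
  open TowerOps.Forms R t using (Λ; w)
  open import Relation.Binary.Reasoning.Setoid setoid

  F₀ : ℕ → List ℕ → Carrier
  F₀ p V = Σ[ arr p V ] (G₀ p)

  private
    F : ℕ → List ℕ → Bool → ℕ → Carrier
    F p V s y = Σ[ arr p V ] (G p s y)

    signedChain : ℕ → ℕ → List ℕ → Bool → ℕ → (List ℕ → Carrier) → Carrier
    signedChain zero    p V s y Φ = Φ V
    signedChain (suc k) p V s y Φ = Σ[ picks V ] (λ { (x , W) →
      when (signed< true x s y) (es true p x * signedChain k (ℕ.pred p) W true x Φ) +
      when (signed< false x s y) (es false p x * signedChain k (ℕ.pred p) W false x Φ) })

    -- Either there is a cut at p, of weight qᵖ and without condition, or there is none, of weight 1
    -- - qᵖ, and the signed word must ascend at p.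
    δ-split : ∀ p b e x → e * (δ p b * x) ≈ pow q p * (e * x) + cq p * when b (e * x)
    δ-split p true  e x = solve 3 (λ q e x → e :* (:1 :* x) := q :* (e :* x) :+ (:1 :+ :- q) :* (e :* x)) refl (pow q p) e x
    δ-split p false e x = trans (solve 3 (λ q e x → e :* (q :* x) := q :* (e :* x)) refl (pow q p) e x)
                                (sym (trans (+-congˡ (zeroʳ _)) (+-identityʳ _)))

    F₀-suc : ∀ p V → F₀ (suc p) V ≈ Σ[ picks V ] (λ { (x , W) → es true (suc p) x * F p W true x + es false (suc p) x * F p W false x })
    F₀-suc p V = trans (Σ-arr-suc p V _) (Σ-cong (picks V) (λ { (x , W) →
      trans (Σ-+ (arr p W) _ _) (+-cong (Σ-*ˡ _ (arr p W) _) (Σ-*ˡ _ (arr p W) _)) }))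

    F-suc : ∀ p V s y → F (suc p) V s y ≈ pow q (suc p) * F₀ (suc p) V + cq (suc p) * Σ[ picks V ] (λ { (x , W) →
      when (signed< true x s y) (es true (suc p) x * F p W true x) + when (signed< false x s y) (es false (suc p) x * F p W false x) })
    F-suc p V s y = begin
      F (suc p) V s y
        ≈⟨ Σ-arr-suc p V _ ⟩
      Σ[ picks V ] (λ { (x , W) → Σ[ arr p W ] (λ r → G (suc p) s y (x ∷ r)) })
        ≈⟨ Σ-cong (picks V) (λ { (x , W) → trans (Σ-+ (arr p W) _ _) (+-cong (half true x W) (half false x W)) }) ⟩
      Σ[ picks V ] (λ { (x , W) → (Q * a true x W + C * b true x W) + (Q * a false x W + C * b false x W) })
        ≈⟨ Σ-cong (picks V) (λ { (x , W) → solve 6 (λ q c x y z w → (q :* x :+ c :* y) :+ (q :* z :+ c :* w)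
             := q :* (x :+ z) :+ c :* (y :+ w)) refl Q C _ _ _ _ }) ⟩
      Σ[ picks V ] (λ { (x , W) → Q * (a true x W + a false x W) + C * (b true x W + b false x W) })
        ≈⟨ trans (Σ-+ (picks V) _ _) (+-cong (Σ-*ˡ Q (picks V) _) (Σ-*ˡ C (picks V) _)) ⟩
      Q * Σ[ picks V ] (λ { (x , W) → a true x W + a false x W }) + C * Σ[ picks V ] (λ { (x , W) → b true x W + b false x W })
        ≈⟨ +-congʳ (*-congˡ (F₀-suc p V)) ⟨
      Q * F₀ (suc p) V + C * Σ[ picks V ] (λ { (x , W) → b true x W + b false x W }) ∎
      where
      Q C : Carrier
      Q = pow q (suc p)
      C = cq (suc p)
      a b : Bool → ℕ → List ℕ → Carrier
      a s′ x W = es s′ (suc p) x * F p W s′ x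
      b s′ x W = when (signed< s′ x s y) (a s′ x W)
      half : ∀ s′ x W → Σ[ arr p W ] (λ r → es s′ (suc p) x * (δ (suc p) (signed< s′ x s y) * G p s′ x r)) ≈ Q * a s′ x W + C * b s′ x W
      half s′ x W = trans (Σ-*ˡ _ (arr p W) _) (trans (*-congˡ (Σ-*ˡ _ (arr p W) _)) (δ-split (suc p) (signed< s′ x s y) _ _))

    pull : ∀ p b e (x : ℕ → Carrier) → when b (e * Σ≤ p (λ j → fc p j * (pow q (p ∸ j) * x j))) ≈
           Σ≤ p (λ j → fc p j * (pow q (p ∸ j) * when b (e * x j)))
    pull p b e x = trans (when-cong b (trans (sym (Σ≤-*ˡ p e _)) (Σ≤-cong p (λ j →
      solve 4 (λ e f q x → e :* (f :* (q :* x)) := f :* (q :* (e :* x))) refl e _ _ (x j)))))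
      (push b)
      where
      push : ∀ b → when b (Σ≤ p (λ j → fc p j * (pow q (p ∸ j) * (e * x j)))) ≈ Σ≤ p (λ j → fc p j * (pow q (p ∸ j) * when b (e * x j)))
      push true  = refl
      push false = sym (trans (Σ≤-cong p (λ j → trans (*-congˡ (zeroʳ _)) (zeroʳ _))) (Σ≤-zero p))

    merge : ∀ V p (x y : ℕ → ℕ → List ℕ → Carrier) →
      Σ[ picks V ] (λ { (v , W) → Σ≤ p (λ j → fc p j * (pow q (p ∸ j) * x j v W)) + Σ≤ p (λ j → fc p j * (pow q (p ∸ j) * y j v W)) }) ≈
      Σ≤ p (λ j → fc p j * (pow q (p ∸ j) * Σ[ picks V ] (λ { (v , W) → x j v W + y j v W })))
    merge V p x y = begin
      Σ[ picks V ] (λ { (v , W) → Σ≤ p (λ j → fc p j * (pow q (p ∸ j) * x j v W)) + Σ≤ p (λ j → fc p j * (pow q (p ∸ j) * y j v W)) })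
        ≈⟨ Σ-cong (picks V) (λ { (v , W) → trans (sym (Σ≤-+ p _ _)) (Σ≤-cong p (λ j →
             solve 4 (λ f q x y → f :* (q :* x) :+ f :* (q :* y) := f :* (q :* (x :+ y))) refl _ _ _ _)) }) ⟩
      Σ[ picks V ] (λ { (v , W) → Σ≤ p (λ j → fc p j * (pow q (p ∸ j) * (x j v W + y j v W))) })
        ≈⟨ Σ-Σ≤-swap (picks V) p _ ⟩
      Σ≤ p (λ j → Σ[ picks V ] (λ { (v , W) → fc p j * (pow q (p ∸ j) * (x j v W + y j v W)) }))
        ≈⟨ Σ≤-cong p (λ j → trans (Σ-*ˡ _ (picks V) _) (*-congˡ (Σ-*ˡ _ (picks V) _))) ⟩
      Σ≤ p (λ j → fc p j * (pow q (p ∸ j) * Σ[ picks V ] (λ { (v , W) → x j v W + y j v W }))) ∎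

    -- As long as no cut occurs the signed letters must ascend, so the last j letters form a chain
    -- read backwards; the cut at p - j frees everything before it, which sums to `F₀`.
    F-chains : ∀ p V s y → F p V s y ≈ Σ≤ p (λ j → fc p j * (pow q (p ∸ j) * signedChain j p V s y (F₀ (p ∸ j))))
    F-chains zero    V s y = sym (trans (*-identityˡ _) (*-identityˡ _))
    F-chains (suc p) V s y = begin
      F (suc p) V s y
        ≈⟨ F-suc p V s y ⟩
      pow q (suc p) * F₀ (suc p) V + cq (suc p) * Σ[ picks V ] (λ { (x , W) →
        when (signed< true x s y) (es true (suc p) x * F p W true x) + when (signed< false x s y) (es false (suc p) x * F p W false x) })
        ≈⟨ +-cong (sym (*-identityˡ _)) (*-congˡ (trans (Σ-cong (picks V) (λ { (x , W) → +-cong (part true x W) (part false x W) }))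
             (merge V p (λ j x W → when (signed< true x s y) (es true (suc p) x * signedChain j p W true x (F₀ (p ∸ j))))
                        (λ j x W → when (signed< false x s y) (es false (suc p) x * signedChain j p W false x (F₀ (p ∸ j))))))) ⟩
      1# * (pow q (suc p) * F₀ (suc p) V) + cq (suc p) * Σ≤ p (λ j → fc p j * (pow q (p ∸ j) * signedChain (suc j) (suc p) V s y (F₀ (p ∸ j))))
        ≈⟨ +-congˡ (trans (sym (Σ≤-*ˡ p _ _)) (Σ≤-cong p (λ j → sym (*-assoc _ _ _)))) ⟩
      Σ≤ (suc p) (λ j → fc (suc p) j * (pow q (suc p ∸ j) * signedChain j (suc p) V s y (F₀ (suc p ∸ j)))) ∎
      where
      part : ∀ s′ x W → when (signed< s′ x s y) (es s′ (suc p) x * F p W s′ x) ≈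
        Σ≤ p (λ j → fc p j * (pow q (p ∸ j) * when (signed< s′ x s y) (es s′ (suc p) x * signedChain j p W s′ x (F₀ (p ∸ j)))))
      part s′ x W = trans (when-cong (signed< s′ x s y) (*-congˡ (F-chains p W s′ x))) (pull p (signed< s′ x s y) (es s′ (suc p) x) (λ j → signedChain j p W s′ x (F₀ (p ∸ j))))

    F₀-chains : ∀ p V → All (_< B) V →
      F₀ (suc p) V ≈ Σ≤ p (λ j → fc p j * (pow q (p ∸ j) * signedChain (suc j) (suc p) V false B (F₀ (p ∸ j))))
    F₀-chains p V below = trans (F₀-suc p V) (trans (picks-congᴬ below (λ {x} W x<B →
      +-cong (trans (*-congˡ (F-chains p W true x)) (pull p true (es true (suc p) x) (λ j → signedChain j p W true x (F₀ (p ∸ j)))))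
             (trans (*-congˡ (F-chains p W false x)) (trans (pull p true (es false (suc p) x) (λ j → signedChain j p W false x (F₀ (p ∸ j))))
               (Σ≤-cong p (λ j → *-congˡ (*-congˡ (reflexive (≡.cong (λ b → when b (es false (suc p) x * signedChain j p W false x (F₀ (p ∸ j)))) (≡.sym (<ᵇ-true x<B)))))))))))
      (merge V p (λ j x W → when true (es true (suc p) x * signedChain j p W true x (F₀ (p ∸ j))))
                 (λ j x W → when (x <ᵇ B) (es false (suc p) x * signedChain j p W false x (F₀ (p ∸ j))))))

    module N = Chains _<ᵇ_ (λ x → <ᵇ-false {x} {x} ℕ.≤-refl) (λ p x _ → es false p x)
    module E = Chains _<ᵇ_ (λ x → <ᵇ-false {x} {x} ℕ.≤-refl) (λ p x _ → es true p x)

    signedChain-exc : ∀ k p V y Φ → signedChain k p V true y Φ ≈ E.chain k p V y Φ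
    signedChain-exc zero    p V y Φ = refl
    signedChain-exc (suc k) p V y Φ = Σ-cong (picks V) (λ { (x , W) →
      trans (+-identityʳ _) (when-cong (x <ᵇ y) (*-congˡ (signedChain-exc k (ℕ.pred p) W x Φ))) })

    -- Read backwards, an ascending block consists of a non-excedances and then of excedances. The
    -- comparison at the change of sign always holds, so the excedances start afresh from the bound
    -- `B`.
    signedChain-split : ∀ k m V y Φ → All (_< B) V → signedChain k (k ℕ.+ m) V false y Φ ≈
      Σ≤ k (λ a → N.chain a (k ℕ.+ m) V y (λ V₁ → E.chain (k ∸ a) ((k ∸ a) ℕ.+ m) V₁ B Φ))
    signedChain-split zero    m V y Φ below = refl
    signedChain-split (suc k) m V y Φ below = begin
      Σ[ picks V ] (λ { (x , W) → es true P x * signedChain k (k ℕ.+ m) W true x Φ +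
                                  when (x <ᵇ y) (es false P x * signedChain k (k ℕ.+ m) W false x Φ) })
        ≈⟨ Σ-congᴬ (picks-All below) (λ { {x , W} (x<B , W<B) → +-cong
             (trans (*-congˡ (signedChain-exc k (k ℕ.+ m) W x Φ))
               (reflexive (≡.cong (λ b → when b (es true P x * E.chain k (k ℕ.+ m) W x Φ)) (≡.sym (<ᵇ-true x<B)))))
             (trans (when-cong (x <ᵇ y) (trans (*-congˡ (signedChain-split k m W x Φ W<B)) (sym (Σ≤-*ˡ k _ _)))) (push (x <ᵇ y) _)) }) ⟩
      Σ[ picks V ] (λ { (x , W) → when (x <ᵇ B) (es true P x * E.chain k (k ℕ.+ m) W x Φ) +
        Σ≤ k (λ a → when (x <ᵇ y) (es false P x * N.chain a (k ℕ.+ m) W x (λ V₁ → E.chain (k ∸ a) ((k ∸ a) ℕ.+ m) V₁ B Φ))) })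
        ≈⟨ trans (Σ-+ (picks V) _ _) (+-congˡ (Σ-Σ≤-swap (picks V) k _)) ⟩
      Σ≤ (suc k) (λ a → N.chain a P V y (λ V₁ → E.chain (suc k ∸ a) ((suc k ∸ a) ℕ.+ m) V₁ B Φ)) ∎
      where
      P : ℕ
      P = suc k ℕ.+ m
      push : ∀ b (f : ℕ → Carrier) → when b (Σ≤ k f) ≈ Σ≤ k (λ a → when b (f a))
      push true  f = refl
      push false f = sym (Σ≤-zero k)

    -- The analogue of `subset` for weights that depend on the value alone and not on the position;
    -- Φ receives the values not chosen.
    sub : (ℕ → Carrier) → ℕ → List ℕ → (List ℕ → Carrier) → Carrier
    sub ω zero    V       Φ = Φ V
    sub ω (suc k) []      Φ = 0#
    sub ω (suc k) (v ∷ V) Φ = ω v * sub ω k V Φ + sub ω (suc k) V (λ W → Φ (v ∷ W))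

    sub-cong : ∀ ω k V {Φ Φ′ : List ℕ → Carrier} → AllPairs _>_ V →
      (∀ W → AllPairs _>_ W → (∀ {P : ℕ → Set} → All P V → All P W) → k ℕ.+ length W ≡ length V → Φ W ≈ Φ′ W) →
      sub ω k V Φ ≈ sub ω k V Φ′
    sub-cong ω zero    V       desc h = h V desc id ≡.refl
    sub-cong ω (suc k) []      desc h = refl
    sub-cong ω (suc k) (v ∷ V) (v>V ∷ desc) h = +-cong
      (*-congˡ (sub-cong ω k V desc (λ W d i e → h W d (λ { (_ ∷ ps) → i ps }) (≡.cong suc e))))
      (sub-cong ω (suc k) V desc (λ W d i e → h (v ∷ W) (i v>V ∷ d) (λ { (p ∷ ps) → p ∷ i ps })
        (≡.cong suc (≡.trans (ℕ.+-suc k (length W)) e))))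

    sub-≡ : ∀ ω k V {Φ Φ′ : List ℕ → Carrier} → (∀ W → Φ W ≈ Φ′ W) → sub ω k V Φ ≈ sub ω k V Φ′
    sub-≡ ω zero    V       h = h V
    sub-≡ ω (suc k) []      h = refl
    sub-≡ ω (suc k) (v ∷ V) h = +-cong (*-congˡ (sub-≡ ω k V h)) (sub-≡ ω (suc k) V (λ W → h (v ∷ W)))

    sub-weights : ∀ {ω ω′} k V Φ → All (λ v → ω v ≈ ω′ v) V → sub ω k V Φ ≈ sub ω′ k V Φ
    sub-weights zero    V       Φ _        = refl
    sub-weights (suc k) []      Φ _        = refl
    sub-weights (suc k) (v ∷ V) Φ (e ∷ es) = +-cong (*-cong e (sub-weights k V Φ es)) (sub-weights (suc k) V _ es)

    -- A descending sequence of values placed at positions p, p − 1, … stays below the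
    -- positions as soon as its first value does.
    subset-anti : ∀ k p U V Φ → AllPairs _>_ V → N.subset k p U V Φ ≈ sub (es false p) k V (λ W → Φ (U ++ W))
    subset-anti zero    p U V       Φ desc = refl
    subset-anti (suc k) p U []      Φ desc = refl
    subset-anti (suc k) p U (v ∷ V) Φ (v>V ∷ desc) = +-cong (chosen (v ℕ.<? p))
      (trans (subset-anti (suc k) p (U ∷ʳ v) V Φ desc) (sub-≡ (es false p) (suc k) V (λ W → reflexive (≡.cong Φ (++-assoc U (v ∷ []) W)))))
      where
      chosen : _ → es false p v * N.subset k (ℕ.pred p) U V Φ ≈ es false p v * sub (es false p) k V (λ W → Φ (U ++ W))
      chosen (yes v<p) = *-congˡ (trans (subset-anti k (ℕ.pred p) U V Φ desc) (sub-weights k V _ (All.map (λ x<v →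
        let x<p-1 = ℕ.<-≤-trans x<v (ℕ.<⇒≤pred v<p) in
        trans (proj₂ (es-anti x<p-1)) (sym (proj₂ (es-anti {p} (ℕ.<-≤-trans x<p-1 ℕ.pred[n]≤n))))) v>V)))
      chosen (no v≮p) rewrite <ᵇ-false (ℕ.≮⇒≥ v≮p) = trans (zeroˡ _) (sym (zeroˡ _))

    -- Fewer than k integers lie strictly between m + 1 and v.
    sub-exc-vanish : ∀ k m v V Φ → All (v >_) V → AllPairs _>_ V → v ≤ suc m ℕ.+ k → suc m < v → sub (es true (suc m)) k V Φ ≈ 0#
    sub-exc-vanish zero    m v V        Φ _ _ l l′ = contradiction (≡.subst (v ≤_) (ℕ.+-identityʳ (suc m)) l) (ℕ.<⇒≱ l′)
    sub-exc-vanish (suc k) m v []       Φ _ _ l l′ = refl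
    sub-exc-vanish (suc k) m v (v′ ∷ V) Φ (v>v′ ∷ v>V) (v′>V ∷ desc) l l′ = trans
      (+-cong (chosen (suc m ℕ.<? v′)) (sub-exc-vanish (suc k) m v V _ v>V desc l l′)) (+-identityˡ _)
      where
      chosen : _ → es true (suc m) v′ * sub (es true (suc m)) k V Φ ≈ 0#
      chosen (yes m<v′) = trans (*-congˡ (sub-exc-vanish k m v′ V Φ v′>V desc
        (ℕ.≤-pred (ℕ.≤-trans v>v′ (≡.subst (v ≤_) (ℕ.+-suc (suc m) k) l))) m<v′)) (zeroʳ _)
      chosen (no m≮v′) rewrite <ᵇ-false (ℕ.≮⇒≥ m≮v′) = zeroˡ _

    -- Dually, it stays above the positions as soon as its last value does.
    subset-exc : ∀ k m U V Φ → AllPairs _>_ V → E.subset k (k ℕ.+ m) U V Φ ≈ sub (es true (suc m)) k V (λ W → Φ (U ++ W))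
    subset-exc zero    m U V       Φ desc = refl
    subset-exc (suc k) m U []      Φ desc = refl
    subset-exc (suc k) m U (v ∷ V) Φ (v>V ∷ desc) = +-cong (trans (*-congˡ (subset-exc k m U V Φ desc)) (chosen (suc k ℕ.+ m ℕ.<? v) (suc m ℕ.<? v)))
      (trans (subset-exc (suc k) m (U ∷ʳ v) V Φ desc) (sub-≡ (es true (suc m)) (suc k) V (λ W → reflexive (≡.cong Φ (++-assoc U (v ∷ []) W)))))
      where
      S : Carrier
      S = sub (es true (suc m)) k V (λ W → Φ (U ++ W))
      chosen : _ → _ → es true (suc k ℕ.+ m) v * S ≈ es true (suc m) v * S
      chosen (yes l) _ = *-congʳ (trans (proj₁ (es-exc l)) (sym (proj₁ (es-exc (ℕ.≤-<-trans (s≤s (ℕ.m≤n+m m k)) l)))))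
      -- Here m + 1 < v ≤ m + k + 1, and the two weights differ. Both sides vanish, because there is
      -- no room for k smaller values above m + 1.
      chosen (no l) (yes l′) = trans (*-congˡ zero-S) (trans (zeroʳ _) (sym (trans (*-congˡ zero-S) (zeroʳ _))))
        where
        zero-S : S ≈ 0#
        zero-S = sub-exc-vanish k m v V _ v>V desc (≡.subst (λ n → v ≤ suc n) (ℕ.+-comm k m) (ℕ.≮⇒≥ l)) l′
      chosen (no l) (no l′) rewrite <ᵇ-false (ℕ.≮⇒≥ l) | <ᵇ-false (ℕ.≮⇒≥ l′) = refl

    sub-+ : ∀ ω k V (Φ Φ′ : List ℕ → Carrier) → sub ω k V (λ W → Φ W + Φ′ W) ≈ sub ω k V Φ + sub ω k V Φ′
    sub-+ ω zero    V       Φ Φ′ = refl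
    sub-+ ω (suc k) []      Φ Φ′ = sym (+-identityˡ _)
    sub-+ ω (suc k) (v ∷ V) Φ Φ′ = trans (+-cong (trans (*-congˡ (sub-+ ω k V Φ Φ′)) (distribˡ _ _ _)) (sub-+ ω (suc k) V _ _)) (interchange _ _ _ _)
      where open import Algebra.Properties.CommutativeSemigroup +-commutativeSemigroup using (interchange)

    sub-* : ∀ ω k V a (Φ : List ℕ → Carrier) → sub ω k V (λ W → a * Φ W) ≈ a * sub ω k V Φ
    sub-* ω zero    V       a Φ = refl
    sub-* ω (suc k) []      a Φ = sym (zeroʳ a)
    sub-* ω (suc k) (v ∷ V) a Φ = trans (+-cong (*-congˡ (sub-* ω k V a Φ)) (sub-* ω (suc k) V a _))
      (solve 4 (λ w a x y → w :* (a :* x) :+ a :* y := a :* (w :* x :+ y)) refl _ _ _ _)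

    -- Choosing a values for one label and k - a of the others for a second label is choosing k
    -- values and a label for each.
    sub-merge : ∀ ω ω′ V k Φ → Σ≤ k (λ a → sub ω a V (λ W → sub ω′ (k ∸ a) W Φ)) ≈ sub (λ v → ω v + ω′ v) k V Φ
    sub-merge ω ω′ V       zero    Φ = refl
    sub-merge ω ω′ []      (suc k) Φ = trans (+-identityˡ _) (Σ≤-zero k)
    sub-merge ω ω′ (v ∷ V) (suc k) Φ = begin
      (ω′ v * sub ω′ k V Φ + sub ω′ (suc k) V Φᵥ) +
        Σ≤ k (λ a → ω v * sub ω a V (λ W → sub ω′ (k ∸ a) W Φ) + sub ω (suc a) V (λ W → sub ω′ (k ∸ a) (v ∷ W) Φ))
        ≈⟨ +-congˡ (trans (Σ≤-+ k _ _) (+-cong (Σ≤-*ˡ k _ _) (trans (Σ≤-cong k (λ a → trans (sub-≡ ω (suc a) V (λ W → first-step (k ∸ a) W)) (sub-+ ω (suc a) V _ _))) (Σ≤-+ k _ _)))) ⟩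
      (ω′ v * sub ω′ k V Φ + sub ω′ (suc k) V Φᵥ) +
        (ω v * X k Φ + (Σ≤ k (λ a → sub ω (suc a) V (λ W → ε (k ∸ a) W)) + Σ≤ k (λ a → sub ω (suc a) V (λ W → sub ω′ (k ∸ a) W Φᵥ))))
        ≈⟨ solve 5 (λ a b c d e → (a :+ b) :+ (c :+ (d :+ e)) := (c :+ (a :+ d)) :+ (b :+ e)) refl _ _ _ _ _ ⟩
      (ω v * X k Φ + Σ≤ (suc k) (λ a → sub ω a V (λ W → ε (suc k ∸ a) W))) + X (suc k) Φᵥ
        ≈⟨ +-congʳ (+-congˡ excs) ⟩
      (ω v * X k Φ + ω′ v * X k Φ) + X (suc k) Φᵥ
        ≈⟨ +-cong (trans (sym (distribʳ _ _ _)) (*-congˡ (sub-merge ω ω′ V k Φ))) (sub-merge ω ω′ V (suc k) Φᵥ) ⟩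
      (ω v + ω′ v) * sub (λ v → ω v + ω′ v) k V Φ + sub (λ v → ω v + ω′ v) (suc k) V Φᵥ ∎
      where
      Φᵥ : List ℕ → Carrier
      Φᵥ W = Φ (v ∷ W)
      X : ℕ → (List ℕ → Carrier) → Carrier
      X k Φ = Σ≤ k (λ a → sub ω a V (λ W → sub ω′ (k ∸ a) W Φ))
      ε : ℕ → List ℕ → Carrier
      ε zero    W = 0#
      ε (suc j) W = ω′ v * sub ω′ j W Φ
      first-step : ∀ j W → sub ω′ j (v ∷ W) Φ ≈ ε j W + sub ω′ j W Φᵥ
      first-step zero    W = sym (+-identityˡ _)
      first-step (suc j) W = refl
      excs : Σ≤ (suc k) (λ a → sub ω a V (λ W → ε (suc k ∸ a) W)) ≈ ω′ v * X k Φ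
      excs = begin
        Σ≤ (suc k) (λ a → sub ω a V (ε (suc k ∸ a)))
          ≈⟨ Σ≤-last k _ ⟩
        Σ≤ k (λ a → sub ω a V (ε (suc k ∸ a))) + sub ω (suc k) V (ε (k ∸ k))
          ≈⟨ +-cong (Σ≤-cong≤ k (λ a l → trans (reflexive (≡.cong (λ j → sub ω a V (ε j)) (ℕ.+-∸-assoc 1 l))) (sub-* ω a V (ω′ v) _)))
                    (trans (reflexive (≡.cong (λ j → sub ω (suc k) V (ε j)) (ℕ.n∸n≡0 k))) (zero-sub (suc k) V)) ⟩
        Σ≤ k (λ a → ω′ v * sub ω a V (λ W → sub ω′ (k ∸ a) W Φ)) + 0#
          ≈⟨ trans (+-identityʳ _) (Σ≤-*ˡ k _ _) ⟩
        ω′ v * X k Φ ∎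
        where
        zero-sub : ∀ k V → sub ω k V (λ _ → 0#) ≈ 0#
        zero-sub k V = trans (sub-≡ ω k V (λ _ → sym (zeroˡ 0#))) (trans (sub-* ω k V 0# _) (zeroˡ _))

    -- The sets of non-excedances and of excedances determine an ascending block. The position
    -- conditions reduce to the last position of the block for the former and to its first position
    -- for the latter, so the two labels of a value are independent and add up to `w`.
    signedChain-sub : ∀ j m V Φ → AllPairs _>_ V → All (_< B) V →
      signedChain (suc j) (suc j ℕ.+ m) V false B Φ ≈ sub (w m j) (suc j) V Φ
    signedChain-sub j m V Φ desc below = begin
      signedChain (suc j) (suc j ℕ.+ m) V false B Φ
        ≈⟨ signedChain-split (suc j) m V B Φ below ⟩
      Σ≤ (suc j) (λ a → N.chain a (suc j ℕ.+ m) V B (λ V₁ → E.chain (suc j ∸ a) ((suc j ∸ a) ℕ.+ m) V₁ B Φ))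
        ≈⟨ Σ≤-cong (suc j) (λ a → trans (N.chain-subset a (suc j ℕ.+ m) [] V B _ (sorted desc) (All.map (λ _ → []) below) [] (All.map <ᵇ-true below))
             (trans (subset-anti a (suc j ℕ.+ m) [] V _ desc)
             (sub-cong (es false (suc j ℕ.+ m)) a V desc (λ W d i _ →
               trans (E.chain-subset (suc j ∸ a) ((suc j ∸ a) ℕ.+ m) [] W B Φ (sorted d) (All.map (λ _ → []) (i below)) [] (All.map <ᵇ-true (i below)))
                     (subset-exc (suc j ∸ a) m [] W Φ d))))) ⟩
      Σ≤ (suc j) (λ a → sub (es false (suc j ℕ.+ m)) a V (λ W → sub (es true (suc m)) (suc j ∸ a) W Φ))
        ≈⟨ sub-merge (es false (suc j ℕ.+ m)) (es true (suc m)) V (suc j) Φ ⟩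
      sub (w m j) (suc j) V Φ ∎
      where
      sorted : ∀ {V} → AllPairs _>_ V → AllPairs (λ a b → (b <ᵇ a) ≡ true × (a <ᵇ b) ≡ false) V
      sorted = AllPairs.map (λ l → <ᵇ-true l , <ᵇ-false (ℕ.<⇒≤ l))

    Sn-zero : ∀ m → Sn m (λ _ → 0#) ≈ 0#
    Sn-zero m = trans (Sn-cong m (λ _ _ → sym (zeroˡ 0#))) (trans (Sn-* 0# m _) (zeroˡ _))

    sub-Sn : ∀ ω k V m (f : List ℕ → List ℕ → Carrier) → sub ω k V (λ W → Sn m (λ b → f b W)) ≈ Sn m (λ b → sub ω k V (f b))
    sub-Sn ω zero    V       m f = refl
    sub-Sn ω (suc k) []      m f = sym (Sn-zero m)
    sub-Sn ω (suc k) (v ∷ V) m f = trans (+-cong (trans (*-congˡ (sub-Sn ω k V m f)) (sym (Sn-* (ω v) m _))) (sub-Sn ω (suc k) V m _)) (sym (Sn-+ m _ _))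

    Πᵀ : ∀ b → List ℕ → (ℕ → 𝕋.Carrier b) → 𝕋.Carrier b
    Πᵀ b = RingProducts.Π (Tower R b)

    -- The k chosen values are the factors that supply y; `g` accumulates the forms of the values
    -- passed over.
    sub-coef : ∀ ω b k V (L : ℕ → 𝕋.Carrier b) g →
      sub ω k V (λ W → coef b (𝕋._*_ b g (Πᵀ b W L))) ≈
      coef b (𝕋._*_ b g (RingProducts.Π (PS (Tower R b)) V (λ v → PowerSeries.lin (Tower R b) (L v) (ι b (ω v))) k))
    sub-coef ω b zero    V       L g = coef-cong b (T.*-congˡ (constant V))
      where
      module T = CommutativeRing (Tower R b)
      constant : ∀ V → Πᵀ b V L T.≈ RingProducts.Π (PS (Tower R b)) V (λ v → PowerSeries.lin (Tower R b) (L v) (ι b (ω v))) 0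
      constant []      = T.refl
      constant (v ∷ V) = T.*-congˡ (constant V)
    sub-coef ω b (suc k) []      L g = sym (trans (coef-cong b (T.trans (T.*-congˡ (one k)) (T.zeroʳ g))) (coef-0 b))
      where
      module T = CommutativeRing (Tower R b)
      one : ∀ k → PowerSeries.const (Tower R b) T.1# (suc k) T.≈ T.0#
      one zero    = T.refl
      one (suc k) = T.refl
    sub-coef ω b (suc k) (v ∷ V) L g = begin
      ω v * sub ω k V (λ W → coef b (g T.* Πᵀ b W L)) + sub ω (suc k) V (λ W → coef b (g T.* (L v T.* Πᵀ b W L)))
        ≈⟨ +-cong (*-congˡ (sub-coef ω b k V L g)) (trans (sub-≡ ω (suc k) V (λ W → coef-cong b (T.sym (T.*-assoc g (L v) _)))) (sub-coef ω b (suc k) V L (g T.* L v))) ⟩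
      ω v * coef b (g T.* P k) + coef b ((g T.* L v) T.* P (suc k))
        ≈⟨ +-congʳ (coef-ι b (ω v) _) ⟨
      coef b (ι b (ω v) T.* (g T.* P k)) + coef b ((g T.* L v) T.* P (suc k))
        ≈⟨ coef-+ b _ _ ⟨
      coef b (ι b (ω v) T.* (g T.* P k) T.+ (g T.* L v) T.* P (suc k))
        ≈⟨ coef-cong b (ST.solve 5 (λ w g p l s → w ST.:* (g ST.:* p) ST.:+ (g ST.:* l) ST.:* s ST.:= g ST.:* (l ST.:* s ST.:+ w ST.:* p)) T.refl _ _ _ _ _) ⟩
      coef b (g T.* (L v T.* P (suc k) T.+ ι b (ω v) T.* P k))
        ≈⟨ coef-cong b (T.*-congˡ (PowerSeries.lin-mul-suc (Tower R b) (L v) (ι b (ω v)) P k)) ⟨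
      coef b (g T.* RingProducts.Π (PS (Tower R b)) (v ∷ V) (λ v → PowerSeries.lin (Tower R b) (L v) (ι b (ω v))) (suc k)) ∎
      where
      module T = CommutativeRing (Tower R b)
      module ST = DifferenceSolver (Tower R b)
      P : ℕ → T.Carrier
      P = RingProducts.Π (PS (Tower R b)) V (λ v → PowerSeries.lin (Tower R b) (L v) (ι b (ω v)))

  labelled : List ℕ → List ℕ → Carrier
  labelled V b = coef b (Πᵀ b V (Λ b))

  private
    sub-labelled : ∀ j m V → sub (w m j) (suc j) V (λ W → Sn m (labelled W)) ≈ Sn m (λ b → labelled V (j ∷ b))
    sub-labelled j m V = trans (sub-Sn (w m j) (suc j) V m (λ b W → labelled W b)) (Sn-cong m step)
      where
      step : ∀ b → size b ≡ m → sub (w m j) (suc j) V (λ W → labelled W b) ≈ labelled V (j ∷ b)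
      step b ≡.refl = trans (sub-≡ (w m j) (suc j) V (λ W → coef-cong b (T.sym (T.*-identityˡ _))))
        (trans (sub-coef (w m j) b (suc j) V (Λ b) T.1#) (coef-cong b (T.*-identityˡ _)))
        where module T = CommutativeRing (Tower R b)

  -- The pool is an arbitrary descending list, because removing the values of the last block leaves
  -- gaps.
  F₀-labelled : ∀ n p → p ≤ n → ∀ V → AllPairs _>_ V → All (_< B) V → length V ≡ p → F₀ p V ≈ Sn p (labelled V)
  F₀-labelled n       zero    _       []  desc below e = +-identityʳ 1#
  F₀-labelled (suc n) (suc p) (s≤s l) V   desc below e = begin
    F₀ (suc p) V
      ≈⟨ F₀-chains p V below ⟩
    Σ≤ p (λ j → fc p j * (pow q (p ∸ j) * signedChain (suc j) (suc p) V false B (F₀ (p ∸ j))))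
      ≈⟨ Σ≤-cong≤ p (λ j j≤p → *-congˡ (*-congˡ (block j j≤p))) ⟩
    Σ≤ p (λ j → fc p j * (pow q (p ∸ j) * Sn (p ∸ j) (λ b → labelled V (j ∷ b))))
      ≈⟨ Sb-Σ≤ 0 p (labelled V) ⟨
    Sn (suc p) (labelled V) ∎
    where
    block : ∀ j → j ≤ p → signedChain (suc j) (suc p) V false B (F₀ (p ∸ j)) ≈ Sn (p ∸ j) (λ b → labelled V (j ∷ b))
    block j j≤p = begin
      signedChain (suc j) (suc p) V false B (F₀ m)
        ≡⟨ ≡.cong (λ P → signedChain (suc j) (suc P) V false B (F₀ m)) (≡.sym (ℕ.m+[n∸m]≡n j≤p)) ⟩
      signedChain (suc j) (suc j ℕ.+ m) V false B (F₀ m)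
        ≈⟨ signedChain-sub j m V (F₀ m) desc below ⟩
      sub (w m j) (suc j) V (F₀ m)
        ≈⟨ sub-cong (w m j) (suc j) V desc (λ W d i e′ → F₀-labelled n m (ℕ.≤-trans (ℕ.m∸n≤m p j) l) W d (i below) (size-left W e′)) ⟩
      sub (w m j) (suc j) V (λ W → Sn m (labelled W))
        ≈⟨ sub-labelled j m V ⟩
      Sn m (λ b → labelled V (j ∷ b)) ∎
      where
      m : ℕ
      m = p ∸ j
      size-left : ∀ W → suc j ℕ.+ length W ≡ length V → length W ≡ m
      size-left W e′ = ≡.trans (≡.sym (ℕ.m+n∸m≡n j (length W))) (≡.cong (_∸ j) (ℕ.suc-injective (≡.trans e′ e)))

module LeftSideForm {c ℓ : Level} {R : CommutativeRing c ℓ} (D : QData R) where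
  open CommutativeRing R
  open QData D
  open QSums D
  open Eval commutativeSemiring using (A)
  open TowerOps R using (coef-cong; ι-0)
  open TowerOps.Forms R t using (Pcoef)
  open Solution D using (sol)
  open import Relation.Binary.Reasoning.Setoid setoid

  A-closed : ∀ n → A (suc n) t 0# q ≈ qf (suc n) * sol 0# (suc n)
  A-closed n = begin
    A (suc n) t 0# q
      ≈⟨ LeftSideWeights.A-backward D n ⟩
    F₀ (suc n) (desc (suc n))
      ≈⟨ F₀-labelled (suc n) (suc n) ℕ.≤-refl (desc (suc n)) (desc-descending (suc n)) (All.map s≤s (desc≤ (suc n))) (desc-length (suc n)) ⟩
    Sn (suc n) (labelled (desc (suc n)))
      ≈⟨ Sn-cong (suc n) forms ⟩
    Sn (suc n) (Pcoef 0#)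
      ≈⟨ closed-form (suc n) (suc n) ℕ.≤-refl R D 0# ⟩
    qf (suc n) * sol 0# (suc n) ∎
    where
    open LeftSide D (suc (suc n))
    forms : ∀ b → size b ≡ suc n → labelled (desc (suc n)) b ≈ Pcoef 0# b
    forms b e = trans (reflexive (≡.cong (λ m → labelled (desc m) b) (≡.sym e)))
      (coef-cong b (RingProducts.Π-cong (Tower R b) (desc (size b)) (λ v →
        T.sym (T.trans (T.+-congˡ (T.trans (T.*-congʳ (ι-0 b)) (T.zeroˡ _))) (T.+-identityʳ _)))))
      where module T = CommutativeRing (Tower R b)

-- The identity over rings, and its transfer to semirings

ring-identity : ∀ {c ℓ : Level} {R : CommutativeRing c ℓ} (D : QData R) n →
  CommutativeRing._≈_ R (Eval.A (CommutativeRing.commutativeSemiring R) (suc n) (QData.t D) (CommutativeRing.0# R) (QData.q D))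
                        (Eval.RHS (CommutativeRing.commutativeSemiring R) (suc n) (QData.t D) (QData.q D))
ring-identity {R = R} D n = CommutativeRing.trans R (LeftSideForm.A-closed D n) (CommutativeRing.sym R (RightSideForm.RHS-closed D n))

-- The monomial tᵃ qᵇ is represented by (a , b).
Monomial : Set
Monomial = ℕ × ℕ

_≡ᵐ_ : Monomial → Monomial → Bool
(a , b) ≡ᵐ (c , d) = (a ≡ᵇ c) ∧ (b ≡ᵇ d)

count : Monomial → List Monomial → ℕ
count m []       = 0
count m (x ∷ xs) = ind (m ≡ᵐ x) ℕ.+ count m xs

delete : Monomial → List Monomial → List Monomial
delete m []       = []
delete m (x ∷ xs) = if m ≡ᵐ x then xs else x ∷ delete m xs

≡ᵇ-true : ∀ a b → (a ≡ᵇ b) ≡ true → a ≡ b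
≡ᵇ-true a b e = ℕ.≡ᵇ⇒≡ a b (Equivalence.from T-≡ e)

≡ᵐ⇒≡ : ∀ x y → (x ≡ᵐ y) ≡ true → x ≡ y
≡ᵐ⇒≡ (a , b) (c , d) e with a ≡ᵇ c in a≡c | b ≡ᵇ d in b≡d
... | true | true = ≡.cong₂ _,_ (≡ᵇ-true a c a≡c) (≡ᵇ-true b d b≡d)

≡ᵐ-refl : ∀ x → (x ≡ᵐ x) ≡ true
≡ᵐ-refl (a , b) rewrite ≡ᵇ-refl a | ≡ᵇ-refl b = ≡.refl

count-delete : ∀ m y ys k → count m ys ≡ suc k → count y ys ≡ ind (y ≡ᵐ m) ℕ.+ count y (delete m ys)
count-delete m y (x ∷ ys) k e with m ≡ᵐ x in m≡x
... | true  rewrite ≡ᵐ⇒≡ m x m≡x = ≡.refl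
... | false = ≡.trans (≡.cong (ind (y ≡ᵐ x) ℕ.+_) (count-delete m y ys k e)) (x∙yz≈y∙xz (ind (y ≡ᵐ x)) (ind (y ≡ᵐ m)) _)
  where open import Algebra.Properties.CommutativeSemigroup ℕ.+-commutativeSemigroup using (x∙yz≈y∙xz)

-- The exponents of t in (1 + t)ᵐ, listed with multiplicity.
binomials : ℕ → List ℕ
binomials zero    = 0 ∷ []
binomials (suc m) = binomials m ++ map suc (binomials m)

monomialsA : ℕ → List Monomial
monomialsA n = map (λ σ → (exc σ , maj σ ∸ exc σ)) (filter (λ σ → T? (fix σ ≡ᵇ 0)) (perms n))

monomialsRHS : ℕ → List Monomial
monomialsRHS n = concatMap (λ k → concatMap (λ σ → map (λ i → (k ℕ.+ i , inv σ)) (binomials (n ∸ (k ℕ.+ k)))) (Dtilde n k)) (range (n / 2))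

module Evaluation {c ℓ : Level} (S : CommutativeSemiring c ℓ) where
  open CommutativeSemiring S
  open Eval S
  open ListSums S
  open Enumeration S
  open import Relation.Binary.Reasoning.Setoid setoid
  open import Algebra.Properties.CommutativeSemigroup *-commutativeSemigroup using (x∙yz≈y∙xz)

  Σ-counts : ∀ (f : Monomial → Carrier) xs ys → (∀ m → count m xs ≡ count m ys) → Σ[ xs ] f ≈ Σ[ ys ] f
  Σ-counts f []       []       e = refl
  Σ-counts f []       (y ∷ ys) e = contradiction (≡.trans (e y) (≡.cong (λ b → ind b ℕ.+ count y ys) (≡ᵐ-refl y))) (λ ())
  Σ-counts f (x ∷ xs) ys       e = trans (+-congˡ (Σ-counts f xs (delete x ys) (λ m →
      ℕ.+-cancelˡ-≡ (ind (m ≡ᵐ x)) _ _ (≡.trans (e m) (count-delete x m ys _ occurs))))) (sym (Σ-delete ys occurs))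
    where
    occurs : count x ys ≡ suc (count x xs)
    occurs = ≡.trans (≡.sym (e x)) (≡.cong (λ b → ind b ℕ.+ count x xs) (≡ᵐ-refl x))
    Σ-delete : ∀ ys {k} → count x ys ≡ suc k → Σ[ ys ] f ≈ f x + Σ[ delete x ys ] f
    Σ-delete (y ∷ ys) h with x ≡ᵐ y in x≡y
    ... | true  rewrite ≡ᵐ⇒≡ x y x≡y = refl
    ... | false = trans (+-congˡ (Σ-delete ys h)) (y+[x+z] (f y) (f x) _)
      where open import Algebra.Properties.CommutativeSemigroup +-commutativeSemigroup renaming (x∙yz≈y∙xz to y+[x+z])

  module _ (t q : Carrier) where

    value : Monomial → Carrier
    value (a , b) = pow t a * pow q b

    A-monomials : ∀ n → A n t 0# q ≈ Σ[ monomialsA n ] value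
    A-monomials n = begin
      A n t 0# q
        ≈⟨ Σ-cong (perms n) (λ σ → no-fix (fix σ) _ _) ⟩
      Σ[ perms n ] (λ σ → when (fix σ ≡ᵇ 0) (pow t (exc σ) * pow q (maj σ ∸ exc σ)))
        ≈⟨ Σ-filter (λ σ → fix σ ≡ᵇ 0) (perms n) _ ⟨
      Σ[ filter (λ σ → T? (fix σ ≡ᵇ 0)) (perms n) ] (λ σ → pow t (exc σ) * pow q (maj σ ∸ exc σ))
        ≈⟨ Σ-map (λ σ → (exc σ , maj σ ∸ exc σ)) (filter (λ σ → T? (fix σ ≡ᵇ 0)) (perms n)) value ⟨
      Σ[ monomialsA n ] value ∎
      where
      no-fix : ∀ k x y → x * (pow 0# k * y) ≈ when (k ≡ᵇ 0) (x * y)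
      no-fix zero    x y = *-congˡ (*-identityˡ y)
      no-fix (suc k) x y = trans (*-congˡ (trans (*-congʳ (zeroˡ _)) (zeroˡ y))) (zeroʳ x)

    pow-1+t : ∀ m → pow (1# + t) m ≈ Σ[ binomials m ] (pow t)
    pow-1+t zero    = sym (+-identityʳ _)
    pow-1+t (suc m) = begin
      (1# + t) * pow (1# + t) m
        ≈⟨ trans (distribʳ _ _ _) (+-cong (trans (*-identityˡ _) (pow-1+t m)) (*-congˡ (pow-1+t m))) ⟩
      Σ[ binomials m ] (pow t) + t * Σ[ binomials m ] (pow t)
        ≈⟨ +-congˡ (trans (sym (Σ-*ˡ t (binomials m) _)) (sym (Σ-map suc (binomials m) (pow t)))) ⟩
      Σ[ binomials m ] (pow t) + Σ[ map suc (binomials m) ] (pow t)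
        ≈⟨ Σ-++ (binomials m) _ _ ⟨
      Σ[ binomials (suc m) ] (pow t) ∎

    RHS-monomials : ∀ n → RHS n t q ≈ Σ[ monomialsRHS n ] value
    RHS-monomials n = sym (trans (Σ-concatMap _ (range (n / 2)) value) (Σ-cong (range (n / 2)) (λ k → begin
      Σ[ concatMap (λ σ → map (λ i → (k ℕ.+ i , inv σ)) (binomials (n ∸ (k ℕ.+ k)))) (Dtilde n k) ] value
        ≈⟨ Σ-concatMap _ (Dtilde n k) value ⟩
      Σ[ Dtilde n k ] (λ σ → Σ[ map (λ i → (k ℕ.+ i , inv σ)) (binomials (n ∸ (k ℕ.+ k))) ] value)
        ≈⟨ Σ-cong (Dtilde n k) (λ σ → trans (Σ-map _ (binomials (n ∸ (k ℕ.+ k))) value) (trans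
             (Σ-cong (binomials (n ∸ (k ℕ.+ k))) (λ i → trans (*-congʳ (pow-+ t k i)) (trans (*-assoc _ _ _) (trans (*-congˡ (*-comm _ _)) (x∙yz≈y∙xz _ _ _)))))
             (trans (Σ-*ˡ _ (binomials (n ∸ (k ℕ.+ k))) _) (*-congˡ (trans (Σ-*ˡ _ (binomials (n ∸ (k ℕ.+ k))) _) (*-congˡ (sym (pow-1+t (n ∸ (k ℕ.+ k)))))))))) ⟩
      Σ[ Dtilde n k ] (λ σ → pow q (inv σ) * (pow t k * pow (1# + t) (n ∸ (k ℕ.+ k))))
        ≈⟨ Σ-*ʳ _ (Dtilde n k) _ ⟩
      Σ[ Dtilde n k ] (λ σ → pow q (inv σ)) * (pow t k * pow (1# + t) (n ∸ (k ℕ.+ k))) ∎)))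

module GenericPoint where
  ℤ[[t]] : CommutativeRing Level.zero Level.zero
  ℤ[[t]] = PS ℤ.+-*-commutativeRing

  ℤ[[t,q]] : CommutativeRing Level.zero Level.zero
  ℤ[[t,q]] = PS ℤ[[t]]

  private
    module Zₜ = CommutativeRing ℤ[[t]]
    module Zₜq = CommutativeRing ℤ[[t,q]]

  module Powers {c ℓ : Level} (R : CommutativeRing c ℓ) where
    open CommutativeRing R
    open Geometric R using (X; X-suc; X-zero)
    open Eval (CommutativeRing.commutativeSemiring (PS R)) using (pow)

    X-power : ∀ n k → pow X n k ≈ (if k ≡ᵇ n then 1# else 0#)
    X-power zero    zero          = refl
    X-power zero    (suc zero)    = refl
    X-power zero    (suc (suc k)) = refl
    X-power (suc n) zero          = X-zero (pow X n)
    X-power (suc n) (suc k)       = trans (X-suc (pow X n) k) (X-power n k)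

  variable-t : Zₜq.Carrier
  variable-t = PowerSeries.const ℤ[[t]] (Geometric.X ℤ.+-*-commutativeRing)

  variable-q : Zₜq.Carrier
  variable-q = Geometric.X ℤ[[t]]

  -- q is the outer variable of ℤ[[t]][[q]], so 1 - qⁿ⁺¹ is inverted by a geometric series in q.
  generic : QData ℤ[[t,q]]
  generic = record { t = variable-t ; q = variable-q ; ic = λ n → geom (pow X n) ; ic-inverse = λ n → begin
      (Zₜq.1# Zₜq.+ Zₜq.- (X Zₜq.* pow X n)) Zₜq.* geom (pow X n)
        ≈⟨ solve 3 (λ x p g → (:1 :+ :- (x :* p)) :* g := g :+ :- (x :* (p :* g))) Zₜq.refl X (pow X n) (geom (pow X n)) ⟩
      geom (pow X n) Zₜq.+ Zₜq.- (X Zₜq.* (pow X n Zₜq.* geom (pow X n)))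
        ≈⟨ Zₜq.+-congʳ (geom-eq (pow X n)) ⟩
      Zₜq.1# Zₜq.+ X Zₜq.* (pow X n Zₜq.* geom (pow X n)) Zₜq.+ Zₜq.- (X Zₜq.* (pow X n Zₜq.* geom (pow X n)))
        ≈⟨ solve 1 (λ x → :1 :+ x :+ :- x := :1) Zₜq.refl (X Zₜq.* (pow X n Zₜq.* geom (pow X n))) ⟩
      Zₜq.1# ∎ }
    where
    open Geometric ℤ[[t]]
    open Eval Zₜq.commutativeSemiring using (pow)
    open DifferenceSolver ℤ[[t,q]]
    open import Relation.Binary.Reasoning.Setoid Zₜq.setoid

  open Eval Zₜq.commutativeSemiring using (pow; Σ[_]_)
  open Evaluation Zₜq.commutativeSemiring using (value)

  value-coefficient : ∀ x a b → value variable-t variable-q x b a ≡ ℤ.+ ind ((a , b) ≡ᵐ x)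
  value-coefficient (i , j) a b = begin
    (pow variable-t i Zₜq.* pow variable-q j) b a
      ≡⟨ PowerSeries.mul-cong ℤ[[t]] (Constants.const-pow ℤ[[t]] τ i) (λ n → Zₜ.refl) b a ⟩
    (PowerSeries.const ℤ[[t]] (powₜ τ i) Zₜq.* pow variable-q j) b a
      ≡⟨ PowerSeries.const-mul ℤ[[t]] (powₜ τ i) (pow variable-q j) b a ⟩
    (powₜ τ i Zₜ.* pow variable-q j b) a
      ≡⟨ Zₜ.*-congˡ {powₜ τ i} (Powers.X-power ℤ[[t]] j b) a ⟩
    (powₜ τ i Zₜ.* (if b ≡ᵇ j then Zₜ.1# else Zₜ.0#)) a
      ≡⟨ select (b ≡ᵇ j) ⟩
    ℤ.+ ind ((a ≡ᵇ i) ∧ (b ≡ᵇ j)) ∎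
    where
    open ≡.≡-Reasoning
    open Eval Zₜ.commutativeSemiring using () renaming (pow to powₜ)
    τ : Zₜ.Carrier
    τ = Geometric.X ℤ.+-*-commutativeRing
    as-ind : ∀ b → (if b then ℤ.+ 1 else ℤ.+ 0) ≡ ℤ.+ ind b
    as-ind true  = ≡.refl
    as-ind false = ≡.refl
    select : ∀ x → (powₜ τ i Zₜ.* (if x then Zₜ.1# else Zₜ.0#)) a ≡ ℤ.+ ind ((a ≡ᵇ i) ∧ x)
    select true  rewrite ∧-identityʳ (a ≡ᵇ i) = ≡.trans (Zₜ.*-identityʳ (powₜ τ i) a)
      (≡.trans (Powers.X-power ℤ.+-*-commutativeRing i a) (as-ind (a ≡ᵇ i)))
    select false rewrite ∧-zeroʳ (a ≡ᵇ i) = Zₜ.zeroʳ (powₜ τ i) a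

  Σ-coefficient : ∀ xs a b → (Σ[ xs ] value variable-t variable-q) b a ≡ ℤ.+ count (a , b) xs
  Σ-coefficient []       a b = ≡.refl
  Σ-coefficient (x ∷ xs) a b = ≡.cong₂ ℤ._+_ (value-coefficient x a b) (Σ-coefficient xs a b)

  -- At independent t and q the multiplicity of a monomial is an integer coefficient, so the
  -- identity in this one ring shows that both lists are the same multiset.
  counts : ∀ n m → count m (monomialsA (suc n)) ≡ count m (monomialsRHS (suc n))
  counts n (a , b) = ℤ.+-injective (begin
    ℤ.+ count (a , b) (monomialsA (suc n))
      ≡⟨ Σ-coefficient (monomialsA (suc n)) a b ⟨
    (Σ[ monomialsA (suc n) ] value variable-t variable-q) b a
      ≡⟨ E.A-monomials variable-t variable-q (suc n) b a ⟨
    Eval.A Zₜq.commutativeSemiring (suc n) variable-t Zₜq.0# variable-q b a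
      ≡⟨ ring-identity generic n b a ⟩
    Eval.RHS Zₜq.commutativeSemiring (suc n) variable-t variable-q b a
      ≡⟨ E.RHS-monomials variable-t variable-q (suc n) b a ⟩
    (Σ[ monomialsRHS (suc n) ] value variable-t variable-q) b a
      ≡⟨ Σ-coefficient (monomialsRHS (suc n)) a b ⟩
    ℤ.+ count (a , b) (monomialsRHS (suc n)) ∎)
    where
    open ≡.≡-Reasoning
    module E = Evaluation Zₜq.commutativeSemiring

theorem1p5 : ∀ {c ℓ : Level} (R : CommutativeSemiring c ℓ) (n : ℕ) → n ≥ 1 →
    (t q : CommutativeSemiring.Carrier R) →
    CommutativeSemiring._≈_ R (Eval.A R n t (CommutativeSemiring.0# R) q) (Eval.RHS R n t q)
theorem1p5 R (suc n) _ t q = trans (A-monomials t q (suc n)) (trans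
  (Σ-counts (value t q) (monomialsA (suc n)) (monomialsRHS (suc n)) (GenericPoint.counts n)) (sym (RHS-monomials t q (suc n))))
  where
  open CommutativeSemiring R
  open Evaluation R
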